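{- There is an absolute constant $c>0$ such that for all sufficiently large $N$, there exists a $K_4^-$-free $3$-uniform hypergraph $H$ on $N$ vertices whose complement contains no copy of $S_n$, where $n = c\sqrt{N\log N}$. In other words, $r(K_4^-, S_n) = \Omega(n^2/\log n)$.
   Context: A $3$-uniform hypergraph ($3$-graph) $H$ consists of a vertex set $V(H)$ and a set $E(H)$ of $3$-element subsets of $V(H)$. $K_4^-$ denotes the unique $3$-graph with four vertices and three edges; $H$ is $K_4^-$-free if it contains no copy of $K_4^-$ as a subhypergraph. The complement of $H$ is the $3$-graph on $V(H)$ whose edges are the $3$-subsets of $V(H)$ not in $E(H)$. The $n$-vertex star $S_n$ is the $3$-graph with vertex set $\{1,\dots,n\}$ and edge set $\{e\in\binom{[n]}{3} : 1\in e\}$. For $3$-graphs $G,F$, the Ramsey number $r(G,F)$ is the minimum $N$ such that every red/blue colouring of the edges of the complete $3$-graph on $N$ vertices contains a red copy of $G$ or a blue copy of $F$. -}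

module Defs where

open import Data.Nat using (ℕ; zero; suc; _+_; _*_; _<_; _≤_)
open import Data.Nat.Logarithm using (⌊log₂_⌋)
open import Data.Fin using (Fin; toℕ)
open import Data.Product using (Σ; _×_; _,_; ∃-syntax)
open import Data.Sum using (_⊎_; inj₁; inj₂)
open import Relation.Nullary using (¬_)
open import Relation.Binary.PropositionalEquality using (_≡_)
open import Function.Definitions using (Injective)

-- A 3-uniform hypergraph on vertex type V: a predicate E on triples,
-- invariant under permutations of the triple.  Only triples of pairwise
-- distinct vertices are ever inspected (see _⊆_ below), so E x y z
-- represents "{x,y,z} is an edge" for distinct x, y, z.
record 3Graph (V : Set) : Set₁ where
  field
    E     : V → V → V → Set
    sym₁₂ : ∀ {x y z} → E x y z → E y x z
    sym₂₃ : ∀ {x y z} → E x y z → E x z y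
open 3Graph public

Distinct₃ : {V : Set} → V → V → V → Set
Distinct₃ x y z = ¬ x ≡ y × ¬ y ≡ z × ¬ x ≡ z

complement : {V : Set} → 3Graph V → 3Graph V
complement H = record
  { E     = λ x y z → ¬ E H x y z
  ; sym₁₂ = λ ne e → ne (sym₁₂ H e)
  ; sym₂₃ = λ ne e → ne (sym₂₃ H e)
  }

_⊆_ : {U V : Set} → 3Graph U → 3Graph V → Set
_⊆_ {U} {V} F H =
  Σ (U → V) λ f → Injective _≡_ _≡_ f ×
    (∀ a b c → Distinct₃ a b c → E F a b c → E H (f a) (f b) (f c))

-- The star S_n on vertex set Fin n (vertex 0 plays the role of vertex 1
-- in the paper): edges are the triples containing vertex 0.
Star : (n : ℕ) → 3Graph (Fin n)
Star n = record
  { E     = λ x y z → toℕ x ≡ 0 ⊎ toℕ y ≡ 0 ⊎ toℕ z ≡ 0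
  ; sym₁₂ = s₁₂
  ; sym₂₃ = s₂₃
  }
  where
  P : Fin n → Fin n → Fin n → Set
  P x y z = toℕ x ≡ 0 ⊎ toℕ y ≡ 0 ⊎ toℕ z ≡ 0
  s₁₂ : ∀ {x y z} → P x y z → P y x z
  s₁₂ (inj₁ p) = inj₂ (inj₁ p)
  s₁₂ (inj₂ (inj₁ p)) = inj₁ p
  s₁₂ (inj₂ (inj₂ p)) = inj₂ (inj₂ p)
  s₂₃ : ∀ {x y z} → P x y z → P x z y
  s₂₃ (inj₁ p) = inj₁ p
  s₂₃ (inj₂ (inj₁ p)) = inj₂ (inj₂ p)
  s₂₃ (inj₂ (inj₂ p)) = inj₂ (inj₁ p)

-- K₄⁻ : the 3-graph on 4 vertices with 3 edges.  Any three of the four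
-- triples of a 4-set share a common vertex, so (up to isomorphism) K₄⁻ is
-- the 3-graph on Fin 4 whose edges are the three triples containing 0.
K₄⁻ : 3Graph (Fin 4)
K₄⁻ = Star 4

K₄⁻-free : {V : Set} → 3Graph V → Set
K₄⁻-free H = ¬ (K₄⁻ ⊆ H)

module Submission where

-- The links of a K₄⁻-free 3-graph are triangle-free graphs, so the theorem asks for the bound
-- R(3,t) = Ω(t²/log t) in all links simultaneously.  Group the N vertices into clusters of size
-- O(log N) in two ways, by a fixed (red) and by a random (blue) partition, and draw for each colour a
-- random 3-graph on the m clusters, of density about 1/√m.  A triple of vertices is an edge if, in
-- one of the colours, its clusters form a chosen triple and it does not complete a K₄⁻ with two
-- chosen triples of the other colour, or with two chosen triples of its own colour that come
-- earlier in a fixed order.  Two of the three edges of a K₄⁻ have the same colour, so no K₄⁻ arises.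
--
-- A set of C√(N log N) vertices meets many clusters of one of the colours.  In the link of any
-- vertex only a small constant fraction of the pairs of such a set is closed: paths of length two
-- are counted by an exponential supermartingale, apart from those through vertices of large
-- degree into the set, which are few because codegrees are small.  Blowing up clusters leaves this
-- fraction unchanged and raises the density by the missing factor √(log N): exposing the triples
-- of that colour in order, the probability that no open one is chosen beats the union bound.

-- Why clusters help: a star whose `K` leaves lie in distinct clusters has about `K * K` open
-- triples, each chosen with probability `1/q`, and must beat a union bound over about `N ^ K`
-- stars. So `K` has to be of order `q log N`, that is √m log m. For `m` vertices this is too large
-- by √(log m); for `N` of order m log m it is exactly √(N log N).
--
-- Why two colours: `K` clusters hold about K log N vertices, so with one partition a star of the
-- desired size could be squeezed into few clusters. Any `K` red and any `K` blue clusters share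
-- fewer than `20 * K` vertices if the blue partition is random, so `20 * K` leaves contain `K` that
-- one colour separates. In the other colour these may collide, up to `s` to a cluster, and closed
-- pairs must still be few there; hence families with bounded multiplicity throughout.
--
-- Probabilities are counts of outcomes, and exponentials are powers of 1 + 1/n with denominators
-- cleared. Assumptions such as small degrees are made part of the rare events, so that tail bounds
-- need neither stopping times nor conditioning on typical behaviour.

open import Defs
open import Data.Bool using (Bool; true; false; if_then_else_)
import Data.Bool.Properties as Bool
open import Data.Empty using (⊥; ⊥-elim)
open import Data.Fin as Fin using (Fin; toℕ; fromℕ<; combine; zero; suc; inject≤; quotient; remainder)
import Data.Fin.Properties as Fin
open import Data.List using (List; []; _∷_; _++_; length; map; filter; allFin; cartesianProduct; cartesianProductWith)
open import Data.List.Properties using (length-tabulate; length-++; length-map; map-tabulate)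
open import Data.List.Membership.Propositional using (_∈_; _∉_)
open import Data.List.Membership.Propositional.Properties
  using (∈-++⁻; ∈-++⁺ˡ; ∈-++⁺ʳ; ∈-allFin; ∈-filter⁻; ∈-cartesianProduct⁺; ∈-cartesianProductWith⁺)
open import Data.List.Relation.Binary.Permutation.Propositional using (_↭_; prep; swap; ↭-sym; ↭-trans; ↭-refl)
  renaming (refl to refl↭; trans to trans↭)
open import Data.List.Relation.Binary.Permutation.Propositional.Properties using (shift; ↭-length)
open import Data.List.Relation.Unary.All as All using (All; []; _∷_)
open import Data.List.Relation.Unary.All.Properties using (all-filter)
open import Data.List.Relation.Unary.AllPairs using (AllPairs; []; _∷_)
open import Data.List.Relation.Unary.AllPairs.Properties using (tabulate⁺-<)
open import Data.List.Relation.Unary.Any using (here; there)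
open import Data.List.Relation.Unary.Unique.Propositional using (Unique)
open import Data.List.Relation.Unary.Unique.Propositional.Properties using (allFin⁺; filter⁺)
open import Data.Nat
open import Data.Nat.Logarithm using (⌊log₂_⌋; ⌊log₂⌋-mono-≤; ⌊log₂[2^n]⌋≡n)
open import Data.Nat.Properties
open import Algebra.Properties.CommutativeSemigroup +-commutativeSemigroup using (interchange)
open import Data.Nat.Tactic.RingSolver using (solve-∀)
open import Data.Product using (_×_; _,_; ∃; ∃-syntax; Σ; Σ-syntax; proj₁; proj₂)
open import Data.Sum using (_⊎_; inj₁; inj₂)
open import Data.Unit using (tt)
open import Data.Vec as Vec using (Vec; []; _∷_; lookup; tabulate; _[_]≔_; replicate)
open import Data.Vec.Properties
  using ([]≔-commutes; lookup∘update; lookup∘update′; lookup-replicate; lookup∘tabulate; tabulate-cong; tabulate∘lookup; lookup-map)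
open import Function using (_∘_; id)
open import Relation.Binary.Definitions using (Tri; tri<; tri≈; tri>)
open import Relation.Binary.PropositionalEquality
open import Relation.Nullary using (¬_; Dec; yes; no; ¬?; _×-dec_; _⊎-dec_)

-- Finite sums

private variable
  I I′ Φ Ψ : Set

∑ : List I → (I → ℕ) → ℕ
∑ []       f = 0
∑ (x ∷ xs) f = f x + ∑ xs f

infixr 5 ∑
syntax ∑ xs (λ x → e) = ∑[ x ← xs ] e

∑-mono∈ : ∀ (xs : List I) {f g : I → ℕ} → (∀ x → x ∈ xs → f x ≤ g x) → ∑ xs f ≤ ∑ xs g
∑-mono∈ []       p = z≤n
∑-mono∈ (x ∷ xs) p = +-mono-≤ (p x (here refl)) (∑-mono∈ xs (λ y y∈ → p y (there y∈)))

∑-mono : ∀ (xs : List I) {f g : I → ℕ} → (∀ x → f x ≤ g x) → ∑ xs f ≤ ∑ xs g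
∑-mono xs p = ∑-mono∈ xs (λ x _ → p x)

∑-cong : ∀ (xs : List I) {f g : I → ℕ} → (∀ x → f x ≡ g x) → ∑ xs f ≡ ∑ xs g
∑-cong []       p = refl
∑-cong (x ∷ xs) p = cong₂ _+_ (p x) (∑-cong xs p)

∑-zero : ∀ (xs : List I) → ∑ xs (λ _ → 0) ≡ 0
∑-zero []       = refl
∑-zero (x ∷ xs) = ∑-zero xs

∑-+ : ∀ (xs : List I) (f g : I → ℕ) → ∑ xs (λ x → f x + g x) ≡ ∑ xs f + ∑ xs g
∑-+ []       f g = refl
∑-+ (x ∷ xs) f g = trans (cong (f x + g x +_) (∑-+ xs f g)) (interchange (f x) (g x) _ _)

∑²-+ : ∀ (xs : List I) (ys : List I′) (f g : I → I′ → ℕ) → ∑[ x ← xs ] ∑[ y ← ys ] (f x y + g x y)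
  ≡ (∑[ x ← xs ] ∑[ y ← ys ] f x y) + (∑[ x ← xs ] ∑[ y ← ys ] g x y)
∑²-+ xs ys f g = trans (∑-cong xs (λ x → ∑-+ ys (f x) (g x))) (∑-+ xs _ _)

∑-*ˡ : ∀ (xs : List I) c (f : I → ℕ) → ∑ xs (λ x → c * f x) ≡ c * ∑ xs f
∑-*ˡ []       c f = sym (*-zeroʳ c)
∑-*ˡ (x ∷ xs) c f = trans (cong (c * f x +_) (∑-*ˡ xs c f)) (sym (*-distribˡ-+ c (f x) _))

∑-*ʳ : ∀ (xs : List I) c (f : I → ℕ) → ∑ xs (λ x → f x * c) ≡ ∑ xs f * c
∑-*ʳ xs c f = trans (∑-cong xs (λ x → *-comm (f x) c)) (trans (∑-*ˡ xs c f) (*-comm c _))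

∑-const : ∀ (xs : List I) c → ∑ xs (λ _ → c) ≡ length xs * c
∑-const []       c = refl
∑-const (x ∷ xs) c = cong (c +_) (∑-const xs c)

∑-bound : ∀ (xs : List I) {f : I → ℕ} {c} → (∀ x → f x ≤ c) → ∑ xs f ≤ length xs * c
∑-bound xs {c = c} p = ≤-trans (∑-mono xs p) (≤-reflexive (∑-const xs c))

∑-swap : ∀ (xs : List I) (ys : List I′) (f : I → I′ → ℕ) →
  ∑[ x ← xs ] ∑[ y ← ys ] f x y ≡ ∑[ y ← ys ] ∑[ x ← xs ] f x y
∑-swap []       ys f = sym (∑-zero ys)
∑-swap (x ∷ xs) ys f = trans (cong (∑ ys (f x) +_) (∑-swap xs ys f)) (sym (∑-+ ys (f x) _))

∑-++ : ∀ (xs ys : List I) (f : I → ℕ) → ∑ (xs ++ ys) f ≡ ∑ xs f + ∑ ys f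
∑-++ []       ys f = refl
∑-++ (x ∷ xs) ys f = trans (cong (f x +_) (∑-++ xs ys f)) (sym (+-assoc (f x) _ _))

∑-∈ : ∀ {xs : List I} (f : I → ℕ) {x} → x ∈ xs → f x ≤ ∑ xs f
∑-∈ f (here refl) = m≤m+n _ _
∑-∈ f (there p)   = ≤-trans (∑-∈ f p) (m≤n+m _ _)

∑≡0⇒ : ∀ {xs : List I} (f : I → ℕ) → ∑ xs f ≡ 0 → ∀ {x} → x ∈ xs → f x ≡ 0
∑≡0⇒ f e x∈ = n≤0⇒n≡0 (≤-trans (∑-∈ f x∈) (≤-reflexive e))

∑-<⇒ : ∀ (xs : List I) {f g : I → ℕ} → ∑ xs f < ∑ xs g → ∃ λ x → x ∈ xs × f x < g x
∑-<⇒ (x ∷ xs) {f} {g} lt with f x <? g x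
... | yes p = x , here refl , p
... | no ¬p with ∑-<⇒ xs (+-cancelˡ-< (g x) _ _ (≤-<-trans (+-monoˡ-≤ (∑ xs f) (≮⇒≥ ¬p)) lt))
...   | y , y∈ , q = y , there y∈ , q

𝟙 : Dec Φ → ℕ
𝟙 (yes _) = 1
𝟙 (no  _) = 0

𝟙≤1 : (d : Dec Φ) → 𝟙 d ≤ 1
𝟙≤1 (yes _) = ≤-refl
𝟙≤1 (no  _) = z≤n

𝟙-yes : (d : Dec Φ) → Φ → 𝟙 d ≡ 1
𝟙-yes (yes _) p = refl
𝟙-yes (no ¬p) p = ⊥-elim (¬p p)

𝟙-no : (d : Dec Φ) → ¬ Φ → 𝟙 d ≡ 0
𝟙-no (yes p) ¬p = ⊥-elim (¬p p)
𝟙-no (no  _) ¬p = refl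

1≤𝟙⇒ : (d : Dec Φ) → 1 ≤ 𝟙 d → Φ
1≤𝟙⇒ (yes p) _ = p

𝟙≡0⇒ : (d : Dec Φ) → 𝟙 d ≡ 0 → ¬ Φ
𝟙≡0⇒ (no ¬p) _ = ¬p

𝟙-≤ : (d : Dec Φ) {n : ℕ} → (Φ → 1 ≤ n) → 𝟙 d ≤ n
𝟙-≤ (yes p) f = f p
𝟙-≤ (no  _) f = z≤n

𝟙-mono : (d : Dec Φ) (e : Dec Ψ) → (Φ → Ψ) → 𝟙 d ≤ 𝟙 e
𝟙-mono d e f = 𝟙-≤ d (λ p → ≤-reflexive (sym (𝟙-yes e (f p))))

𝟙-*-≤ : (d : Dec Φ) (e : Dec Ψ) {n : ℕ} → (Φ → Ψ → 1 ≤ n) → 𝟙 d * 𝟙 e ≤ n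
𝟙-*-≤ (yes p) (yes q) f = f p q
𝟙-*-≤ (yes _) (no  _) f = z≤n
𝟙-*-≤ (no  _) _       f = z≤n

𝟙-cover : (d : Dec Φ) (e : Dec Ψ) → 1 ≤ 𝟙 (¬? d ×-dec ¬? e) + (𝟙 d + 𝟙 e)
𝟙-cover (yes _) _       = s≤s z≤n
𝟙-cover (no  _) (yes _) = s≤s z≤n
𝟙-cover (no  _) (no  _) = s≤s z≤n

∑-𝟙-≤1 : ∀ {P : I → Set} (P? : ∀ x → Dec (P x)) {xs} → Unique xs →
  (∀ {x y} → P x → P y → x ≡ y) → ∑[ x ← xs ] 𝟙 (P? x) ≤ 1
∑-𝟙-≤1 P? {[]}     u         inj = z≤n
∑-𝟙-≤1 P? {x ∷ xs} (x∉ ∷ u) inj with P? x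
... | no  _ = ∑-𝟙-≤1 P? u inj
... | yes p = ≤-reflexive (cong suc (n≤0⇒n≡0 (≤-trans (∑-mono∈ xs rest) (≤-reflexive (∑-zero xs)))))
  where
  rest : ∀ y → y ∈ xs → 𝟙 (P? y) ≤ 0
  rest y y∈ = 𝟙-≤ (P? y) (λ py → ⊥-elim (All.lookup x∉ y∈ (inj p py)))

∑-filter : ∀ {P : I → Set} (P? : ∀ x → Dec (P x)) (f : I → ℕ) xs →
  ∑[ x ← xs ] 𝟙 (P? x) * f x ≡ ∑ (filter P? xs) f
∑-filter P? f []       = refl
∑-filter P? f (x ∷ xs) with P? x in eq
... | yes p = cong₂ _+_ (*-identityˡ (f x)) (∑-filter P? f xs)
... | no  _ = ∑-filter P? f xs

-- Power inequalities

module _ where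

  open ≤-Reasoning

  *-monoʳ : ∀ a {b c} → b ≤ c → a * b ≤ a * c
  *-monoʳ a = *-monoʳ-≤ a

  *-monoˡ : ∀ c {a b} → a ≤ b → a * c ≤ b * c
  *-monoˡ c = *-monoˡ-≤ c

  -- Divided out, this is (1 + 1/(2h))^a ≤ 1 + a/h, a form of e^x ≤ 1 + 2x for small x. The range of
  -- `a` is what makes the error (h + a)/(2h) of an induction step at most 1.
  double-growth : ∀ h a → a ≤ h → (2 * h + 1) ^ a * h ≤ (2 * h) ^ a * (h + a)
  double-growth h zero    _   = ≤-reflexive (cong (1 *_) (sym (+-identityʳ h)))
  double-growth h (suc a) a<h = begin
    (2 * h + 1) * (2 * h + 1) ^ a * h   ≡⟨ *-assoc (2 * h + 1) _ h ⟩
    (2 * h + 1) * ((2 * h + 1) ^ a * h) ≤⟨ *-monoʳ (2 * h + 1) (double-growth h a (<⇒≤ a<h)) ⟩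
    (2 * h + 1) * (X * (h + a))         ≡⟨ e₁ h a X ⟩
    X * (2 * h * (h + a) + h + a)       ≤⟨ *-monoʳ X (+-monoʳ-≤ (2 * h * (h + a) + h) (<⇒≤ a<h)) ⟩
    X * (2 * h * (h + a) + h + h)       ≡⟨ e₂ h a X ⟩
    2 * h * X * (h + suc a)             ∎
    where
    X = (2 * h) ^ a
    e₁ : ∀ h a X → (2 * h + 1) * (X * (h + a)) ≡ X * (2 * h * (h + a) + h + a)
    e₁ = solve-∀
    e₂ : ∀ h a X → X * (2 * h * (h + a) + h + h) ≡ 2 * h * X * (h + suc a)
    e₂ = solve-∀

  bernoulli : ∀ n a → (n + a) * n ^ a ≤ n * (n + 1) ^ a
  bernoulli n zero    = ≤-reflexive (cong (_* 1) (+-identityʳ n))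
  bernoulli n (suc a) = begin
    (n + suc a) * (n * n ^ a)            ≤⟨ m≤m+n _ (a * n ^ a) ⟩
    (n + suc a) * (n * n ^ a) + a * n ^ a ≡⟨ e₁ n a (n ^ a) ⟩
    (n + 1) * ((n + a) * n ^ a)          ≤⟨ *-monoʳ (n + 1) (bernoulli n a) ⟩
    (n + 1) * (n * (n + 1) ^ a)          ≡⟨ e₂ n ((n + 1) ^ a) ⟩
    n * ((n + 1) * (n + 1) ^ a)          ∎
    where
    e₁ : ∀ n a X → (n + suc a) * (n * X) + a * X ≡ (n + 1) * ((n + a) * X)
    e₁ = solve-∀
    e₂ : ∀ n X → (n + 1) * (n * X) ≡ n * ((n + 1) * X)
    e₂ = solve-∀

  -- Read as (1 + 1/n)^k ≤ 1/(1 - k/n). The split n = k + r avoids subtraction, and the induction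
  -- moves one unit from `k` to `r`.
  inverse-bernoulli : ∀ n k r → n ≡ k + r → (n + 1) ^ k * r ≤ n ^ k * n
  inverse-bernoulli n zero    r refl = ≤-refl
  inverse-bernoulli n (suc k) r eq = begin
    (n + 1) * X * r     ≡⟨ e₁ n X r ⟩
    X * (n * r + r)     ≤⟨ *-monoʳ X (+-monoʳ-≤ (n * r) (≤-trans (m≤n+m r (suc k)) (≤-reflexive (sym eq)))) ⟩
    X * (n * r + n)     ≡⟨ e₂ n X r ⟩
    n * (X * suc r)     ≤⟨ *-monoʳ n (inverse-bernoulli n k (suc r) (trans eq (sym (+-suc k r)))) ⟩
    n * (n ^ k * n)     ≡⟨ *-assoc n (n ^ k) n ⟨
    n * n ^ k * n       ∎
    where
    X = (n + 1) ^ k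
    e₁ : ∀ n X r → (n + 1) * X * r ≡ X * (n * r + r)
    e₁ = solve-∀
    e₂ : ∀ n X r → X * (n * r + n) ≡ n * (X * suc r)
    e₂ = solve-∀

  half-exponential : ∀ k .{{_ : NonZero k}} → (2 * k + 1) ^ k ≤ 2 * (2 * k) ^ k
  half-exponential k = *-cancelʳ-≤ _ _ k (begin
    (2 * k + 1) ^ k * k   ≤⟨ inverse-bernoulli (2 * k) k k (cong (k +_) (+-identityʳ k)) ⟩
    (2 * k) ^ k * (2 * k) ≡⟨ e k ((2 * k) ^ k) ⟩
    2 * (2 * k) ^ k * k   ∎)
    where
    e : ∀ k X → X * (2 * k) ≡ 2 * X * k
    e = solve-∀

  exponential≥2 : ∀ h .{{_ : NonZero h}} → 2 * h ^ h ≤ (h + 1) ^ h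
  exponential≥2 h = *-cancelˡ-≤ h (begin
    h * (2 * h ^ h) ≡⟨ e h (h ^ h) ⟩
    (h + h) * h ^ h ≤⟨ bernoulli h h ⟩
    h * (h + 1) ^ h ∎)
    where
    e : ∀ h X → h * (2 * X) ≡ (h + h) * X
    e = solve-∀

  -- For q = p + 1 this is (1 - 1/q)^q ≤ 1/2: the gain from `q` open coordinates none of which is
  -- chosen.
  pred-power : ∀ p → 2 * p ^ suc p ≤ suc p ^ suc p
  pred-power zero      = z≤n
  pred-power p@(suc _) = *-cancelˡ-≤ p (begin
    p * (2 * p ^ suc p)       ≡⟨ e p (p ^ suc p) ⟩
    (p + p) * p ^ suc p       ≤⟨ *-monoˡ (p ^ suc p) (+-monoʳ-≤ p (n≤1+n p)) ⟩
    (p + suc p) * p ^ suc p   ≤⟨ bernoulli p (suc p) ⟩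
    p * (p + 1) ^ suc p       ≡⟨ cong (λ z → p * z ^ suc p) (+-comm p 1) ⟩
    p * suc p ^ suc p         ∎)
    where
    e : ∀ h X → h * (2 * X) ≡ (h + h) * X
    e = solve-∀

  *-^ : ∀ z a b → (a * b) ^ z ≡ a ^ z * b ^ z
  *-^ zero    a b = refl
  *-^ (suc z) a b = trans (cong (a * b *_) (*-^ z a b)) (e a b (a ^ z) (b ^ z))
    where
    e : ∀ a b X Y → a * b * (X * Y) ≡ a * X * (b * Y)
    e = solve-∀

  ^-scale : ∀ c {a b} k z → c * a ^ k ≤ b ^ k → c ^ z * a ^ (k * z) ≤ b ^ (k * z)
  ^-scale c {a} {b} k z p = begin
    c ^ z * a ^ (k * z)   ≡⟨ cong (c ^ z *_) (^-*-assoc a k z) ⟨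
    c ^ z * (a ^ k) ^ z   ≡⟨ *-^ z c (a ^ k) ⟨
    (c * a ^ k) ^ z       ≤⟨ ^-monoˡ-≤ z p ⟩
    (b ^ k) ^ z           ≡⟨ ^-*-assoc b k z ⟩
    b ^ (k * z)           ∎

  ^-scale′ : ∀ c {a b} k z → b ^ k ≤ c * a ^ k → b ^ (k * z) ≤ c ^ z * a ^ (k * z)
  ^-scale′ c {a} {b} k z p = begin
    b ^ (k * z)           ≡⟨ ^-*-assoc b k z ⟨
    (b ^ k) ^ z           ≤⟨ ^-monoˡ-≤ z p ⟩
    (c * a ^ k) ^ z       ≡⟨ *-^ z c (a ^ k) ⟩
    c ^ z * (a ^ k) ^ z   ≡⟨ cong (c ^ z *_) (^-*-assoc a k z) ⟩
    c ^ z * a ^ (k * z)   ∎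

  -- With β = t/s ≥ 1 the claim is β^x ≤ β^(x ∸ a) β^a, the powers of `s` clearing denominators. It
  -- is an identity unless the subtraction truncates, which happens when a jump overshoots its
  -- target.
  ∸-cross : ∀ {s t} → s ≤ t → ∀ x a → t ^ x * s ^ a * s ^ (x ∸ a) ≤ t ^ (x ∸ a) * s ^ x * t ^ a
  ∸-cross {s} {t} s≤t zero a rewrite 0∸n≡0 a = begin
    1 * s ^ a * 1 ≡⟨ trans (*-identityʳ _) (*-identityˡ _) ⟩
    s ^ a         ≤⟨ ^-monoˡ-≤ a s≤t ⟩
    t ^ a         ≡⟨ *-identityˡ _ ⟨
    1 * t ^ a     ∎
  ∸-cross {s} {t} s≤t (suc x) zero = ≤-reflexive (e (t * t ^ x) (s * s ^ x))
    where
    e : ∀ X Y → X * 1 * Y ≡ X * Y * 1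
    e = solve-∀
  ∸-cross {s} {t} s≤t (suc x) (suc a) = begin
    t * t ^ x * (s * s ^ a) * s ^ (x ∸ a) ≡⟨ e₁ s t (t ^ x) (s ^ a) (s ^ (x ∸ a)) ⟩
    s * t * (t ^ x * s ^ a * s ^ (x ∸ a)) ≤⟨ *-monoʳ (s * t) (∸-cross s≤t x a) ⟩
    s * t * (t ^ (x ∸ a) * s ^ x * t ^ a) ≡⟨ e₂ s t (t ^ (x ∸ a)) (s ^ x) (t ^ a) ⟩
    t ^ (x ∸ a) * (s * s ^ x) * (t * t ^ a) ∎
    where
    e₁ : ∀ s t X Y Z → t * X * (s * Y) * Z ≡ s * t * (X * Y * Z)
    e₁ = solve-∀
    e₂ : ∀ s t X Y Z → s * t * (X * Y * Z) ≡ X * (s * Y) * (t * Z)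
    e₂ = solve-∀

-- Exposing random coordinates one at a time

repeat : ∀ {A : Set} → ℕ → List A → List A
repeat zero    xs = []
repeat (suc n) xs = xs ++ repeat n xs

∑-repeat : ∀ {A : Set} n (xs : List A) (f : A → ℕ) → ∑ (repeat n xs) f ≡ n * ∑ xs f
∑-repeat zero    xs f = refl
∑-repeat (suc n) xs f = trans (∑-++ xs _ f) (cong (∑ xs f +_) (∑-repeat n xs f))

∈-repeat⁻ : ∀ {A : Set} n {xs : List A} {x} → x ∈ repeat n xs → x ∈ xs
∈-repeat⁻ (suc n) {xs} p with ∈-++⁻ xs p
... | inj₁ q = q
... | inj₂ q = ∈-repeat⁻ n q

∈-repeat⁺ : ∀ {A : Set} n .{{_ : NonZero n}} {xs : List A} {x} → x ∈ xs → x ∈ repeat n xs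
∈-repeat⁺ (suc n) p = ∈-++⁺ˡ p

module Exposure (T q′ : ℕ) {{_ : NonZero q′}} where

  q : ℕ
  q = suc q′

  State : Set
  State = Vec Bool T

  infixl 6 _⊕_
  _⊕_ : State → Fin T → State
  ω ⊕ c = ω [ c ]≔ true

  ∅ : State
  ∅ = replicate T false

  bit : State → Fin T → ℕ
  bit ω c = if lookup ω c then 1 else 0

  infix 4 _⊑_
  _⊑_ : State → State → Set
  ω ⊑ F = ∀ c → lookup ω c ≡ true → lookup F c ≡ true

  ⊑-refl : ∀ {ω} → ω ⊑ ω
  ⊑-refl c e = e

  ⊑-trans : ∀ {ω F G} → ω ⊑ F → F ⊑ G → ω ⊑ G
  ⊑-trans p r c e = r c (p c e)

  ⊑-⊕ : ∀ ω c → ω ⊑ ω ⊕ c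
  ⊑-⊕ ω c e p with e Fin.≟ c
  ... | yes refl = lookup∘update c ω true
  ... | no  e≢c  = trans (lookup∘update′ e≢c ω true) p

  bit≤1 : ∀ ω c → bit ω c ≤ 1
  bit≤1 ω c with lookup ω c
  ... | true  = ≤-refl
  ... | false = z≤n

  bit-mono : ∀ {ω F} → ω ⊑ F → ∀ c → bit ω c ≤ bit F c
  bit-mono {ω} {F} s c with lookup ω c in eq
  ... | false = z≤n
  ... | true rewrite s c eq = ≤-refl

  bit-true : ∀ {ω c} → lookup ω c ≡ true → bit ω c ≡ 1
  bit-true e rewrite e = refl

  bit-∅ : ∀ c → bit ∅ c ≡ 0
  bit-∅ c rewrite lookup-replicate c false = refl

  bit-⊕-≢ : ∀ ω {c e} → e ≢ c → bit (ω ⊕ c) e ≡ bit ω e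
  bit-⊕-≢ ω {c} {e} e≢c rewrite lookup∘update′ e≢c ω true = refl

  bit-⊕ : ∀ ω c e → bit (ω ⊕ c) e ≤ bit ω e + 𝟙 (e Fin.≟ c)
  bit-⊕ ω c e with e Fin.≟ c
  ... | yes refl = ≤-trans (bit≤1 (ω ⊕ c) e) (m≤n+m 1 _)
  ... | no  e≢c  = ≤-trans (≤-reflexive (bit-⊕-≢ ω e≢c)) (m≤m+n _ 0)

  -- All final states reachable from ω by deciding the coordinates in l, each being chosen with
  -- probability 1/q; multiplicities encode probabilities.
  outcomes : List (Fin T) → State → List State
  outcomes []      ω = ω ∷ []
  outcomes (c ∷ l) ω = outcomes l (ω ⊕ c) ++ repeat q′ (outcomes l ω)

  ∑-outcomes : ∀ c l ω f →
    ∑ (outcomes (c ∷ l) ω) f ≡ ∑ (outcomes l (ω ⊕ c)) f + q′ * ∑ (outcomes l ω) f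
  ∑-outcomes c l ω f = trans (∑-++ (outcomes l (ω ⊕ c)) _ f)
    (cong (∑ (outcomes l (ω ⊕ c)) f +_) (∑-repeat q′ (outcomes l ω) f))

  length-outcomes : ∀ l ω → length (outcomes l ω) ≡ q ^ length l
  length-outcomes l ω = trans (trans (sym (*-identityʳ _)) (sym (∑-const (outcomes l ω) 1))) (count l ω)
    where
    count : ∀ l ω → ∑ (outcomes l ω) (λ _ → 1) ≡ q ^ length l
    count []      ω = refl
    count (c ∷ l) ω = trans (∑-outcomes c l ω _)
      (cong₂ (λ a b → a + q′ * b) (count l (ω ⊕ c)) (count l ω))

  ∈-outcomes⁻ : ∀ c l ω {F} → F ∈ outcomes (c ∷ l) ω → F ∈ outcomes l (ω ⊕ c) ⊎ F ∈ outcomes l ω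
  ∈-outcomes⁻ c l ω F∈ with ∈-++⁻ (outcomes l (ω ⊕ c)) F∈
  ... | inj₁ p = inj₁ p
  ... | inj₂ p = inj₂ (∈-repeat⁻ q′ p)

  ∈-outcomes⁺ : ∀ c l ω {F} → F ∈ outcomes l (ω ⊕ c) ⊎ F ∈ outcomes l ω → F ∈ outcomes (c ∷ l) ω
  ∈-outcomes⁺ c l ω (inj₁ p) = ∈-++⁺ˡ p
  ∈-outcomes⁺ c l ω (inj₂ p) = ∈-++⁺ʳ (outcomes l (ω ⊕ c)) (∈-repeat⁺ q′ p)

  outcomes-⊑ : ∀ l ω {F} → F ∈ outcomes l ω → ω ⊑ F
  outcomes-⊑ []      ω (here refl) = ⊑-refl {ω}
  outcomes-⊑ (c ∷ l) ω {F} F∈ with ∈-outcomes⁻ c l ω F∈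
  ... | inj₁ p = ⊑-trans {ω} {ω ⊕ c} {F} (⊑-⊕ ω c) (outcomes-⊑ l (ω ⊕ c) p)
  ... | inj₂ p = outcomes-⊑ l ω p

  outcomes-∉ : ∀ l ω {F} → F ∈ outcomes l ω → ∀ {e} → e ∉ l → lookup F e ≡ lookup ω e
  outcomes-∉ []      ω (here refl) e∉ = refl
  outcomes-∉ (c ∷ l) ω F∈ e∉ with ∈-outcomes⁻ c l ω F∈
  ... | inj₁ p = trans (outcomes-∉ l (ω ⊕ c) p (e∉ ∘ there)) (lookup∘update′ (e∉ ∘ here) ω true)
  ... | inj₂ p = outcomes-∉ l ω p (e∉ ∘ there)

  ⊕-comm : ∀ ω a b → ω ⊕ a ⊕ b ≡ ω ⊕ b ⊕ a
  ⊕-comm ω a b with a Fin.≟ b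
  ... | yes refl = refl
  ... | no  a≢b  = []≔-commutes ω a b a≢b

  -- Coordinates are independent, so the order of exposure is free. This is what permits exposing
  -- the link of a vertex before everything else.
  ∑-outcomes-↭ : ∀ {l l′} → l ↭ l′ → ∀ ω f → ∑ (outcomes l ω) f ≡ ∑ (outcomes l′ ω) f
  ∑-outcomes-↭ refl↭ ω f = refl
  ∑-outcomes-↭ (prep {l} {l′} c p) ω f = trans (∑-outcomes c l ω f) (trans
    (cong₂ (λ a b → a + q′ * b) (∑-outcomes-↭ p (ω ⊕ c) f) (∑-outcomes-↭ p ω f))
    (sym (∑-outcomes c l′ ω f)))
  ∑-outcomes-↭ (swap {l} {l′} a b p) ω f = begin
    ∑ (outcomes (a ∷ b ∷ l) ω) f       ≡⟨ two a b l ⟩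
    four a b l                         ≡⟨ cong₂ _+_ (cong₂ _+_ (trans (cong (λ s → ∑ (outcomes l s) f) (⊕-comm ω a b)) (∑-outcomes-↭ p _ f))
                                                              (cong (q′ *_) (∑-outcomes-↭ p _ f)))
                                                   (cong (q′ *_) (cong₂ _+_ (∑-outcomes-↭ p _ f) (cong (q′ *_) (∑-outcomes-↭ p _ f)))) ⟩
    S (ω ⊕ b ⊕ a) + q′ * S (ω ⊕ a) + q′ * (S (ω ⊕ b) + q′ * S ω)
                                       ≡⟨ e q′ (S (ω ⊕ b ⊕ a)) (S (ω ⊕ a)) (S (ω ⊕ b)) (S ω) ⟩
    four b a l′                        ≡⟨ two b a l′ ⟨
    ∑ (outcomes (b ∷ a ∷ l′) ω) f      ∎
    where
    open ≡-Reasoning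
    S : State → ℕ
    S s = ∑ (outcomes l′ s) f
    four : Fin T → Fin T → List (Fin T) → ℕ
    four a b l = (∑ (outcomes l (ω ⊕ a ⊕ b)) f + q′ * ∑ (outcomes l (ω ⊕ a)) f)
               + q′ * (∑ (outcomes l (ω ⊕ b)) f + q′ * ∑ (outcomes l ω) f)
    two : ∀ a b l → ∑ (outcomes (a ∷ b ∷ l) ω) f ≡ four a b l
    two a b l = trans (∑-outcomes a (b ∷ l) ω f)
      (cong₂ (λ x y → x + q′ * y) (∑-outcomes b l (ω ⊕ a) f) (∑-outcomes b l ω f))
    e : ∀ q a b c d → a + q * b + q * (c + q * d) ≡ a + q * c + q * (b + q * d)
    e = solve-∀
  ∑-outcomes-↭ (trans↭ p r) ω f = trans (∑-outcomes-↭ p ω f) (∑-outcomes-↭ r ω f)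

  ∑-outcomes-++ : ∀ l l′ ω f →
    ∑ (outcomes (l ++ l′) ω) f ≡ ∑[ ω′ ← outcomes l ω ] ∑ (outcomes l′ ω′) f
  ∑-outcomes-++ []      l′ ω f = sym (+-identityʳ _)
  ∑-outcomes-++ (c ∷ l) l′ ω f = trans (∑-outcomes c (l ++ l′) ω f) (trans
    (cong₂ (λ a b → a + q′ * b) (∑-outcomes-++ l l′ (ω ⊕ c) f) (∑-outcomes-++ l l′ ω f))
    (sym (∑-outcomes c l ω _)))

  ∑-outcomes≡0 : ∀ l ω f → (∀ F → F ∈ outcomes l ω → 1 ≤ f F → 1 ≤ 0) → ∑ (outcomes l ω) f ≡ 0
  ∑-outcomes≡0 l ω f none = n≤0⇒n≡0 (≤-trans (∑-mono∈ (outcomes l ω) bound) (≤-reflexive (∑-zero (outcomes l ω))))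
    where
    bound : ∀ F → F ∈ outcomes l ω → f F ≤ 0
    bound F F∈ with f F in eq
    ... | zero  = z≤n
    ... | suc n = ⊥-elim (1+n≰n (none F F∈ (≤-trans (s≤s z≤n) (≤-reflexive (sym eq)))))

  module Tail (a : Fin T → State → ℕ) (V f : State → ℕ)
    (a-mono : ∀ c {ω F} → ω ⊑ F → a c ω ≤ a c F)
    (V-mono : ∀ {ω F} → ω ⊑ F → V ω ≤ V F)
    (f≤1 : ∀ F → f F ≤ 1)
    (h : ℕ) {{_ : NonZero h}} where

    n : ℕ
    n = h * q

    -- All limits are imposed on the final state. Since `a` is monotone, they also bound each
    -- increment at the moment of its exposure, which replaces a stopping time.
    Forced : List (Fin T) → State → ℕ → ℕ → Set
    Forced l ω x y = ∀ F → F ∈ outcomes l ω → 1 ≤ f F →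
      x + V ω ≤ V F × ∑ l (λ c → a c F) ≤ y × (∀ c → c ∈ l → a c F ≤ h)

    open ≤-Reasoning

    -- An exponential supermartingale: a step of weight a multiplies the potential on average by
    -- at most 1 + a/(h q), which the factor (n/(n+1))^a compensates.
    supermartingale : ∀ l ω x y → (∀ c → c ∈ l → ∀ ω → V (ω ⊕ c) ≤ V ω + a c ω) → Forced l ω x y →
      ∑ (outcomes l ω) f * ((2 * h + 1) ^ x * n ^ y) ≤ q ^ length l * ((2 * h) ^ x * (n + 1) ^ y)
    supermartingale [] ω x y step forced with f ω in eq
    ... | zero  = z≤n
    ... | suc k with forced ω (here refl) (≤-trans (s≤s z≤n) (≤-reflexive (sym eq)))
    ...   | xV , _ , _ rewrite n≤0⇒n≡0 (+-cancelʳ-≤ (V ω) x 0 xV) = *-mono-≤ le (*-monoʳ 1 (^-monoˡ-≤ y (m≤m+n n 1)))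
      where
      le : suc k + 0 ≤ 1
      le = ≤-trans (≤-reflexive (+-identityʳ (suc k))) (≤-trans (≤-reflexive (sym eq)) (f≤1 ω))
    -- If the present increment already breaks a limit, then by monotonicity every completion breaks
    -- it, so no completion lies in the event and its mass is 0.
    supermartingale (c ∷ l) ω x y step forced with a c ω ≤? y | a c ω ≤? h
    ... | no a≰y | _ = ≤-trans (≤-reflexive (cong (_* _) (∑-outcomes≡0 (c ∷ l) ω f λ F F∈ p →
            ⊥-elim (a≰y (≤-trans (a-mono c (outcomes-⊑ (c ∷ l) ω F∈)) (≤-trans (m≤m+n _ _) (proj₁ (proj₂ (forced F F∈ p)))))))) ) z≤n
    ... | yes _ | no a≰h = ≤-trans (≤-reflexive (cong (_* _) (∑-outcomes≡0 (c ∷ l) ω f λ F F∈ p →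
            ⊥-elim (a≰h (≤-trans (a-mono c (outcomes-⊑ (c ∷ l) ω F∈)) (proj₂ (proj₂ (forced F F∈ p)) c (here refl)))))) ) z≤n
    ... | yes a≤y | yes a≤h = subst (λ s → s * (β₁ ^ x * n ^ y) ≤ q * Q * (β₀ ^ x * (n + 1) ^ y)) (sym (∑-outcomes c l ω f))
            (subst (λ z → (S₁ + q′ * S₀) * (β₁ ^ x * n ^ z) ≤ q * Q * (β₀ ^ x * (n + 1) ^ z)) (m∸n+n≡m a≤y) goal)
      where
      α = a c ω
      y′ = y ∸ α
      β₁ = 2 * h + 1
      β₀ = 2 * h
      Q = q ^ length l
      S₁ = ∑ (outcomes l (ω ⊕ c)) f
      S₀ = ∑ (outcomes l ω) f
      X = β₁ ^ x * n ^ y′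
      Y = (n + 1) ^ y′
      instance
        β₀≢0 : NonZero β₀
        β₀≢0 = m*n≢0 2 h
      budget : ∀ F → F ∈ outcomes l (ω ⊕ c) ⊎ F ∈ outcomes l ω → 1 ≤ f F →
        ∑ l (λ c → a c F) ≤ y′ × (∀ c → c ∈ l → a c F ≤ h)
      budget F F∈ p with forced F (∈-outcomes⁺ c l ω F∈) p
      ... | _ , sum≤ , a≤h =
        m+n≤o⇒m≤o∸n _ (≤-trans (≤-reflexive (+-comm _ α)) (≤-trans (+-monoˡ-≤ _ (a-mono c (outcomes-⊑ (c ∷ l) ω (∈-outcomes⁺ c l ω F∈)))) sum≤))
        , λ e e∈ → a≤h e (there e∈)
      IH₁ : S₁ * (β₁ ^ (x ∸ α) * n ^ y′) ≤ Q * (β₀ ^ (x ∸ α) * Y)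
      IH₁ = supermartingale l (ω ⊕ c) (x ∸ α) y′ (λ e e∈ → step e (there e∈)) λ F F∈ p →
        value F F∈ p , budget F (inj₁ F∈) p
        where
        value : ∀ F → F ∈ outcomes l (ω ⊕ c) → 1 ≤ f F → x ∸ α + V (ω ⊕ c) ≤ V F
        value F F∈ p with α ≤? x
        ... | yes α≤x = begin
          x ∸ α + V (ω ⊕ c)   ≤⟨ +-monoʳ-≤ (x ∸ α) (step c (here refl) ω) ⟩
          x ∸ α + (V ω + α)   ≡⟨ cong (x ∸ α +_) (+-comm (V ω) α) ⟩
          x ∸ α + (α + V ω)   ≡⟨ +-assoc (x ∸ α) α (V ω) ⟨
          x ∸ α + α + V ω     ≡⟨ cong (_+ V ω) (m∸n+n≡m α≤x) ⟩
          x + V ω             ≤⟨ proj₁ (forced F (∈-outcomes⁺ c l ω (inj₁ F∈)) p) ⟩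
          V F                 ∎
        -- The jump overshoots: the remaining target is 0, and monotonicity of `V` suffices.
        ... | no  α≰x rewrite m≤n⇒m∸n≡0 (<⇒≤ (≰⇒> α≰x)) = V-mono (outcomes-⊑ l (ω ⊕ c) F∈)
      IH₀ : S₀ * X ≤ Q * (β₀ ^ x * Y)
      IH₀ = supermartingale l ω x y′ (λ e e∈ → step e (there e∈)) λ F F∈ p →
        proj₁ (forced F (∈-outcomes⁺ c l ω (inj₂ F∈)) p) , budget F (inj₂ F∈) p
      -- The branch in which `c` is chosen: the target drops by `α`, and `double-growth` bounds the
      -- resulting factor by 1 + α/h.
      jump : S₁ * X * h ≤ Q * (β₀ ^ x * Y) * (h + α)
      jump = *-cancelʳ-≤ _ _ (β₀ ^ α * β₀ ^ (x ∸ α)) {{m*n≢0 (β₀ ^ α) _ {{m^n≢0 β₀ α}} {{m^n≢0 β₀ (x ∸ α)}}}} (begin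
        S₁ * X * h * (β₀ ^ α * β₀ ^ (x ∸ α))
          ≡⟨ e₁ S₁ (β₁ ^ x) (n ^ y′) h (β₀ ^ α) (β₀ ^ (x ∸ α)) ⟩
        S₁ * n ^ y′ * h * (β₁ ^ x * β₀ ^ α * β₀ ^ (x ∸ α))
          ≤⟨ *-monoʳ (S₁ * n ^ y′ * h) (∸-cross (m≤m+n β₀ 1) x α) ⟩
        S₁ * n ^ y′ * h * (β₁ ^ (x ∸ α) * β₀ ^ x * β₁ ^ α)
          ≡⟨ e₂ S₁ (n ^ y′) h (β₁ ^ (x ∸ α)) (β₀ ^ x) (β₁ ^ α) ⟩
        S₁ * (β₁ ^ (x ∸ α) * n ^ y′) * (β₀ ^ x * (β₁ ^ α * h))
          ≤⟨ *-mono-≤ IH₁ (*-monoʳ (β₀ ^ x) (double-growth h α a≤h)) ⟩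
        Q * (β₀ ^ (x ∸ α) * Y) * (β₀ ^ x * (β₀ ^ α * (h + α)))
          ≡⟨ e₃ Q (β₀ ^ (x ∸ α)) Y (β₀ ^ x) (β₀ ^ α) (h + α) ⟩
        Q * (β₀ ^ x * Y) * (h + α) * (β₀ ^ α * β₀ ^ (x ∸ α)) ∎)
        where
        e₁ : ∀ s b m h u v → s * (b * m) * h * (u * v) ≡ s * m * h * (b * u * v)
        e₁ = solve-∀
        e₂ : ∀ s m h b c d → s * m * h * (b * c * d) ≡ s * (b * m) * (c * (d * h))
        e₂ = solve-∀
        e₃ : ∀ Q b Y c d z → Q * (b * Y) * (c * (d * z)) ≡ Q * (c * Y) * z * (d * b)
        e₃ = solve-∀
      goal : (S₁ + q′ * S₀) * (β₁ ^ x * n ^ (y′ + α)) ≤ q * Q * (β₀ ^ x * (n + 1) ^ (y′ + α))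
      goal = *-cancelʳ-≤ _ _ h (begin
        (S₁ + q′ * S₀) * (β₁ ^ x * n ^ (y′ + α)) * h
          ≡⟨ cong (λ z → (S₁ + q′ * S₀) * (β₁ ^ x * z) * h) (^-distribˡ-+-* n y′ α) ⟩
        (S₁ + q′ * S₀) * (β₁ ^ x * (n ^ y′ * n ^ α)) * h
          ≡⟨ e₁ S₁ q′ S₀ (β₁ ^ x) (n ^ y′) (n ^ α) h ⟩
        (S₁ * X * h + q′ * h * (S₀ * X)) * n ^ α
          ≤⟨ *-monoˡ (n ^ α) (+-mono-≤ jump (*-monoʳ (q′ * h) IH₀)) ⟩
        (Z * (h + α) + q′ * h * Z) * n ^ α
          ≡⟨ e₂ Z h α q′ (n ^ α) ⟩
        Z * ((h * suc q′ + α) * n ^ α)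
          ≤⟨ *-monoʳ Z (bernoulli n α) ⟩
        Z * (h * q * (n + 1) ^ α)
          ≡⟨ e₃ Q (β₀ ^ x) Y h q ((n + 1) ^ α) ⟩
        q * Q * (β₀ ^ x * (Y * (n + 1) ^ α)) * h
          ≡⟨ cong (λ z → q * Q * (β₀ ^ x * z) * h) (^-distribˡ-+-* (n + 1) y′ α) ⟨
        q * Q * (β₀ ^ x * (n + 1) ^ (y′ + α)) * h ∎)
        where
        Z = Q * (β₀ ^ x * Y)
        e₁ : ∀ s r t b m k h → (s + r * t) * (b * (m * k)) * h ≡ (s * (b * m) * h + r * h * (t * (b * m))) * k
        e₁ = solve-∀
        e₂ : ∀ Z h a r k → (Z * (h + a) + r * h * Z) * k ≡ Z * ((h * suc r + a) * k)
        e₂ = solve-∀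
        e₃ : ∀ Q b Y h q k → Q * (b * Y) * (h * q * k) ≡ q * Q * (b * (Y * k)) * h
        e₃ = solve-∀

  -- If f = 1 forces V to reach 4 h X while the predicted increments sum to at most h q Y, then f = 1
  -- has probability at most 2^(Y - X).
  tail-bound : (a : Fin T → State → ℕ) (V f : State → ℕ) →
    (∀ c {ω F} → ω ⊑ F → a c ω ≤ a c F) → (∀ {ω F} → ω ⊑ F → V ω ≤ V F) → (∀ F → f F ≤ 1) →
    ∀ h .{{_ : NonZero h}} l ω X Y → (∀ c → c ∈ l → ∀ ω → V (ω ⊕ c) ≤ V ω + a c ω) → V ω ≡ 0 →
    (∀ F → F ∈ outcomes l ω → 1 ≤ f F →
      4 * h * X ≤ V F × ∑ l (λ c → a c F) ≤ h * q * Y × (∀ c → c ∈ l → a c F ≤ 2 * h)) →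
    ∑ (outcomes l ω) f * 2 ^ X ≤ q ^ length l * 2 ^ Y
  tail-bound a V f a-mono V-mono f≤1 h l ω X Y step V≡0 forced =
    *-cancelʳ-≤ _ _ (β ^ x * n ^ y) {{m*n≢0 _ _ {{m^n≢0 β x {{m*n≢0 4 h}}}} {{m^n≢0 n y {{m*n≢0 (2 * h) q {{m*n≢0 2 h}}}}}}}} (begin
      S * 2 ^ X * (β ^ x * n ^ y)        ≡⟨ e₁ S (2 ^ X) (β ^ x) (n ^ y) ⟩
      S * (2 ^ X * β ^ x * n ^ y)        ≤⟨ *-monoʳ S (*-monoˡ (n ^ y) (^-scale 2 β X (exponential≥2 β {{m*n≢0 4 h}}))) ⟩
      S * ((β + 1) ^ x * n ^ y)          ≤⟨ subst (λ b → S * ((b + 1) ^ x * n ^ y) ≤ Q * (b ^ x * (n + 1) ^ y)) (e₀ h) main ⟩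
      Q * (β ^ x * (n + 1) ^ y)          ≤⟨ *-monoʳ Q (*-monoʳ (β ^ x) (^-scale′ 2 (h * q) Y half)) ⟩
      Q * (β ^ x * (2 ^ Y * n ^ y))      ≡⟨ e₂ Q (β ^ x) (2 ^ Y) (n ^ y) ⟩
      Q * 2 ^ Y * (β ^ x * n ^ y)        ∎)
    where
    open ≤-Reasoning
    open Tail a V f a-mono V-mono f≤1 (2 * h) {{m*n≢0 2 h}} using (supermartingale; n)
    S = ∑ (outcomes l ω) f
    Q = q ^ length l
    -- Both exponents are multiples chosen to give powers of two: (1 + 1/(4h))^(4h) is at least 2,
    -- and (1 + 1/(2hq))^(hq) is at most 2.
    β = 4 * h
    x = β * X
    y = h * q * Y
    main : S * ((2 * (2 * h) + 1) ^ x * n ^ y) ≤ Q * ((2 * (2 * h)) ^ x * (n + 1) ^ y)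
    main = supermartingale l ω x y step (λ F F∈ p → subst (_≤ V F) (sym (trans (cong (x +_) V≡0) (+-identityʳ x))) (proj₁ (forced F F∈ p))
      , proj₂ (forced F F∈ p))
    half : (n + 1) ^ (h * q) ≤ 2 * n ^ (h * q)
    half = subst (λ k → (k + 1) ^ (h * q) ≤ 2 * k ^ (h * q)) (sym (*-assoc 2 h q)) (half-exponential (h * q) {{m*n≢0 h q}})
    e₀ : ∀ h → 2 * (2 * h) ≡ 4 * h
    e₀ = solve-∀
    e₁ : ∀ S x y z → S * x * (y * z) ≡ S * (x * y * z)
    e₁ = solve-∀
    e₂ : ∀ S x y z → S * (x * (y * z)) ≡ S * y * (x * z)
    e₂ = solve-∀

  masked : ∀ {P : Set} → Dec P → Bool → Bool
  masked (yes _) b = b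
  masked (no  _) _ = false

  -- The history of `F` just before `c` is exposed, when coordinates are exposed in the order of
  -- `Fin T`; what is still undecided counts as not chosen.
  _↾_ : State → Fin T → State
  F ↾ c = tabulate (λ e → masked (e Fin.<? c) (lookup F e))

  ↾-below : ∀ F {c e} → e Fin.< c → lookup (F ↾ c) e ≡ lookup F e
  ↾-below F {c} {e} e<c = trans (lookup∘tabulate _ e) (unmask (e Fin.<? c))
    where
    unmask : ∀ d → masked {e Fin.< c} d (lookup F e) ≡ lookup F e
    unmask (yes _)   = refl
    unmask (no  e≮c) = ⊥-elim (e≮c e<c)

  ↾-above : ∀ F {c e} → ¬ e Fin.< c → lookup (F ↾ c) e ≡ false
  ↾-above F {c} {e} e≮c = trans (lookup∘tabulate _ e) (mask (e Fin.<? c))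
    where
    mask : ∀ d → masked {e Fin.< c} d (lookup F e) ≡ false
    mask (yes e<c) = ⊥-elim (e≮c e<c)
    mask (no  _)   = refl

  State-ext : ∀ {ω F : State} → (∀ e → lookup ω e ≡ lookup F e) → ω ≡ F
  State-ext {ω} {F} p = trans (sym (tabulate∘lookup ω)) (trans (tabulate-cong p) (tabulate∘lookup F))

  -- If f = 1 forces at least M coordinates to be active throughout, and no coordinate that is
  -- active at the time of its exposure to be chosen, then f = 1 has probability at most (1 - 1/q)^M.
  module Survival (act : Fin T → State → ℕ) (f : State → ℕ)
    (act-anti : ∀ c {ω F} → ω ⊑ F → act c F ≤ act c ω) (act≤1 : ∀ c F → act c F ≤ 1)
    (f≤1 : ∀ F → f F ≤ 1)
    (avoids : ∀ F c → 1 ≤ f F → lookup F c ≡ true → act c (F ↾ c) ≡ 0) where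

    open ≤-Reasoning

    -- The list stays a final segment of `Fin T` and its coordinates are still unset, which
    -- identifies the current state `ω` with the history `F ↾ c`. Activity is counted in the final
    -- state; antitonicity carries it back to the moment of exposure.
    survival : ∀ l ω M → AllPairs Fin._<_ l → (∀ e → e ∈ l ⊎ All (e Fin.<_) l) →
      (∀ e → e ∈ l → lookup ω e ≡ false) →
      (∀ F → F ∈ outcomes l ω → 1 ≤ f F → M ≤ ∑ l (λ c → act c F)) →
      ∑ (outcomes l ω) f * q ^ M ≤ q ^ length l * q′ ^ M
    survival [] ω M _ _ _ active with f ω in eq
    ... | zero  = z≤n
    ... | suc k rewrite n≤0⇒n≡0 (active ω (here refl) (≤-trans (s≤s z≤n) (≤-reflexive (sym eq)))) =
      *-monoˡ 1 (≤-trans (≤-reflexive (+-identityʳ (suc k))) (≤-trans (≤-reflexive (sym eq)) (f≤1 ω)))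
    survival (c ∷ l) ω M (c< ∷ sorted) full fresh active with act c ω in eq
    ... | zero = begin
      ∑ (outcomes (c ∷ l) ω) f * q ^ M ≡⟨ cong (_* q ^ M) (∑-outcomes c l ω f) ⟩
      (S₁ + q′ * S₀) * q ^ M           ≡⟨ e₁ S₁ q′ S₀ (q ^ M) ⟩
      S₁ * q ^ M + q′ * (S₀ * q ^ M)   ≤⟨ +-mono-≤ IH₁ (*-monoʳ q′ IH₀) ⟩
      Z + q′ * Z                       ≡⟨ *-assoc q (q ^ length l) (q′ ^ M) ⟨
      q * q ^ length l * q′ ^ M        ∎
      where
      S₁ = ∑ (outcomes l (ω ⊕ c)) f
      S₀ = ∑ (outcomes l ω) f
      Z = q ^ length l * q′ ^ M
      full′ : ∀ e → e ∈ l ⊎ All (e Fin.<_) l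
      full′ e with full e
      ... | inj₁ (here refl) = inj₂ c<
      ... | inj₁ (there p)   = inj₁ p
      ... | inj₂ (_ ∷ p)     = inj₂ p
      inactive : ∀ F → F ∈ outcomes (c ∷ l) ω → 1 ≤ f F → M ≤ ∑ l (λ c → act c F)
      inactive F F∈ p = ≤-trans (active F F∈ p)
        (+-monoˡ-≤ _ (≤-trans (act-anti c (outcomes-⊑ (c ∷ l) ω F∈)) (≤-reflexive eq)))
      IH₁ : S₁ * q ^ M ≤ Z
      IH₁ = survival l (ω ⊕ c) M sorted full′
        (λ e e∈ → trans (lookup∘update′ (λ e≡c → Fin.<⇒≢ (All.lookup c< e∈) (sym e≡c)) ω true) (fresh e (there e∈)))
        (λ F F∈ → inactive F (∈-outcomes⁺ c l ω (inj₁ F∈)))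
      IH₀ : S₀ * q ^ M ≤ Z
      IH₀ = survival l ω M sorted full′ (λ e e∈ → fresh e (there e∈))
        (λ F F∈ → inactive F (∈-outcomes⁺ c l ω (inj₂ F∈)))
      e₁ : ∀ s r t x → (s + r * t) * x ≡ s * x + r * (t * x)
      e₁ = solve-∀
    ... | suc k = begin
      ∑ (outcomes (c ∷ l) ω) f * q ^ M ≡⟨ cong (_* q ^ M) (∑-outcomes c l ω f) ⟩
      (S₁ + q′ * S₀) * q ^ M           ≡⟨ cong (λ s → (s + q′ * S₀) * q ^ M) (∑-outcomes≡0 l (ω ⊕ c) f dead) ⟩
      q′ * S₀ * q ^ M                  ≤⟨ shave M {Q = q ^ length l} IH ⟩
      q * q ^ length l * q′ ^ M        ∎
      where
      S₁ = ∑ (outcomes l (ω ⊕ c)) f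
      S₀ = ∑ (outcomes l ω) f
      full′ : ∀ e → e ∈ l ⊎ All (e Fin.<_) l
      full′ e with full e
      ... | inj₁ (here refl) = inj₂ c<
      ... | inj₁ (there p)   = inj₁ p
      ... | inj₂ (_ ∷ p)     = inj₂ p
      past : ∀ F → F ∈ outcomes l (ω ⊕ c) → F ↾ c ≡ ω
      past F F∈ = State-ext λ e → same e (e Fin.<? c)
        where
        same : ∀ e → Dec (e Fin.< c) → lookup (F ↾ c) e ≡ lookup ω e
        same e (yes e<c) = trans (↾-below F e<c) (trans
          (outcomes-∉ l (ω ⊕ c) F∈ λ e∈ → <-asym e<c (All.lookup c< e∈))
          (lookup∘update′ (Fin.<⇒≢ e<c) ω true))
        same e (no e≮c) with full e
        ... | inj₁ e∈       = trans (↾-above F e≮c) (sym (fresh e e∈))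
        ... | inj₂ (e<c ∷ _) = ⊥-elim (e≮c e<c)
      -- Choosing an active coordinate contradicts `avoids`, so only `q′` of the `q` branches
      -- contribute.
      dead : ∀ F → F ∈ outcomes l (ω ⊕ c) → 1 ≤ f F → 1 ≤ 0
      dead F F∈ p = ⊥-elim (absurd (trans (sym eq) (trans (cong (act c) (sym (past F F∈)))
        (avoids F c p (outcomes-⊑ l (ω ⊕ c) F∈ c (lookup∘update c ω true))))))
        where
        absurd : suc k ≢ 0
        absurd ()
      IH : S₀ * q ^ (M ∸ 1) ≤ q ^ length l * q′ ^ (M ∸ 1)
      IH = survival l ω (M ∸ 1) sorted full′ (λ e e∈ → fresh e (there e∈)) λ F F∈ p →
        ∸-monoˡ-≤ 1 (≤-trans (active F (∈-outcomes⁺ c l ω (inj₂ F∈)) p) (+-monoˡ-≤ _ (act≤1 c F)))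
      shave : ∀ M {S Q} → S * q ^ (M ∸ 1) ≤ Q * q′ ^ (M ∸ 1) → q′ * S * q ^ M ≤ q * Q * q′ ^ M
      shave zero {S} {Q} le = begin
        q′ * S * 1   ≡⟨ *-assoc q′ S 1 ⟩
        q′ * (S * 1) ≤⟨ *-mono-≤ (n≤1+n q′) le ⟩
        q * (Q * 1)  ≡⟨ *-assoc q Q 1 ⟨
        q * Q * 1    ∎
      shave (suc M) {S} {Q} le = begin
        q′ * S * (q * q ^ M)   ≡⟨ e₁ q′ S q (q ^ M) ⟩
        q′ * q * (S * q ^ M)   ≤⟨ *-monoʳ (q′ * q) le ⟩
        q′ * q * (Q * q′ ^ M)  ≡⟨ e₂ q′ q Q (q′ ^ M) ⟩
        q * Q * (q′ * q′ ^ M)  ∎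
        where
        e₁ : ∀ r S q X → r * S * (q * X) ≡ r * q * (S * X)
        e₁ = solve-∀
        e₂ : ∀ r q Q X → r * q * (Q * X) ≡ q * Q * (r * X)
        e₂ = solve-∀

    -- The bound (1 - 1/q)^(qμ) from `survival` is at most 2^(-μ) by `pred-power`.
    survival-bound : ∀ μ →
      (∀ F → 1 ≤ f F → q * μ ≤ ∑ (allFin T) (λ c → act c F)) →
      ∑ (outcomes (allFin T) ∅) f * 2 ^ μ ≤ q ^ T
    survival-bound μ active = *-cancelʳ-≤ _ _ (q′ ^ (q * μ)) {{m^n≢0 q′ (q * μ)}} (begin
      S * 2 ^ μ * q′ ^ (q * μ)   ≡⟨ *-assoc S (2 ^ μ) _ ⟩
      S * (2 ^ μ * q′ ^ (q * μ)) ≤⟨ *-monoʳ S (^-scale 2 q μ (pred-power q′)) ⟩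
      S * q ^ (q * μ)            ≤⟨ survival (allFin T) ∅ (q * μ) (tabulate⁺-< (λ p → p)) (λ e → inj₁ (∈-allFin e))
                                      (λ e _ → lookup-replicate e false) (λ F _ → active F) ⟩
      q ^ length (allFin T) * q′ ^ (q * μ) ≡⟨ cong (λ z → q ^ z * q′ ^ (q * μ)) (length-tabulate {n = T} (λ i → i)) ⟩
      q ^ T * q′ ^ (q * μ)       ∎)
      where S = ∑ (outcomes (allFin T) ∅) f

-- Encoding triples

_∈₃_ : ∀ {A : Set} → A → A × A × A → Set
x ∈₃ (a , b , c) = x ≡ a ⊎ x ≡ b ⊎ x ≡ c

module Multiset where

  lo hi : ℕ → ℕ → ℕ → ℕ
  lo x y z = x ⊓ y ⊓ z
  hi x y z = x ⊔ y ⊔ z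

  -- An entry that is neither extreme is the sum minus both extremes, stated additively to avoid
  -- truncated subtraction. Together with `middle` this recovers the entries from the three
  -- invariants, even when some coincide.
  position : ∀ x y z → x ≡ lo x y z ⊎ x ≡ hi x y z ⊎ x + (lo x y z + hi x y z) ≡ x + y + z
  position x y z with ≤-total x y | ≤-total x z
  ... | inj₁ p | inj₁ r = inj₁ (sym (trans (cong (_⊓ z) (m≤n⇒m⊓n≡m p)) (m≤n⇒m⊓n≡m r)))
  ... | inj₂ p | inj₂ r = inj₂ (inj₁ (sym (trans (cong (_⊔ z) (m≥n⇒m⊔n≡m p)) (m≥n⇒m⊔n≡m r))))
  ... | inj₁ p | inj₂ r = inj₂ (inj₂ (trans (cong₂ (λ a b → x + (a + b))
      (trans (cong (_⊓ z) (m≤n⇒m⊓n≡m p)) (m≥n⇒m⊓n≡n r))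
      (trans (cong (_⊔ z) (m≤n⇒m⊔n≡n p)) (m≥n⇒m⊔n≡m (≤-trans r p)))) (e x y z)))
    where
    e : ∀ x y z → x + (z + y) ≡ x + y + z
    e = solve-∀
  ... | inj₂ p | inj₁ r = inj₂ (inj₂ (trans (cong₂ (λ a b → x + (a + b))
      (trans (cong (_⊓ z) (m≥n⇒m⊓n≡n p)) (m≤n⇒m⊓n≡m (≤-trans p r)))
      (trans (cong (_⊔ z) (m≥n⇒m⊔n≡m p)) (m≤n⇒m⊔n≡n r))) (sym (+-assoc x y z))))

  middle : ∀ a b c → ∃ λ u → u ∈₃ (a , b , c) × u + (lo a b c + hi a b c) ≡ a + b + c
  middle a b c with position a b c
  ... | inj₂ (inj₂ e) = a , inj₁ refl , e
  ... | inj₁ low with ≤-total b c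
  ...   | inj₁ p = b , inj₂ (inj₁ refl) , trans (cong₂ (λ l h → b + (l + h)) (sym low) high) (e a b c)
    where
    a≤b : a ≤ b
    a≤b = ≤-trans (≤-reflexive low) (≤-trans (m⊓n≤m (a ⊓ b) c) (m⊓n≤n a b))
    high : hi a b c ≡ c
    high = trans (cong (_⊔ c) (m≤n⇒m⊔n≡n a≤b)) (m≤n⇒m⊔n≡n p)
    e : ∀ a b c → b + (a + c) ≡ a + b + c
    e = solve-∀
  ...   | inj₂ p = c , inj₂ (inj₂ refl) , trans (cong₂ (λ l h → c + (l + h)) (sym low) high) (e a b c)
    where
    a≤b : a ≤ b
    a≤b = ≤-trans (≤-reflexive low) (≤-trans (m⊓n≤m (a ⊓ b) c) (m⊓n≤n a b))
    high : hi a b c ≡ b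
    high = trans (cong (_⊔ c) (m≤n⇒m⊔n≡n a≤b)) (m≥n⇒m⊔n≡m p)
    e : ∀ a b c → c + (a + b) ≡ a + b + c
    e = solve-∀
  middle a b c | inj₂ (inj₁ high) with ≤-total b c
  ...   | inj₁ p = c , inj₂ (inj₂ refl) , trans (cong₂ (λ l h → c + (l + h)) low (sym high)) (e a b c)
    where
    b≤a : b ≤ a
    b≤a = ≤-trans (≤-trans (m≤n⊔m a b) (m≤m⊔n (a ⊔ b) c)) (≤-reflexive (sym high))
    low : lo a b c ≡ b
    low = trans (cong (_⊓ c) (m≥n⇒m⊓n≡n b≤a)) (m≤n⇒m⊓n≡m p)
    e : ∀ a b c → c + (b + a) ≡ a + b + c
    e = solve-∀
  ...   | inj₂ p = b , inj₂ (inj₁ refl) , trans (cong₂ (λ l h → b + (l + h)) low (sym high)) (e a b c)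
    where
    b≤a : b ≤ a
    b≤a = ≤-trans (≤-trans (m≤n⊔m a b) (m≤m⊔n (a ⊔ b) c)) (≤-reflexive (sym high))
    low : lo a b c ≡ c
    low = trans (cong (_⊓ c) (m≥n⇒m⊓n≡n b≤a)) (m≥n⇒m⊓n≡n p)
    e : ∀ a b c → b + (c + a) ≡ a + b + c
    e = solve-∀

  lo-∈ : ∀ a b c → lo a b c ∈₃ (a , b , c)
  lo-∈ a b c with ⊓-sel (a ⊓ b) c
  ... | inj₂ e = inj₂ (inj₂ e)
  ... | inj₁ e with ⊓-sel a b
  ...   | inj₁ e′ = inj₁ (trans e e′)
  ...   | inj₂ e′ = inj₂ (inj₁ (trans e e′))

  hi-∈ : ∀ a b c → hi a b c ∈₃ (a , b , c)
  hi-∈ a b c with ⊔-sel (a ⊔ b) c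
  ... | inj₂ e = inj₂ (inj₂ e)
  ... | inj₁ e with ⊔-sel a b
  ...   | inj₁ e′ = inj₁ (trans e e′)
  ...   | inj₂ e′ = inj₂ (inj₁ (trans e e′))

  ∈₃-determined : ∀ x y z a b c → lo x y z ≡ lo a b c → hi x y z ≡ hi a b c → x + y + z ≡ a + b + c →
    x ∈₃ (a , b , c)
  ∈₃-determined x y z a b c el eh es with position x y z
  ... | inj₁ e        = subst (_∈₃ (a , b , c)) (sym (trans e el)) (lo-∈ a b c)
  ... | inj₂ (inj₁ e) = subst (_∈₃ (a , b , c)) (sym (trans e eh)) (hi-∈ a b c)
  ... | inj₂ (inj₂ e) with middle a b c
  ...   | u , u∈ , e′ = subst (_∈₃ (a , b , c)) (+-cancelʳ-≡ (lo a b c + hi a b c) u x (begin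
    u + (lo a b c + hi a b c) ≡⟨ e′ ⟩
    a + b + c                 ≡⟨ es ⟨
    x + y + z                 ≡⟨ e ⟨
    x + (lo x y z + hi x y z) ≡⟨ cong (x +_) (cong₂ _+_ el eh) ⟩
    x + (lo a b c + hi a b c) ∎)) u∈
    where open ≡-Reasoning

-- A multiset {x, y, z} is encoded by its minimum, its maximum and its sum, which makes the
-- encoding visibly symmetric.
module Coordinates (m : ℕ) where

  open Multiset

  Triples : ℕ
  Triples = m * (m * (m + m + m))

  private
    lo< : ∀ (x y z : Fin m) → lo (toℕ x) (toℕ y) (toℕ z) < m
    lo< x y z = ≤-<-trans (m⊓n≤n (toℕ x ⊓ toℕ y) (toℕ z)) (Fin.toℕ<n z)

    hi< : ∀ (x y z : Fin m) → hi (toℕ x) (toℕ y) (toℕ z) < m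
    hi< x y z = ⊔-lub (⊔-lub (Fin.toℕ<n x) (Fin.toℕ<n y)) (Fin.toℕ<n z)

    sum< : ∀ (x y z : Fin m) → toℕ x + toℕ y + toℕ z < m + m + m
    sum< x y z = +-mono-< (+-mono-< (Fin.toℕ<n x) (Fin.toℕ<n y)) (Fin.toℕ<n z)

  code : Fin m → Fin m → Fin m → Fin Triples
  code x y z = combine (fromℕ< (lo< x y z)) (combine (fromℕ< (hi< x y z)) (fromℕ< (sum< x y z)))

  private
    encode : ∀ {x y z a b c : Fin m} → lo (toℕ x) (toℕ y) (toℕ z) ≡ lo (toℕ a) (toℕ b) (toℕ c) →
      hi (toℕ x) (toℕ y) (toℕ z) ≡ hi (toℕ a) (toℕ b) (toℕ c) →
      toℕ x + toℕ y + toℕ z ≡ toℕ a + toℕ b + toℕ c → code x y z ≡ code a b c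
    encode {x} {y} {z} {a} {b} {c} el eh es = cong₂ combine (Fin.fromℕ<-cong _ _ el (lo< x y z) (lo< a b c))
      (cong₂ combine (Fin.fromℕ<-cong _ _ eh (hi< x y z) (hi< a b c)) (Fin.fromℕ<-cong _ _ es (sum< x y z) (sum< a b c)))

    decode : ∀ {x y z a b c : Fin m} → code x y z ≡ code a b c →
      lo (toℕ x) (toℕ y) (toℕ z) ≡ lo (toℕ a) (toℕ b) (toℕ c) ×
      hi (toℕ x) (toℕ y) (toℕ z) ≡ hi (toℕ a) (toℕ b) (toℕ c) ×
      toℕ x + toℕ y + toℕ z ≡ toℕ a + toℕ b + toℕ c
    decode {x} {y} {z} {a} {b} {c} e with Fin.combine-injective _ _ _ _ e
    ... | el , e′ with Fin.combine-injective _ _ _ _ e′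
    ...   | eh , es = Fin.fromℕ<-injective _ _ (lo< x y z) (lo< a b c) el
                    , Fin.fromℕ<-injective _ _ (hi< x y z) (hi< a b c) eh
                    , Fin.fromℕ<-injective _ _ (sum< x y z) (sum< a b c) es

  code-sym₁₂ : ∀ x y z → code x y z ≡ code y x z
  code-sym₁₂ x y z = encode {x} {y} {z} {y} {x} {z} (cong (_⊓ toℕ z) (⊓-comm (toℕ x) (toℕ y)))
    (cong (_⊔ toℕ z) (⊔-comm (toℕ x) (toℕ y))) (cong (_+ toℕ z) (+-comm (toℕ x) (toℕ y)))

  code-sym₂₃ : ∀ x y z → code x y z ≡ code x z y
  code-sym₂₃ x y z = encode {x} {y} {z} {x} {z} {y}
    (trans (⊓-assoc (toℕ x) _ _) (trans (cong (toℕ x ⊓_) (⊓-comm (toℕ y) (toℕ z))) (sym (⊓-assoc (toℕ x) _ _))))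
    (trans (⊔-assoc (toℕ x) _ _) (trans (cong (toℕ x ⊔_) (⊔-comm (toℕ y) (toℕ z))) (sym (⊔-assoc (toℕ x) _ _))))
    (trans (+-assoc (toℕ x) _ _) (trans (cong (toℕ x +_) (+-comm (toℕ y) (toℕ z))) (sym (+-assoc (toℕ x) _ _))))

  code-cancel : ∀ {x y z z′} → code x y z ≡ code x y z′ → z ≡ z′
  code-cancel {x} {y} {z} {z′} e = Fin.toℕ-injective (+-cancelˡ-≡ (toℕ x + toℕ y) _ _
    (proj₂ (proj₂ (decode {x} {y} {z} {x} {y} {z′} e))))

  code-∈₃ : ∀ {x y z a b c} → code x y z ≡ code a b c → x ∈₃ (a , b , c)
  code-∈₃ {x} {y} {z} {a} {b} {c} e with decode {x} {y} {z} {a} {b} {c} e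
  ... | el , eh , es with ∈₃-determined (toℕ x) (toℕ y) (toℕ z) (toℕ a) (toℕ b) (toℕ c) el eh es
  ...   | inj₁ p        = inj₁ (Fin.toℕ-injective p)
  ...   | inj₂ (inj₁ p) = inj₂ (inj₁ (Fin.toℕ-injective p))
  ...   | inj₂ (inj₂ p) = inj₂ (inj₂ (Fin.toℕ-injective p))

-- Rare events in a random 3-graph

length-allFin : ∀ n → length (allFin n) ≡ n
length-allFin n = length-tabulate id

filter-split-↭ : ∀ {A : Set} {P : A → Set} (P? : ∀ x → Dec (P x)) xs →
  xs ↭ filter P? xs ++ filter (¬? ∘ P?) xs
filter-split-↭ P? []       = ↭-refl
filter-split-↭ P? (x ∷ xs) with P? x
... | yes _ = prep x (filter-split-↭ P? xs)
... | no  _ = ↭-trans (prep x (filter-split-↭ P? xs)) (↭-sym (shift x (filter P? xs) _))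

module Random (m q′ : ℕ) {{_ : NonZero q′}} where

  open Coordinates m public
  open Exposure Triples q′ public

  private
    V : Set
    V = Fin m
    all : List V
    all = allFin m

  deg : State → V → V → ℕ
  deg F v w = ∑[ x ← all ] bit F (code v w x)

  codeg : State → V → V → V → ℕ
  codeg F v w w′ = ∑[ x ← all ] bit F (code v w x) * bit F (code v w′ x)

  -- Each coordinate is exposed only once, so over the whole process every `e x` is met at most
  -- once. All estimates of total drift rest on this exchange of summations.
  hits : ∀ {A : Set} {l} → Unique l → (xs : List A) (e : A → Fin Triples) (g : A → ℕ) →
    ∑[ c ← l ] ∑[ x ← xs ] 𝟙 (e x Fin.≟ c) * g x ≤ ∑ xs g
  hits {l = l} u xs e g = begin
    ∑[ c ← l ] ∑[ x ← xs ] 𝟙 (e x Fin.≟ c) * g x ≡⟨ ∑-swap l xs _ ⟩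
    ∑[ x ← xs ] ∑[ c ← l ] 𝟙 (e x Fin.≟ c) * g x ≡⟨ ∑-cong xs (λ x → ∑-*ʳ l (g x) _) ⟩
    ∑[ x ← xs ] (∑[ c ← l ] 𝟙 (e x Fin.≟ c)) * g x
      ≤⟨ ∑-mono xs (λ x → *-monoˡ (g x) (∑-𝟙-≤1 (e x Fin.≟_) u (λ p r → trans (sym p) r))) ⟩
    ∑[ x ← xs ] 1 * g x                          ≡⟨ ∑-cong xs (λ x → *-identityˡ (g x)) ⟩
    ∑ xs g                                       ∎
    where open ≤-Reasoning

  hits₁ : ∀ {A : Set} {l} → Unique l → (xs : List A) (e : A → Fin Triples) →
    ∑[ c ← l ] ∑[ x ← xs ] 𝟙 (e x Fin.≟ c) ≤ length xs
  hits₁ {l = l} u xs e = begin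
    ∑[ c ← l ] ∑[ x ← xs ] 𝟙 (e x Fin.≟ c)     ≡⟨ ∑-cong l (λ c → ∑-cong xs (λ x → sym (*-identityʳ _))) ⟩
    ∑[ c ← l ] ∑[ x ← xs ] 𝟙 (e x Fin.≟ c) * 1 ≤⟨ hits u xs e (λ _ → 1) ⟩
    ∑[ x ← xs ] 1                              ≡⟨ ∑-const xs 1 ⟩
    length xs * 1                              ≡⟨ *-identityʳ _ ⟩
    length xs                                  ∎
    where open ≤-Reasoning

  code-unique : ∀ v w c → ∑[ x ← all ] 𝟙 (code v w x Fin.≟ c) ≤ 1
  code-unique v w c = ∑-𝟙-≤1 (λ x → code v w x Fin.≟ c) (allFin⁺ m)
    (λ {x} {y} p r → code-cancel {v} {w} {x} {y} (trans p (sym r)))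

  bit*≤ : ∀ F e n → n * bit F e ≤ n
  bit*≤ F e n = ≤-trans (*-monoʳ n (bit≤1 F e)) (≤-reflexive (*-identityʳ n))

  -- One coordinate cannot flip two different bits, so no product of two increments occurs and the
  -- change is linear.
  pair-step : ∀ ω c {e e′} → e ≢ e′ → bit (ω ⊕ c) e * bit (ω ⊕ c) e′ ≤
    bit ω e * bit ω e′ + (𝟙 (e Fin.≟ c) * bit ω e′ + 𝟙 (e′ Fin.≟ c) * bit ω e)
  pair-step ω c {e} {e′} e≢e′ with e Fin.≟ c | e′ Fin.≟ c
  ... | yes refl | yes refl = ⊥-elim (e≢e′ refl)
  ... | yes refl | no e′≢c = begin
    bit (ω ⊕ c) e * bit (ω ⊕ c) e′ ≤⟨ *-mono-≤ (bit≤1 (ω ⊕ c) e) (≤-reflexive (bit-⊕-≢ ω e′≢c)) ⟩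
    1 * bit ω e′                   ≤⟨ m≤m+n _ 0 ⟩
    1 * bit ω e′ + 0               ≤⟨ m≤n+m _ (bit ω e * bit ω e′) ⟩
    bit ω e * bit ω e′ + (1 * bit ω e′ + 0) ∎
    where open ≤-Reasoning
  ... | no e≢c | yes refl = begin
    bit (ω ⊕ c) e * bit (ω ⊕ c) e′ ≤⟨ *-mono-≤ (≤-reflexive (bit-⊕-≢ ω e≢c)) (bit≤1 (ω ⊕ c) e′) ⟩
    bit ω e * 1                    ≡⟨ *-comm (bit ω e) 1 ⟩
    1 * bit ω e                    ≤⟨ m≤n+m _ (bit ω e * bit ω e′) ⟩
    bit ω e * bit ω e′ + (0 + 1 * bit ω e) ∎
    where open ≤-Reasoning
  ... | no e≢c | no e′≢c = ≤-trans (≤-reflexive (cong₂ _*_ (bit-⊕-≢ ω e≢c) (bit-⊕-≢ ω e′≢c))) (m≤m+n _ 0)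

  Probability≤2^- : (State → ℕ) → ℕ → Set
  Probability≤2^- f E = ∑ (outcomes (allFin Triples) ∅) f * 2 ^ E ≤ q ^ Triples

  private
    Fs : List (Fin Triples)
    Fs = allFin Triples

    Fs-unique : Unique Fs
    Fs-unique = allFin⁺ Triples

    -- The drift costs `Y` in the exponent, so the tail bound is aimed at `X + Y` to leave `X`.
    from-tail : ∀ f X Y → ∑ (outcomes Fs ∅) f * 2 ^ (X + Y) ≤ q ^ length Fs * 2 ^ Y → Probability≤2^- f X
    from-tail f X Y le = *-cancelʳ-≤ S* Q (2 ^ Y) {{m^n≢0 2 Y}} (begin
      S* * 2 ^ Y                      ≡⟨ *-assoc S (2 ^ X) (2 ^ Y) ⟩
      S * (2 ^ X * 2 ^ Y)             ≡⟨ cong (S *_) (^-distribˡ-+-* 2 X Y) ⟨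
      S * 2 ^ (X + Y)                 ≤⟨ le ⟩
      q ^ length Fs * 2 ^ Y           ≡⟨ cong (λ z → q ^ z * 2 ^ Y) (length-allFin Triples) ⟩
      Q * 2 ^ Y                       ∎)
      where
      open ≤-Reasoning
      S = ∑ (outcomes Fs ∅) f
      S* = S * 2 ^ X
      Q = q ^ Triples

    ⊑-bit : ∀ {ω F} → ω ⊑ F → ∀ e → bit ω e ≤ bit F e
    ⊑-bit {ω} {F} s e = bit-mono {ω} {F} s e

    deg-mono : ∀ v w {ω F} → ω ⊑ F → deg ω v w ≤ deg F v w
    deg-mono v w {ω} {F} s = ∑-mono all (λ x → ⊑-bit {ω} {F} s _)

  module Degree (d : ℕ) (m≤qd : m ≤ q * d) (v w : V) where

    event : State → ℕ
    event F = 𝟙 (8 * d ≤? deg F v w)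

    rare : Probability≤2^- event d
    -- The mean degree is about m/q ≤ d. The target is 8d = 4 · 1 · (d + d) with drift exponent `d`,
    -- which leaves 2^(-d).
    rare = from-tail event d d (
      (tail-bound (λ c _ → ∑[ x ← all ] 𝟙 (code v w x Fin.≟ c)) (λ F → deg F v w) event
        (λ c _ → ≤-refl) (λ {ω} {F} s → deg-mono v w {ω} {F} s) (λ F → 𝟙≤1 (8 * d ≤? deg F v w)) 1 Fs ∅ (d + d) d
        (λ c _ ω → ≤-trans (∑-mono all (λ x → bit-⊕ ω c (code v w x))) (≤-reflexive (∑-+ all _ _)))
        (trans (∑-cong all (λ x → bit-∅ (code v w x))) (∑-zero all))
        λ F _ p → ≤-trans (≤-reflexive (e d)) (1≤𝟙⇒ (8 * d ≤? deg F v w) p)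
          , ≤-trans (hits₁ Fs-unique all (code v w)) (≤-trans (≤-reflexive (length-allFin m)) (≤-trans m≤qd (≤-reflexive (e₂ q d))))
          , λ c _ → ≤-trans (code-unique v w c) (s≤s z≤n)))
      where
      e : ∀ d → 4 * 1 * (d + d) ≡ 8 * d
      e = solve-∀
      e₂ : ∀ q d → q * d ≡ 1 * q * d
      e₂ = solve-∀

  module Codegree (d : ℕ) (16d≤q : 16 * d ≤ q) (E : ℕ) (v w w′ : V) where

    -- The degree caps belong to the event. They bound the total drift by 16d ≤ q, a single unit of
    -- the exponent, and so a codegree of only 4(E + 1) is already rare.
    condition? : ∀ F → Dec (w ≢ w′ × deg F v w ≤ 8 * d × deg F v w′ ≤ 8 * d × 4 * suc E ≤ codeg F v w w′)
    condition? F = ¬? (w Fin.≟ w′) ×-dec (deg F v w ≤? 8 * d) ×-dec (deg F v w′ ≤? 8 * d) ×-dec (4 * suc E ≤? codeg F v w w′)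

    event : State → ℕ
    event F = 𝟙 (condition? F)

    private
      open ≤-Reasoning
      differ : ∀ x → code v w x ≡ code v w′ x → w ≡ w′
      differ x eq = code-cancel {v} {x} (trans (sym (code-sym₂₃ v w x)) (trans eq (code-sym₂₃ v w′ x)))
      a : Fin Triples → State → ℕ
      a c F = ∑[ x ← all ] (𝟙 (code v w x Fin.≟ c) * bit F (code v w′ x) + 𝟙 (code v w′ x Fin.≟ c) * bit F (code v w x))
      e : ∀ d → 8 * d + 8 * d ≡ 16 * d
      e = solve-∀
      e₂ : ∀ q → q ≡ 1 * q * 1
      e₂ = solve-∀
      forced : ∀ F → w ≢ w′ × deg F v w ≤ 8 * d × deg F v w′ ≤ 8 * d × 4 * suc E ≤ codeg F v w w′ →
        4 * 1 * (E + 1) ≤ codeg F v w w′ × ∑ Fs (λ c → a c F) ≤ 1 * q * 1 × (∀ c → c ∈ Fs → a c F ≤ 2)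
      forced F (_ , d₁ , d₂ , large) = subst (λ z → 4 * z ≤ codeg F v w w′) (+-comm 1 E) large
        , (begin
          ∑ Fs (λ c → a c F)       ≡⟨ trans (∑-cong Fs (λ c → ∑-+ all _ _)) (∑-+ Fs _ _) ⟩
          _                        ≤⟨ +-mono-≤ (hits Fs-unique all (code v w) _) (hits Fs-unique all (code v w′) _) ⟩
          deg F v w′ + deg F v w   ≤⟨ +-mono-≤ d₂ d₁ ⟩
          8 * d + 8 * d            ≡⟨ e d ⟩
          16 * d                   ≤⟨ 16d≤q ⟩
          q                        ≡⟨ e₂ q ⟩
          1 * q * 1                ∎)
        , λ c _ → begin
          a c F                    ≡⟨ ∑-+ all _ _ ⟩
          _                        ≤⟨ +-mono-≤ (∑-mono all (λ x → bit*≤ F _ _)) (∑-mono all (λ x → bit*≤ F _ _)) ⟩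
          (∑[ x ← all ] 𝟙 (code v w x Fin.≟ c)) + (∑[ x ← all ] 𝟙 (code v w′ x Fin.≟ c))
                                   ≤⟨ +-mono-≤ (code-unique v w c) (code-unique v w′ c) ⟩
          2                        ∎

    rare : Probability≤2^- event E
    rare = by (w Fin.≟ w′)
      where
      by : Dec (w ≡ w′) → Probability≤2^- event E
      by (yes w≡w′) = ≤-trans (≤-reflexive (cong (_* 2 ^ E) (∑-outcomes≡0 Fs ∅ event λ F _ p →
            ⊥-elim (proj₁ (1≤𝟙⇒ (condition? F) p) w≡w′)))) z≤n
      by (no w≢w′) = from-tail event E 1 (
        (tail-bound a (λ F → codeg F v w w′) event
          (λ c {ω} {F} s → ∑-mono all (λ x → +-mono-≤ (*-monoʳ (𝟙 (code v w x Fin.≟ c)) (⊑-bit {ω} {F} s _))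
                                                    (*-monoʳ (𝟙 (code v w′ x Fin.≟ c)) (⊑-bit {ω} {F} s _))))
          (λ {ω} {F} s → ∑-mono all (λ x → *-mono-≤ (⊑-bit {ω} {F} s _) (⊑-bit {ω} {F} s _)))
          (λ F → 𝟙≤1 (condition? F)) 1 Fs ∅ (E + 1) 1
          (λ c _ ω → ≤-trans (∑-mono all (λ x → pair-step ω c (w≢w′ ∘ differ x))) (≤-reflexive (∑-+ all _ _)))
          (trans (∑-cong all (λ x → cong (_* bit ∅ (code v w′ x)) (bit-∅ (code v w x)))) (∑-zero all))
          λ F _ p → forced F (1≤𝟙⇒ (condition? F) p)))

  Touches : Fin Triples → V → Set
  Touches c x = ∃[ y ] ∃[ z ] code x y z ≡ c

  touches? : ∀ c x → Dec (Touches c x)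
  touches? c x = Fin.any? (λ y → Fin.any? (λ z → code x y z Fin.≟ c))

  module Family {K : ℕ} (g : Fin K → V) where

    idx : List (Fin K)
    idx = allFin K

    -- Leaves in distinct clusters of one colour may share clusters of the other: multiplicity 1 is
    -- available in the colour that separates them, `s` in the other.
    Fibres≤ : ℕ → Set
    Fibres≤ s = ∀ x → ∑[ i ← idx ] 𝟙 (g i Fin.≟ x) ≤ s

    fibres? : ∀ s → Dec (Fibres≤ s)
    fibres? s = Fin.all? (λ x → ∑[ i ← idx ] 𝟙 (g i Fin.≟ x) ≤? s)

    -- A coordinate in use codes three clusters, each taken at most `s` times by the family.
    touch-count : ∀ {s} → Fibres≤ s → ∀ c → ∑[ i ← idx ] 𝟙 (touches? c (g i)) ≤ 3 * s
    touch-count {s} fib c with Fin.any? (λ i → touches? c (g i))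
    ... | no none = ≤-trans (∑-mono idx (λ i → 𝟙-≤ (touches? c (g i)) {0} (λ t → ⊥-elim (none (i , t)))))
                      (≤-trans (≤-reflexive (∑-zero idx)) z≤n)
    ... | yes (i₀ , y₀ , z₀ , e₀) = begin
      ∑[ i ← idx ] 𝟙 (touches? c (g i)) ≤⟨ ∑-mono idx (λ i → 𝟙-≤ (touches? c (g i)) (λ where (y , z , e) → one i (code-∈₃ (trans e (sym e₀))))) ⟩
      ∑[ i ← idx ] (p i x₀ + (p i y₀ + p i z₀)) ≡⟨ trans (∑-+ idx _ _) (cong (∑ idx (λ i → p i x₀) +_) (∑-+ idx _ _)) ⟩
      _                                ≤⟨ +-mono-≤ (fib x₀) (+-mono-≤ (fib y₀) (fib z₀)) ⟩
      s + (s + s)                      ≡⟨ e s ⟩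
      3 * s                            ∎
      where
      open ≤-Reasoning
      x₀ = g i₀
      p : Fin K → V → ℕ
      p i x = 𝟙 (g i Fin.≟ x)
      p-yes : ∀ i {x} → g i ≡ x → 1 ≤ p i x
      p-yes i eq = ≤-reflexive (sym (𝟙-yes (g i Fin.≟ _) eq))
      one : ∀ i → g i ∈₃ (x₀ , y₀ , z₀) → 1 ≤ p i x₀ + (p i y₀ + p i z₀)
      one i (inj₁ eq)        = ≤-trans (p-yes i eq) (m≤m+n _ _)
      one i (inj₂ (inj₁ eq)) = ≤-trans (p-yes i eq) (≤-trans (m≤m+n _ _) (m≤n+m _ (p i x₀)))
      one i (inj₂ (inj₂ eq)) = ≤-trans (p-yes i eq) (≤-trans (m≤n+m _ (p i y₀)) (m≤n+m _ (p i x₀)))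
      e : ∀ s → s + (s + s) ≡ 3 * s
      e = solve-∀

    Caps : ℕ → State → V → Set
    Caps d F v = ∀ x → deg F v x ≤ 8 * d

    caps? : ∀ d F v → Dec (Caps d F v)
    caps? d F v = Fin.all? (λ x → deg F v x ≤? 8 * d)

    -- In the link graph of `v`, this is the degree of `w` into the family, with multiplicity. Its
    -- square counts the paths of length two through `w` with both ends in the family.
    weight : State → V → V → ℕ
    weight F v w = ∑[ i ← idx ] bit F (code v (g i) w)

    ∑-weight : ∀ {d} F v → Caps d F v → ∑ all (weight F v) ≤ K * (8 * d)
    ∑-weight {d} F v caps = begin
      ∑ all (weight F v)              ≡⟨ ∑-swap all idx _ ⟩
      ∑[ i ← idx ] deg F v (g i)      ≤⟨ ∑-bound idx (λ i → caps (g i)) ⟩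
      length idx * (8 * d)            ≡⟨ cong (_* (8 * d)) (length-allFin K) ⟩
      K * (8 * d)                     ∎
      where open ≤-Reasoning

    -- Weights are truncated at h to keep the increments small; the few heavier vertices are treated
    -- through the codegrees.
    squares : ℕ → State → V → ℕ
    squares h F v = ∑[ w ← all ] (weight F v w ⊓ h) * (weight F v w ⊓ h)

    module Light (d s h h₂ X Y : ℕ) {{_ : NonZero h₂}}
      (increment : 3 * s * (2 * h + 3 * s) ≤ 2 * h₂)
      (drift : K * (2 * (K * (8 * d)) + 3 * s * m) ≤ h₂ * q * Y) (v : V) where

      condition? : ∀ F → Dec (Fibres≤ s × Caps d F v × 4 * h₂ * (X + Y) ≤ squares h F v)
      condition? F = fibres? s ×-dec caps? d F v ×-dec (4 * h₂ * (X + Y) ≤? squares h F v)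

      event : State → ℕ
      event F = 𝟙 (condition? F)

      private
        δ : Fin Triples → V → ℕ
        δ c w = ∑[ i ← idx ] 𝟙 (code v (g i) w Fin.≟ c)

        -- The expansion of (u + δ)² - u², which remains an upper bound for truncated weights by
        -- `min-square`. Since the `δ c w` add up to at most `3 * s`, truncation at `h` keeps one
        -- increment small; the total drift is estimated with the full weights.
        a : Fin Triples → State → ℕ
        a c F = ∑[ w ← all ] δ c w * (2 * (weight F v w ⊓ h) + δ c w)

        open ≤-Reasoning

        weight-mono : ∀ {ω F} → ω ⊑ F → ∀ w → weight ω v w ≤ weight F v w
        weight-mono {ω} {F} r w = ∑-mono idx (λ i → ⊑-bit {ω} {F} r _)

        min-square : ∀ u t → ((u + t) ⊓ h) * ((u + t) ⊓ h) ≤ (u ⊓ h) * (u ⊓ h) + t * (2 * (u ⊓ h) + t)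
        min-square u t = ≤-trans (*-mono-≤ le le) (≤-reflexive (e (u ⊓ h) t))
          where
          le : (u + t) ⊓ h ≤ u ⊓ h + t
          le = ≤-trans (⊓-monoʳ-≤ (u + t) (m≤m+n h t)) (≤-reflexive (sym (+-distribʳ-⊓ t u h)))
          e : ∀ a t → (a + t) * (a + t) ≡ a * a + t * (2 * a + t)
          e = solve-∀

        step : ∀ c → c ∈ Fs → ∀ ω → squares h (ω ⊕ c) v ≤ squares h ω v + a c ω
        step c _ ω = ≤-trans (∑-mono all (λ w → ≤-trans (*-mono-≤ (grow w) (grow w)) (min-square (weight ω v w) (δ c w))))
          (≤-reflexive (∑-+ all _ _))
          where
          grow : ∀ w → weight (ω ⊕ c) v w ⊓ h ≤ (weight ω v w + δ c w) ⊓ h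
          grow w = ⊓-monoˡ-≤ h (≤-trans (∑-mono idx (λ i → bit-⊕ ω c _)) (≤-reflexive (∑-+ idx _ _)))

        total : Fibres≤ s → ∀ c → ∑ all (δ c) ≤ 3 * s
        total fib c = begin
          ∑ all (δ c)                       ≡⟨ ∑-swap all idx _ ⟩
          ∑[ i ← idx ] ∑[ w ← all ] 𝟙 (code v (g i) w Fin.≟ c) ≤⟨ ∑-mono idx single ⟩
          ∑[ i ← idx ] 𝟙 (touches? c (g i)) ≤⟨ touch-count fib c ⟩
          3 * s                             ∎
          where
          single : ∀ i → ∑[ w ← all ] 𝟙 (code v (g i) w Fin.≟ c) ≤ 𝟙 (touches? c (g i))
          single i with touches? c (g i)
          ... | yes _ = code-unique v (g i) c
          ... | no ¬t = ≤-trans (∑-mono all (λ w → 𝟙-≤ (code v (g i) w Fin.≟ c) {0}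
            (λ eq → ⊥-elim (¬t (v , w , trans (code-sym₁₂ (g i) v w) eq))))) (≤-reflexive (∑-zero all))

        δ≤ : Fibres≤ s → ∀ c w → δ c w ≤ 3 * s
        δ≤ fib c w = ≤-trans (∑-∈ (δ c) (∈-allFin w)) (total fib c)

        small : Fibres≤ s → ∀ F c → a c F ≤ 2 * h₂
        small fib F c = begin
          a c F                                   ≤⟨ ∑-mono all (λ w → *-monoʳ (δ c w)
              (+-mono-≤ (*-monoʳ 2 (m⊓n≤n (weight F v w) h)) (δ≤ fib c w))) ⟩
          ∑[ w ← all ] δ c w * (2 * h + 3 * s)    ≡⟨ ∑-*ʳ all _ _ ⟩
          ∑ all (δ c) * (2 * h + 3 * s)           ≤⟨ *-monoˡ _ (total fib c) ⟩
          3 * s * (2 * h + 3 * s)                 ≤⟨ increment ⟩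
          2 * h₂                                  ∎

        drifts : Fibres≤ s → ∀ F → Caps d F v → ∑ Fs (λ c → a c F) ≤ h₂ * q * Y
        drifts fib F caps = begin
          ∑ Fs (λ c → a c F)
            ≤⟨ ∑-mono Fs (λ c → ∑-mono all (λ w → *-monoʳ (δ c w) (+-mono-≤ (*-monoʳ 2 (m⊓n≤m (weight F v w) h)) (δ≤ fib c w)))) ⟩
          ∑[ c ← Fs ] ∑[ w ← all ] δ c w * (2 * weight F v w + 3 * s)
            ≡⟨ ∑-swap Fs all _ ⟩
          ∑[ w ← all ] ∑[ c ← Fs ] δ c w * (2 * weight F v w + 3 * s)
            ≡⟨ ∑-cong all (λ w → ∑-*ʳ Fs _ _) ⟩
          ∑[ w ← all ] (∑[ c ← Fs ] δ c w) * (2 * weight F v w + 3 * s)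
            ≤⟨ ∑-mono all (λ w → *-monoˡ _ (≤-trans (hits₁ Fs-unique idx (λ i → code v (g i) w)) (≤-reflexive (length-allFin K)))) ⟩
          ∑[ w ← all ] K * (2 * weight F v w + 3 * s)
            ≡⟨ trans (∑-*ˡ all K _) (cong (K *_) (trans (∑-+ all _ _) (cong₂ _+_ (∑-*ˡ all 2 _) (∑-const all (3 * s))))) ⟩
          K * (2 * ∑ all (weight F v) + length all * (3 * s))
            ≤⟨ *-monoʳ K (+-mono-≤ (*-monoʳ 2 (∑-weight {d} F v caps)) (≤-reflexive (trans (cong (_* (3 * s)) (length-allFin m)) (*-comm m (3 * s))))) ⟩
          K * (2 * (K * (8 * d)) + 3 * s * m)
            ≤⟨ drift ⟩
          h₂ * q * Y ∎

      rare : Probability≤2^- event X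
      rare = from-tail event X Y (
        (tail-bound a (λ F → squares h F v) event
          (λ c {ω} {F} r → ∑-mono all (λ w → *-monoʳ (δ c w) (+-monoˡ-≤ (δ c w) (*-monoʳ 2 (⊓-monoˡ-≤ h (weight-mono {ω} {F} r w))))))
          (λ {ω} {F} r → ∑-mono all (λ w → *-mono-≤ (⊓-monoˡ-≤ h (weight-mono {ω} {F} r w)) (⊓-monoˡ-≤ h (weight-mono {ω} {F} r w))))
          (λ F → 𝟙≤1 (condition? F)) h₂ Fs ∅ (X + Y) Y step
          (trans (∑-cong all (λ w → cong (λ z → (z ⊓ h) * (z ⊓ h)) (trans (∑-cong idx (λ i → bit-∅ _)) (∑-zero idx)))) (∑-zero all))
          λ F _ p → let (fib , caps , large) = 1≤𝟙⇒ (condition? F) p in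
            large , drifts fib F caps , λ c _ → small fib F c))

    -- Under this condition the triple of `g i`, `g j`, `w` avoids `v`, so the two factors of a term
    -- of `mixed` are decided in different phases of the exposure.
    Apart : V → Fin K → Fin K → V → Set
    Apart v i j w = g i ≢ v × g j ≢ v × w ≢ v

    apart? : ∀ v i j w → Dec (Apart v i j w)
    apart? v i j w = ¬? (g i Fin.≟ v) ×-dec ¬? (g j Fin.≟ v) ×-dec ¬? (w Fin.≟ v)

    mixed : State → V → ℕ
    mixed F v = ∑[ i ← idx ] ∑[ j ← idx ] ∑[ w ← all ]
      𝟙 (apart? v i j w) * (bit F (code v (g i) w) * bit F (code (g i) (g j) w))

    module Mixed (d s h₂ X Y : ℕ) {{_ : NonZero h₂}}
      (increment : 3 * s * (3 * s) ≤ 2 * h₂)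
      (drift : K * (K * (8 * d)) ≤ h₂ * q * Y) (v : V) where

      condition? : ∀ F → Dec (Fibres≤ s × Caps d F v × 4 * h₂ * (X + Y) ≤ mixed F v)
      condition? F = fibres? s ×-dec caps? d F v ×-dec (4 * h₂ * (X + Y) ≤? mixed F v)

      event : State → ℕ
      event F = 𝟙 (condition? F)

      private
        -- Exposing the link of v first makes `mixed` linear in the remaining coordinates.
        link others : List (Fin Triples)
        link   = filter (λ c → touches? c v) Fs
        others = filter (¬? ∘ λ c → touches? c v) Fs

        a : Fin Triples → State → ℕ
        a c F = ∑[ i ← idx ] ∑[ j ← idx ] ∑[ w ← all ]
          𝟙 (apart? v i j w) * (bit F (code v (g i) w) * 𝟙 (code (g i) (g j) w Fin.≟ c))

        ∑³-mono : ∀ {f f′ : Fin K → Fin K → V → ℕ} → (∀ i j w → f i j w ≤ f′ i j w) →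
          ∑[ i ← idx ] ∑[ j ← idx ] ∑[ w ← all ] f i j w ≤ ∑[ i ← idx ] ∑[ j ← idx ] ∑[ w ← all ] f′ i j w
        ∑³-mono p = ∑-mono idx (λ i → ∑-mono idx (λ j → ∑-mono all (p i j)))

        ∑³-+ : ∀ (f f′ : Fin K → Fin K → V → ℕ) → ∑[ i ← idx ] ∑[ j ← idx ] ∑[ w ← all ] (f i j w + f′ i j w)
          ≡ (∑[ i ← idx ] ∑[ j ← idx ] ∑[ w ← all ] f i j w) + (∑[ i ← idx ] ∑[ j ← idx ] ∑[ w ← all ] f′ i j w)
        ∑³-+ f f′ = trans (∑-cong idx (λ i → trans (∑-cong idx (λ j → ∑-+ all _ _)) (∑-+ idx _ _))) (∑-+ idx _ _)

        open ≤-Reasoning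

        ¬touches : ∀ {i j w} → Apart v i j w → ¬ Touches (code (g i) (g j) w) v
        ¬touches (i≢ , j≢ , w≢) (y , z , e) with code-∈₃ e
        ... | inj₁ p        = i≢ (sym p)
        ... | inj₂ (inj₁ p) = j≢ (sym p)
        ... | inj₂ (inj₂ p) = w≢ (sym p)

        step : ∀ c → c ∈ others → ∀ ω → mixed (ω ⊕ c) v ≤ mixed ω v + a c ω
        step c c∈ ω = ≤-trans (∑³-mono one) (≤-reflexive (∑³-+ _ _))
          where
          ¬t : ¬ Touches c v
          ¬t = proj₂ (∈-filter⁻ (¬? ∘ λ c → touches? c v) {xs = Fs} c∈)
          one : ∀ i j w → 𝟙 (apart? v i j w) * (bit (ω ⊕ c) (code v (g i) w) * bit (ω ⊕ c) (code (g i) (g j) w))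
            ≤ 𝟙 (apart? v i j w) * (bit ω (code v (g i) w) * bit ω (code (g i) (g j) w))
            + 𝟙 (apart? v i j w) * (bit ω (code v (g i) w) * 𝟙 (code (g i) (g j) w Fin.≟ c))
          one i j w = begin
            χ * (bit (ω ⊕ c) e₁ * bit (ω ⊕ c) e₂)
              ≤⟨ *-monoʳ χ (*-mono-≤ (≤-reflexive (bit-⊕-≢ ω (λ e → ¬t (g i , w , e)))) (bit-⊕ ω c e₂)) ⟩
            χ * (bit ω e₁ * (bit ω e₂ + 𝟙 (e₂ Fin.≟ c)))
              ≡⟨ e χ (bit ω e₁) (bit ω e₂) (𝟙 (e₂ Fin.≟ c)) ⟩
            χ * (bit ω e₁ * bit ω e₂) + χ * (bit ω e₁ * 𝟙 (e₂ Fin.≟ c)) ∎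
            where
            χ = 𝟙 (apart? v i j w)
            e₁ = code v (g i) w
            e₂ = code (g i) (g j) w
            e : ∀ x a b c → x * (a * (b + c)) ≡ x * (a * b) + x * (a * c)
            e = solve-∀

        -- Both `g i` and `g j` must occur in the triple coded by `c`, and then `w` is determined;
        -- this leaves at most (3s)² terms.
        small : Fibres≤ s → ∀ F c → a c F ≤ 2 * h₂
        small fib F c = begin
          a c F ≤⟨ ∑-mono idx (λ i → ∑-mono idx (pair i)) ⟩
          ∑[ i ← idx ] ∑[ j ← idx ] t i * t j ≡⟨ ∑-cong idx (λ i → ∑-*ˡ idx (t i) t) ⟩
          ∑[ i ← idx ] t i * ∑ idx t          ≡⟨ ∑-*ʳ idx _ t ⟩
          ∑ idx t * ∑ idx t                   ≤⟨ *-mono-≤ (touch-count fib c) (touch-count fib c) ⟩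
          3 * s * (3 * s)                     ≤⟨ increment ⟩
          2 * h₂                              ∎
          where
          t : Fin K → ℕ
          t i = 𝟙 (touches? c (g i))
          pair : ∀ i j → ∑[ w ← all ] 𝟙 (apart? v i j w) * (bit F (code v (g i) w) * 𝟙 (code (g i) (g j) w Fin.≟ c)) ≤ t i * t j
          pair i j = ≤-trans (∑-mono all (λ w → ≤-trans (*-mono-≤ (𝟙≤1 (apart? v i j w)) (*-monoˡ _ (bit≤1 F (code v (g i) w))))
            (≤-reflexive (trans (*-identityˡ _) (*-identityˡ _))))) bound
            where
            bound : ∑[ w ← all ] 𝟙 (code (g i) (g j) w Fin.≟ c) ≤ t i * t j
            bound with touches? c (g i) | touches? c (g j)
            ... | yes _ | yes _ = code-unique (g i) (g j) c
            ... | yes _ | no ¬t = ≤-trans (∑-mono all (λ w → 𝟙-≤ (code (g i) (g j) w Fin.≟ c) {0}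
              (λ e → ⊥-elim (¬t (g i , w , trans (code-sym₁₂ (g j) (g i) w) e))))) (≤-reflexive (∑-zero all))
            ... | no ¬t | _     = ≤-trans (∑-mono all (λ w → 𝟙-≤ (code (g i) (g j) w Fin.≟ c) {0}
              (λ e → ⊥-elim (¬t (g j , w , e))))) (≤-reflexive (∑-zero all))

        drifts : ∀ F → Caps d F v → ∑ others (λ c → a c F) ≤ h₂ * q * Y
        drifts F caps = begin
          ∑ others (λ c → a c F)
            ≤⟨ ∑-mono others (λ c → ∑³-mono (λ i j w → ≤-trans (*-monoˡ _ (𝟙≤1 (apart? v i j w)))
                 (≤-reflexive (trans (*-identityˡ _) (*-comm (bit F (code v (g i) w)) _))))) ⟩
          ∑[ c ← others ] ∑[ i ← idx ] ∑[ j ← idx ] ∑[ w ← all ] 𝟙 (code (g i) (g j) w Fin.≟ c) * bit F (code v (g i) w)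
            ≡⟨ trans (∑-swap others idx _) (∑-cong idx (λ i → ∑-swap others idx _)) ⟩
          ∑[ i ← idx ] ∑[ j ← idx ] ∑[ c ← others ] ∑[ w ← all ] 𝟙 (code (g i) (g j) w Fin.≟ c) * bit F (code v (g i) w)
            ≤⟨ ∑-mono idx (λ i → ∑-bound idx (λ j → ≤-trans
                 (hits (filter⁺ (¬? ∘ λ c → touches? c v) Fs-unique) all (code (g i) (g j)) (λ w → bit F (code v (g i) w)))
                 (caps (g i)))) ⟩
          ∑[ i ← idx ] length idx * (8 * d)
            ≡⟨ trans (∑-const idx _) (cong₂ (λ k l → k * (l * (8 * d))) (length-allFin K) (length-allFin K)) ⟩
          K * (K * (8 * d)) ≤⟨ drift ⟩
          h₂ * q * Y ∎

        initially-zero : ∀ ω → ω ∈ outcomes link ∅ → mixed ω v ≡ 0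
        initially-zero ω ω∈ = n≤0⇒n≡0 (≤-trans (∑³-mono one) (≤-reflexive (trans (∑-cong idx (λ i →
          trans (∑-cong idx (λ j → ∑-zero all)) (∑-zero idx))) (∑-zero idx))))
          where
          one : ∀ i j w → 𝟙 (apart? v i j w) * (bit ω (code v (g i) w) * bit ω (code (g i) (g j) w)) ≤ 0
          one i j w with apart? v i j w
          ... | no  _  = z≤n
          ... | yes ap = ≤-reflexive (trans (*-identityˡ _) (trans (cong (bit ω (code v (g i) w) *_) unset) (*-zeroʳ (bit ω (code v (g i) w)))))
            where
            unset : bit ω (code (g i) (g j) w) ≡ 0
            unset = trans (cong (λ b → if b then 1 else 0) (outcomes-∉ link ∅ ω∈
              λ e∈ → ¬touches ap (proj₂ (∈-filter⁻ (λ c → touches? c v) {xs = Fs} e∈)))) (bit-∅ (code (g i) (g j) w))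

        conditional : ∀ ω → ω ∈ outcomes link ∅ → ∑ (outcomes others ω) event * 2 ^ (X + Y) ≤ q ^ length others * 2 ^ Y
        conditional ω ω∈ = tail-bound a (λ F → mixed F v) event
          (λ c {ω} {F} r → ∑³-mono (λ i j w → *-monoʳ (𝟙 (apart? v i j w)) (*-monoˡ _ (⊑-bit {ω} {F} r _))))
          (λ {ω} {F} r → ∑³-mono (λ i j w → *-monoʳ (𝟙 (apart? v i j w)) (*-mono-≤ (⊑-bit {ω} {F} r _) (⊑-bit {ω} {F} r _))))
          (λ F → 𝟙≤1 (condition? F)) h₂ others ω (X + Y) Y step (initially-zero ω ω∈)
          λ F _ p → let (fib , caps , large) = 1≤𝟙⇒ (condition? F) p in large , drifts F caps , λ c _ → small fib F c

      rare : Probability≤2^- event X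
      rare = from-tail event X Y (begin
        ∑ (outcomes Fs ∅) event * 2 ^ (X + Y)
          -- The bound on the second phase is uniform in the outcome of the first, so summing over
          -- the link of `v` loses nothing.
          ≡⟨ cong (_* 2 ^ (X + Y)) (trans (∑-outcomes-↭ split ∅ event) (∑-outcomes-++ link others ∅ event)) ⟩
        (∑[ ω ← outcomes link ∅ ] ∑ (outcomes others ω) event) * 2 ^ (X + Y)
          ≡⟨ ∑-*ʳ (outcomes link ∅) (2 ^ (X + Y)) (λ ω → ∑ (outcomes others ω) event) ⟨
        ∑[ ω ← outcomes link ∅ ] ∑ (outcomes others ω) event * 2 ^ (X + Y)
          ≤⟨ ∑-mono∈ (outcomes link ∅) conditional ⟩
        ∑[ ω ← outcomes link ∅ ] q ^ length others * 2 ^ Y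
          ≡⟨ ∑-const (outcomes link ∅) _ ⟩
        length (outcomes link ∅) * (q ^ length others * 2 ^ Y)
          ≡⟨ cong (_* (q ^ length others * 2 ^ Y)) (length-outcomes link ∅) ⟩
        q ^ length link * (q ^ length others * 2 ^ Y)
          ≡⟨ *-assoc (q ^ length link) _ _ ⟨
        q ^ length link * q ^ length others * 2 ^ Y
          ≡⟨ cong (_* 2 ^ Y) (^-distribˡ-+-* q (length link) (length others)) ⟨
        q ^ (length link + length others) * 2 ^ Y
          ≡⟨ cong (λ z → q ^ z * 2 ^ Y) (trans (sym (length-++ link)) (sym (↭-length split))) ⟩
        q ^ length Fs * 2 ^ Y ∎)
        where
        split : Fs ↭ link ++ others
        split = filter-split-↭ (λ c → touches? c v) Fs

-- Closed triples

length-product : ∀ {A B C : Set} (f : A → B → C) xs ys →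
  length (cartesianProductWith f xs ys) ≡ length xs * length ys
length-product f []       ys = refl
length-product f (x ∷ xs) ys = trans (length-++ (map (f x) ys)) (cong₂ _+_ (length-map (f x) ys) (length-product f xs ys))

vectors : ∀ {A : Set} k → List A → List (Vec A k)
vectors zero    xs = [] ∷ []
vectors (suc k) xs = cartesianProductWith _∷_ xs (vectors k xs)

length-vectors : ∀ {A : Set} k (xs : List A) → length (vectors k xs) ≡ length xs ^ k
length-vectors zero    xs = refl
length-vectors (suc k) xs = trans (length-product _∷_ xs (vectors k xs)) (cong (length xs *_) (length-vectors k xs))

∈-vectors : ∀ {A : Set} {k} {xs : List A} → (∀ x → x ∈ xs) → (v : Vec A k) → v ∈ vectors k xs
∈-vectors all []      = here refl
∈-vectors all (x ∷ v) = ∈-cartesianProductWith⁺ _∷_ (all x) (∈-vectors all v)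

-- Grouping the family by value charges every cluster at most `s` times. With `s = 1` the same lemma
-- serves for injections.
fibre-sum : ∀ {m K s} (g : Fin K → Fin m) → (∀ x → ∑[ i ← allFin K ] 𝟙 (g i Fin.≟ x) ≤ s) →
  ∀ f → ∑[ i ← allFin K ] f (g i) ≤ s * ∑ (allFin m) f
fibre-sum {m} {K} {s} g fib f = begin
  ∑[ i ← allFin K ] f (g i)
    ≤⟨ ∑-mono (allFin K) (λ i → ≤-trans (≤-reflexive (sym (trans (cong (_* f (g i)) (𝟙-yes (g i Fin.≟ g i) refl)) (*-identityˡ _))))
         (∑-∈ (λ x → 𝟙 (g i Fin.≟ x) * f x) (∈-allFin (g i)))) ⟩
  ∑[ i ← allFin K ] ∑[ x ← allFin m ] 𝟙 (g i Fin.≟ x) * f x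
    ≡⟨ ∑-swap (allFin K) (allFin m) _ ⟩
  ∑[ x ← allFin m ] ∑[ i ← allFin K ] 𝟙 (g i Fin.≟ x) * f x
    ≡⟨ ∑-cong (allFin m) (λ x → ∑-*ʳ (allFin K) (f x) _) ⟩
  ∑[ x ← allFin m ] (∑[ i ← allFin K ] 𝟙 (g i Fin.≟ x)) * f x
    ≤⟨ ∑-mono (allFin m) (λ x → *-monoˡ (f x) (fib x)) ⟩
  ∑[ x ← allFin m ] s * f x
    ≡⟨ ∑-*ˡ (allFin m) s f ⟩
  s * ∑ (allFin m) f ∎
  where open ≤-Reasoning

module Graph (m q′ : ℕ) {{_ : NonZero q′}} where

  open Random m q′ public

  private
    V : Set
    V = Fin m
    all : List V
    all = allFin m

  Ω : List State
  Ω = outcomes (allFin Triples) ∅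

  length-Ω : length Ω ≡ q ^ Triples
  length-Ω = trans (length-outcomes (allFin Triples) ∅) (cong (q ^_) (length-allFin Triples))

  union-bound : ∀ {I : Set} (is : List I) (event : I → State → ℕ) E c →
    (∀ i → Probability≤2^- (event i) E) → length is * c ≤ 2 ^ E →
    (∑[ F ← Ω ] ∑[ i ← is ] event i F) * c ≤ q ^ Triples
  union-bound is event E c rare few = *-cancelʳ-≤ _ _ (2 ^ E) {{m^n≢0 2 E}} (begin
    (∑[ F ← Ω ] ∑[ i ← is ] event i F) * c * 2 ^ E   ≡⟨ cong (λ z → z * c * 2 ^ E) (∑-swap Ω is _) ⟩
    (∑[ i ← is ] ∑[ F ← Ω ] event i F) * c * 2 ^ E   ≡⟨ e (∑[ i ← is ] ∑[ F ← Ω ] event i F) c (2 ^ E) ⟩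
    (∑[ i ← is ] ∑[ F ← Ω ] event i F) * 2 ^ E * c   ≡⟨ cong (_* c) (∑-*ʳ is (2 ^ E) _) ⟨
    (∑[ i ← is ] (∑[ F ← Ω ] event i F) * 2 ^ E) * c ≤⟨ *-monoˡ c (∑-bound is rare) ⟩
    length is * q ^ Triples * c                      ≡⟨ e₂ (length is) (q ^ Triples) c ⟩
    q ^ Triples * (length is * c)                    ≤⟨ *-monoʳ (q ^ Triples) few ⟩
    q ^ Triples * 2 ^ E                              ∎)
    where
    open ≤-Reasoning
    e : ∀ a b c → a * b * c ≡ a * c * b
    e = solve-∀
    e₂ : ∀ a b c → a * b * c ≡ b * (a * c)
    e₂ = solve-∀

  Adjacent : State → V → V → V → Set
  Adjacent F x y z = x ≢ y × y ≢ z × x ≢ z × lookup F (code x y z) ≡ true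

  adjacent? : ∀ F x y z → Dec (Adjacent F x y z)
  adjacent? F x y z = ¬? (x Fin.≟ y) ×-dec ¬? (y Fin.≟ z) ×-dec ¬? (x Fin.≟ z) ×-dec (lookup F (code x y z) Bool.≟ true)

  adjacent-sym₁₂ : ∀ {F x y z} → Adjacent F x y z → Adjacent F y x z
  adjacent-sym₁₂ {F} {x} {y} {z} (x≢y , y≢z , x≢z , b) =
    x≢y ∘ sym , x≢z , y≢z , trans (cong (lookup F) (code-sym₁₂ y x z)) b

  adjacent-sym₂₃ : ∀ {F x y z} → Adjacent F x y z → Adjacent F x z y
  adjacent-sym₂₃ {F} {x} {y} {z} (x≢y , y≢z , x≢z , b) =
    x≢z , y≢z ∘ sym , x≢y , trans (cong (lookup F) (code-sym₂₃ x z y)) b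

  adjacent-mono : ∀ {F G x y z} → F ⊑ G → Adjacent F x y z → Adjacent G x y z
  adjacent-mono {x = x} {y} {z} s (x≢y , y≢z , x≢z , b) = x≢y , y≢z , x≢z , s (code x y z) b

  -- For distinct clusters: two of the other three triples inside {x, y, z, w} are chosen, so that
  -- choosing {x, y, z} as well would complete a `K₄⁻`.
  Closed : State → V → V → V → Set
  Closed F x y z = ∃[ w ] (Adjacent F x y w × Adjacent F x z w ⊎ Adjacent F x y w × Adjacent F y z w ⊎ Adjacent F x z w × Adjacent F y z w)

  closed? : ∀ F x y z → Dec (Closed F x y z)
  closed? F x y z = Fin.any? λ w → (adjacent? F x y w ×-dec adjacent? F x z w)
    ⊎-dec (adjacent? F x y w ×-dec adjacent? F y z w) ⊎-dec (adjacent? F x z w ×-dec adjacent? F y z w)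

  closed-sym₁₂ : ∀ {F x y z} → Closed F x y z → Closed F y x z
  closed-sym₁₂ {F} (w , inj₁ (p , r))        = w , inj₂ (inj₁ (adjacent-sym₁₂ {F} p , r))
  closed-sym₁₂ {F} (w , inj₂ (inj₁ (p , r))) = w , inj₁ (adjacent-sym₁₂ {F} p , r)
  closed-sym₁₂     (w , inj₂ (inj₂ (p , r))) = w , inj₂ (inj₂ (r , p))

  closed-sym₂₃ : ∀ {F x y z} → Closed F x y z → Closed F x z y
  closed-sym₂₃     (w , inj₁ (p , r))        = w , inj₁ (r , p)
  closed-sym₂₃ {F} (w , inj₂ (inj₁ (p , r))) = w , inj₂ (inj₂ (p , adjacent-sym₁₂ {F} r))
  closed-sym₂₃ {F} (w , inj₂ (inj₂ (p , r))) = w , inj₂ (inj₁ (p , adjacent-sym₁₂ {F} r))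

  closed-mono : ∀ {F G x y z} → F ⊑ G → Closed F x y z → Closed G x y z
  closed-mono {F} {G} s (w , inj₁ (p , r))        = w , inj₁ (adjacent-mono {F} {G} s p , adjacent-mono {F} {G} s r)
  closed-mono {F} {G} s (w , inj₂ (inj₁ (p , r))) = w , inj₂ (inj₁ (adjacent-mono {F} {G} s p , adjacent-mono {F} {G} s r))
  closed-mono {F} {G} s (w , inj₂ (inj₂ (p , r))) = w , inj₂ (inj₂ (adjacent-mono {F} {G} s p , adjacent-mono {F} {G} s r))

  -- Degenerate triples are included, so that an unblocked triple automatically has the distinctness
  -- that `Adjacent` demands.
  Blocked : State → V → V → V → Set
  Blocked F x y z = (x ≡ y ⊎ x ≡ z ⊎ y ≡ z) ⊎ Closed F x y z

  blocked? : ∀ F x y z → Dec (Blocked F x y z)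
  blocked? F x y z = ((x Fin.≟ y) ⊎-dec (x Fin.≟ z) ⊎-dec (y Fin.≟ z)) ⊎-dec closed? F x y z

  blocked-mono : ∀ {F G x y z} → F ⊑ G → Blocked F x y z → Blocked G x y z
  blocked-mono         s (inj₁ p) = inj₁ p
  blocked-mono {F} {G} s (inj₂ p) = inj₂ (closed-mono {F} {G} s p)

  module Blocking (d s h κ : ℕ) (F : State) (v : V) (caps : ∀ x → deg F v x ≤ 8 * d)
    (codegs : ∀ w w′ → w ≢ w′ → codeg F v w w′ ≤ κ) {K : ℕ} (g : Fin K → V) where

    open Family g
    open ≤-Reasoning

    module _ (fib : Fibres≤ s) where

      weight≤ : ∀ w → weight F v w ≤ s * (8 * d)
      weight≤ w = ≤-trans (fibre-sum g fib (λ x → bit F (code v x w)))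
        (*-monoʳ s (≤-trans (≤-reflexive (∑-cong all (λ x → cong (bit F) (code-sym₂₃ v x w)))) (caps w)))

      common : ∀ w w′ → w ≢ w′ → ∑[ i ← idx ] bit F (code v (g i) w) * bit F (code v (g i) w′) ≤ s * κ
      common w w′ w≢w′ = ≤-trans (fibre-sum g fib (λ x → bit F (code v x w) * bit F (code v x w′)))
        (*-monoʳ s (≤-trans (≤-reflexive (∑-cong all (λ x → cong₂ _*_ (cong (bit F) (code-sym₂₃ v x w)) (cong (bit F) (code-sym₂₃ v x w′)))))
          (codegs w w′ w≢w′)))

      private
        b : Fin K → V → ℕ
        b i w = bit F (code v (g i) w)

        pairs : List V → Fin K → ℕ
        pairs []      i = 0
        pairs (w ∷ T) i = (∑[ w′ ← T ] b i w * b i w′) + pairs T i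

        -- If the leaf `i` is joined to n members of `T`, this is n ≤ 1 + n(n - 1)/2, since `pairs`
        -- counts the pairs of such members.
        crowding : ∀ T i → ∑ T (b i) ≤ 1 + pairs T i
        crowding []      i = z≤n
        crowding (w ∷ T) i with b i w | bit≤1 F (code v (g i) w)
        ... | zero        | _ = ≤-trans (crowding T i) (s≤s (m≤n+m _ (∑[ w′ ← T ] 0)))
        ... | suc zero    | _ = s≤s (≤-trans (≤-reflexive (∑-cong T (λ w′ → sym (*-identityˡ (b i w′))))) (m≤m+n _ (pairs T i)))
        ... | suc (suc _) | s≤s ()

        ∑-pairs : ∀ {T} → Unique T → ∑ idx (pairs T) ≤ length T * length T * (s * κ)
        ∑-pairs {[]}    u       = ≤-reflexive (∑-zero idx)
        ∑-pairs {w ∷ T} (w∉ ∷ u) = begin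
          ∑ idx (pairs (w ∷ T))
            ≡⟨ trans (∑-+ idx _ _) (cong (_+ ∑ idx (pairs T)) (∑-swap idx T _)) ⟩
          (∑[ w′ ← T ] ∑[ i ← idx ] b i w * b i w′) + ∑ idx (pairs T)
            ≤⟨ +-mono-≤ (∑-mono∈ T (λ w′ w′∈ → common w w′ (All.lookup w∉ w′∈))) (∑-pairs u) ⟩
          (∑[ w′ ← T ] s * κ) + l * l * (s * κ)
            ≡⟨ cong (_+ l * l * (s * κ)) (∑-const T (s * κ)) ⟩
          l * (s * κ) + l * l * (s * κ)
            ≤⟨ m≤m+n _ ((l + 1) * (s * κ)) ⟩
          l * (s * κ) + l * l * (s * κ) + (l + 1) * (s * κ)
            ≡⟨ e l (s * κ) ⟩
          suc l * suc l * (s * κ) ∎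
          where
          l = length T
          e : ∀ l x → l * x + l * l * x + (l + 1) * x ≡ suc l * suc l * x
          e = solve-∀

      -- A Bonferroni estimate: `K` leaves counted once each, plus overlaps. Two members of `T` have
      -- at most `s * κ` common leaves because codegrees are small.
      crowded-weight : ∀ {T} → Unique T → ∑ T (weight F v) ≤ K + length T * length T * (s * κ)
      crowded-weight {T} u = begin
        ∑ T (weight F v)            ≡⟨ ∑-swap T idx _ ⟩
        ∑[ i ← idx ] ∑ T (b i)      ≤⟨ ∑-mono idx (crowding T) ⟩
        ∑[ i ← idx ] (1 + pairs T i) ≡⟨ trans (∑-+ idx (λ _ → 1) (pairs T)) (cong (_+ ∑ idx (pairs T)) (trans (∑-const idx 1) (trans (*-identityʳ _) (length-allFin K)))) ⟩
        K + ∑ idx (pairs T)         ≤⟨ +-monoʳ-≤ K (∑-pairs u) ⟩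
        K + length T * length T * (s * κ) ∎

      module _ (t : ℕ) {{_ : NonZero t}} (2K≤th : 2 * K ≤ t * h) (ttsκ≤K : t * t * (s * κ) ≤ K) where

        -- Exactly `t` heavy vertices would have total weight above t h ≥ 2K, while their overlaps
        -- add at most `K` to the `K` leaves. The induction meets length `t` before any larger one,
        -- so the quadratic overlap term never gets out of hand.
        few-heavy : ∀ {T} → Unique T → All (λ w → h < weight F v w) T → length T < t
        few-heavy {[]}    u          heavy = >-nonZero⁻¹ t
        few-heavy {w ∷ T} u@(_ ∷ u′) heavy@(_ ∷ heavy′) with m≤n⇒m<n∨m≡n (few-heavy u′ heavy′)
        ... | inj₁ lt  = lt
        ... | inj₂ eq  = ⊥-elim (<-irrefl refl (begin-strict
          2 * K                                     ≤⟨ 2K≤th ⟩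
          t * h                                     <⟨ *-monoʳ-< t (n<1+n h) ⟩
          t * suc h                                 ≡⟨ cong (_* suc h) eq ⟨
          suc (length T) * suc h                    ≡⟨ ∑-const (w ∷ T) (suc h) ⟨
          ∑[ w ← w ∷ T ] suc h                      ≤⟨ ∑-mono∈ (w ∷ T) (λ w′ w′∈ → All.lookup heavy w′∈) ⟩
          ∑ (w ∷ T) (weight F v)                    ≤⟨ crowded-weight u ⟩
          K + suc (length T) * suc (length T) * (s * κ) ≡⟨ cong (λ z → K + z * z * (s * κ)) eq ⟩
          K + t * t * (s * κ)                       ≤⟨ +-monoʳ-≤ K ttsκ≤K ⟩
          K + K                                     ≡⟨ cong (K +_) (+-identityʳ K) ⟨
          2 * K                                     ∎))

        heavy? : ∀ w → Dec (h < weight F v w)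
        heavy? w = h <? weight F v w

        ∑-heavy : ∑[ w ← all ] 𝟙 (heavy? w) * weight F v w ≤ 2 * K
        ∑-heavy = begin
          ∑[ w ← all ] 𝟙 (heavy? w) * weight F v w ≡⟨ ∑-filter heavy? (weight F v) all ⟩
          ∑ T (weight F v)                        ≤⟨ crowded-weight u ⟩
          K + length T * length T * (s * κ)       ≤⟨ +-monoʳ-≤ K (≤-trans (*-monoˡ (s * κ) (*-mono-≤ l≤t l≤t)) ttsκ≤K) ⟩
          K + K                                   ≡⟨ cong (K +_) (+-identityʳ K) ⟨
          2 * K                                   ∎
          where
          T = filter heavy? all
          u : Unique T
          u = filter⁺ heavy? (allFin⁺ m)
          l≤t : length T ≤ t
          l≤t = <⇒≤ (few-heavy u (all-filter heavy? all))

        -- One factor of a heavy square is bounded by the largest possible weight, the remaining sum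
        -- by the total heavy weight, which is only `2 * K`.
        ∑-squares : ∑[ w ← all ] weight F v w * weight F v w ≤ squares h F v + s * (8 * d) * (2 * K)
        ∑-squares = begin
          ∑[ w ← all ] weight F v w * weight F v w ≤⟨ ∑-mono all split ⟩
          ∑[ w ← all ] ((weight F v w ⊓ h) * (weight F v w ⊓ h) + s * (8 * d) * (𝟙 (heavy? w) * weight F v w))
            ≡⟨ trans (∑-+ all _ _) (cong (squares h F v +_) (∑-*ˡ all (s * (8 * d)) _)) ⟩
          squares h F v + s * (8 * d) * (∑[ w ← all ] 𝟙 (heavy? w) * weight F v w)
            ≤⟨ +-monoʳ-≤ (squares h F v) (*-monoʳ (s * (8 * d)) ∑-heavy) ⟩
          squares h F v + s * (8 * d) * (2 * K) ∎
          where
          split : ∀ w → weight F v w * weight F v w ≤ (weight F v w ⊓ h) * (weight F v w ⊓ h) + s * (8 * d) * (𝟙 (heavy? w) * weight F v w)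
          split w with heavy? w
          ... | yes _ = ≤-trans (*-monoˡ _ (weight≤ w)) (≤-trans (≤-reflexive (cong (s * (8 * d) *_) (sym (*-identityˡ _)))) (m≤n+m _ ((weight F v w ⊓ h) * (weight F v w ⊓ h))))
          ... | no ¬p = ≤-trans (≤-reflexive (cong (λ z → z * z) (sym (m≤n⇒m⊓n≡m (≮⇒≥ ¬p))))) (m≤m+n _ _)

        private
          direct crossed : Fin K → Fin K → ℕ
          direct  i j = ∑[ w ← all ] b i w * b j w
          crossed i j = ∑[ w ← all ] 𝟙 (apart? v i j w) * (b i w * bit F (code (g i) (g j) w))

          bound : Fin K → Fin K → ℕ
          bound i j = 𝟙 (g i Fin.≟ v) + (𝟙 (g j Fin.≟ v) + (𝟙 (g i Fin.≟ g j) + (direct i j + (crossed i j + crossed j i))))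

          adj-bit : ∀ {x y z} → Adjacent F x y z → bit F (code x y z) ≡ 1
          adj-bit {x} {y} {z} (_ , _ , _ , e) = bit-true {F} {code x y z} e

          path : ∀ {i j w} → g j ≢ v → Adjacent F v (g i) w → Adjacent F (g i) (g j) w → 1 ≤ crossed i j
          path {i} {j} {w} j≢ p@(v≢i , _ , v≢w , _) r = ≤-trans (≤-reflexive (sym (cong₂ _*_
            (𝟙-yes (apart? v i j w) (v≢i ∘ sym , j≢ , v≢w ∘ sym)) (cong₂ _*_ (adj-bit p) (adj-bit r)))))
            (∑-∈ (λ w → 𝟙 (apart? v i j w) * (b i w * bit F (code (g i) (g j) w))) (∈-allFin w))

          -- Three terms pay for coinciding clusters, one for a path between the two leaves in the
          -- link of `v`, and two for a closing vertex `w` joined to only one of the leaves in that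
          -- link.
          blocked≤ : ∀ i j → 𝟙 (blocked? F v (g i) (g j)) ≤ bound i j
          blocked≤ i j = 𝟙-≤ (blocked? F v (g i) (g j)) case
            where
            c₁ = 𝟙 (g i Fin.≟ v)
            c₂ = 𝟙 (g j Fin.≟ v)
            c₃ = 𝟙 (g i Fin.≟ g j)
            at₂ : 1 ≤ c₂ → 1 ≤ bound i j
            at₂ p = ≤-trans p (≤-trans (m≤m+n c₂ _) (m≤n+m _ c₁))
            at₃ : ∀ {x} → x ≤ c₃ + (direct i j + (crossed i j + crossed j i)) → x ≤ bound i j
            at₃ p = ≤-trans p (≤-trans (m≤n+m _ c₂) (m≤n+m _ c₁))
            at₅ : ∀ {x} → x ≤ crossed i j + crossed j i → x ≤ bound i j
            at₅ p = at₃ (≤-trans p (≤-trans (m≤n+m _ (direct i j)) (m≤n+m _ c₃)))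
            case : Blocked F v (g i) (g j) → 1 ≤ bound i j
            case (inj₁ (inj₁ e))        = ≤-trans (≤-reflexive (sym (𝟙-yes (g i Fin.≟ v) (sym e)))) (m≤m+n c₁ _)
            case (inj₁ (inj₂ (inj₁ e))) = at₂ (≤-reflexive (sym (𝟙-yes (g j Fin.≟ v) (sym e))))
            case (inj₁ (inj₂ (inj₂ e))) = at₃ (≤-trans (≤-reflexive (sym (𝟙-yes (g i Fin.≟ g j) e))) (m≤m+n c₃ _))
            case (inj₂ (w , inj₁ (p , r))) = at₃ (≤-trans (≤-trans (≤-trans (≤-reflexive (sym (cong₂ _*_ (adj-bit p) (adj-bit r))))
              (∑-∈ (λ w → b i w * b j w) (∈-allFin w))) (m≤m+n (direct i j) _)) (m≤n+m _ c₃))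
            case (inj₂ (w , inj₂ (inj₁ (p , r)))) = far (g j Fin.≟ v)
              -- If `g j` is the cluster `v` itself, the path is not `Apart`, but a degenerate term
              -- already pays for the pair.
              where
              far : Dec (g j ≡ v) → 1 ≤ bound i j
              far (yes e) = at₂ (≤-reflexive (sym (𝟙-yes (g j Fin.≟ v) e)))
              far (no j≢) = at₅ (≤-trans (path j≢ p r) (m≤m+n _ _))
            case (inj₂ (w , inj₂ (inj₂ (p , r)))) = far (g i Fin.≟ v)
              where
              far : Dec (g i ≡ v) → 1 ≤ bound i j
              far (yes e) = ≤-trans (≤-reflexive (sym (𝟙-yes (g i Fin.≟ v) e))) (m≤m+n c₁ _)
              far (no i≢) = at₅ (≤-trans (path i≢ p (adjacent-sym₁₂ {F} r)) (m≤n+m _ (crossed i j)))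

        blocked-count : ∑[ i ← idx ] ∑[ j ← idx ] 𝟙 (blocked? F v (g i) (g j))
          ≤ 3 * (K * s) + (squares h F v + s * (8 * d) * (2 * K)) + 2 * mixed F v
        blocked-count = begin
          ∑[ i ← idx ] ∑[ j ← idx ] 𝟙 (blocked? F v (g i) (g j)) ≤⟨ ∑-mono idx (λ i → ∑-mono idx (blocked≤ i)) ⟩
          ∑[ i ← idx ] ∑[ j ← idx ] bound i j
            ≡⟨ trans (∑²-+ idx idx _ _) (cong (A₁ +_) (trans (∑²-+ idx idx _ _) (cong (A₂ +_) (trans (∑²-+ idx idx _ _) (cong (A₃ +_)
                 (trans (∑²-+ idx idx _ _) (cong (A₄ +_) (trans (∑²-+ idx idx _ _) (cong (mixed F v +_) (∑-swap idx idx _)))))))))) ⟩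
          A₁ + (A₂ + (A₃ + (A₄ + (mixed F v + mixed F v))))
            ≤⟨ +-mono-≤ a₁ (+-mono-≤ a₂ (+-mono-≤ a₃ (+-monoˡ-≤ _ a₄))) ⟩
          K * s + (K * s + (K * s + (squares h F v + s * (8 * d) * (2 * K) + (mixed F v + mixed F v))))
            ≡⟨ e (K * s) (squares h F v + s * (8 * d) * (2 * K)) (mixed F v) ⟩
          3 * (K * s) + (squares h F v + s * (8 * d) * (2 * K)) + 2 * mixed F v ∎
          where
          A₁ = ∑[ i ← idx ] ∑[ j ← idx ] 𝟙 (g i Fin.≟ v)
          A₂ = ∑[ i ← idx ] ∑[ j ← idx ] 𝟙 (g j Fin.≟ v)
          A₃ = ∑[ i ← idx ] ∑[ j ← idx ] 𝟙 (g i Fin.≟ g j)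
          A₄ = ∑[ i ← idx ] ∑[ j ← idx ] direct i j
          a₂ : A₂ ≤ K * s
          a₂ = ≤-trans (∑-bound idx (λ _ → fib v)) (≤-reflexive (cong (_* s) (length-allFin K)))
          a₁ : A₁ ≤ K * s
          a₁ = ≤-trans (≤-reflexive (∑-swap idx idx _)) a₂
          a₃ : A₃ ≤ K * s
          a₃ = ≤-trans (≤-reflexive (∑-swap idx idx _)) (≤-trans (∑-bound idx (λ j → fib (g j))) (≤-reflexive (cong (_* s) (length-allFin K))))
          a₄ : A₄ ≤ squares h F v + s * (8 * d) * (2 * K)
          a₄ = begin
            ∑[ i ← idx ] ∑[ j ← idx ] ∑[ w ← all ] b i w * b j w ≡⟨ ∑-cong idx (λ i → ∑-swap idx all _) ⟩
            ∑[ i ← idx ] ∑[ w ← all ] ∑[ j ← idx ] b i w * b j w ≡⟨ ∑-swap idx all _ ⟩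
            ∑[ w ← all ] ∑[ i ← idx ] ∑[ j ← idx ] b i w * b j w
              ≡⟨ ∑-cong all (λ w → trans (∑-cong idx (λ i → ∑-*ˡ idx (b i w) _)) (∑-*ʳ idx (weight F v w) _)) ⟩
            ∑[ w ← all ] weight F v w * weight F v w           ≤⟨ ∑-squares ⟩
            squares h F v + s * (8 * d) * (2 * K) ∎
          e : ∀ a b c → a + (a + (a + (b + (c + c)))) ≡ 3 * a + b + 2 * c
          e = solve-∀

-- The two-coloured hypergraph

-- m clusters and N vertices; triples of clusters are chosen with probability 1/(q′ + 1).  Every
-- cluster has at most s vertices, K is the number of distinct clusters looked at in a large set of
-- vertices, d is about √m, h and t separate light from heavy vertices of a link, and the
-- remaining numbers are the exponents of the tail bounds.
record Parameters : Set where
  field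
    m q′ d s h K t κ₀ h₂ X₂ Y₂ h₃ X₃ Y₃ N μ : ℕ
    {{q′≢0}} : NonZero q′
    {{t≢0}}  : NonZero t
    {{h₂≢0}} : NonZero h₂
    {{h₃≢0}} : NonZero h₃
    1≤s : 1 ≤ s
    m≤qd : m ≤ suc q′ * d
    16d≤q : 16 * d ≤ suc q′
    light-increment : 3 * s * (2 * h + 3 * s) ≤ 2 * h₂
    light-drift : K * (2 * (K * (8 * d)) + 3 * s * m) ≤ h₂ * suc q′ * Y₂
    mixed-increment : 3 * s * (3 * s) ≤ 2 * h₃
    mixed-drift : K * (K * (8 * d)) ≤ h₃ * suc q′ * Y₃
    2K≤th : 2 * K ≤ t * h
    heavy-overlaps : t * t * (s * (4 * suc κ₀)) ≤ K
    blocked-total : 8 * (3 * (K * s) + (4 * h₂ * (X₂ + Y₂) + s * (8 * d) * (2 * K)) + 2 * (4 * h₃ * (X₃ + Y₃))) ≤ K * K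
    degree-union : m * m * 16 ≤ 2 ^ d
    codegree-union : m * (m * m) * 16 ≤ 2 ^ κ₀
    light-union : m * m ^ K * 16 ≤ 2 ^ X₂
    mixed-union : m * m ^ K * 16 ≤ 2 ^ X₃
    survival-union : N * N ^ K * 8 ≤ 2 ^ μ
    4qμ≤KK : 4 * (suc q′ * μ) ≤ K * K

module Construction (P : Parameters) where

  open Parameters P
  open Graph m q′

  private
    V = Fin m
    all = allFin m
    all² = cartesianProduct all all
    all³ = cartesianProduct all all²
    families : List (V × Vec V K)
    families = cartesianProduct all (vectors K all)
    idx = allFin K

    length-all² : length all² ≡ m * m
    length-all² = trans (length-product _,_ all all) (cong₂ _*_ (length-allFin m) (length-allFin m))

    length-all³ : length all³ ≡ m * (m * m)
    length-all³ = trans (length-product _,_ all all²) (cong₂ _*_ (length-allFin m) length-all²)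

    length-families : length families ≡ m * m ^ K
    length-families = trans (length-product _,_ all (vectors K all))
      (cong₂ _*_ (length-allFin m) (trans (length-vectors K all) (cong (_^ K) (length-allFin m))))

    module D (vw : V × V) = Degree d m≤qd (proj₁ vw) (proj₂ vw)
    module C (vww′ : V × V × V) = Codegree d 16d≤q κ₀ (proj₁ vww′) (proj₁ (proj₂ vww′)) (proj₂ (proj₂ vww′))
    module L (vg : V × Vec V K) = Family.Light (lookup (proj₂ vg)) d s h h₂ X₂ Y₂ light-increment light-drift (proj₁ vg)
    module M (vg : V × Vec V K) = Family.Mixed (lookup (proj₂ vg)) d s h₃ X₃ Y₃ mixed-increment mixed-drift (proj₁ vg)

  D-bad C-bad L-bad M-bad bad : State → ℕ
  D-bad F = ∑[ i ← all² ] D.event i F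
  C-bad F = ∑[ i ← all³ ] C.event i F
  L-bad F = ∑[ i ← families ] L.event i F
  M-bad F = ∑[ i ← families ] M.event i F
  bad F = (D-bad F + C-bad F) + (L-bad F + M-bad F)

  -- Each of the four kinds of bad event has expected number at most 1/16.
  bad-rare : ∑ Ω bad * 4 ≤ q ^ Triples
  bad-rare = *-cancelʳ-≤ _ _ 4 (begin
    ∑ Ω bad * 4 * 4 ≡⟨ cong (λ z → z * 4 * 4) (trans (∑-+ Ω _ _) (cong₂ _+_ (∑-+ Ω _ _) (∑-+ Ω _ _))) ⟩
    ((∑ Ω D-bad + ∑ Ω C-bad) + (∑ Ω L-bad + ∑ Ω M-bad)) * 4 * 4
      ≡⟨ e (∑ Ω D-bad) (∑ Ω C-bad) (∑ Ω L-bad) (∑ Ω M-bad) ⟩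
    (∑ Ω D-bad * 16 + ∑ Ω C-bad * 16) + (∑ Ω L-bad * 16 + ∑ Ω M-bad * 16)
      ≤⟨ +-mono-≤
        (+-mono-≤ (union-bound all² D.event d 16 D.rare (subst (λ z → z * 16 ≤ 2 ^ d) (sym length-all²) degree-union))
                  (union-bound all³ C.event κ₀ 16 C.rare (subst (λ z → z * 16 ≤ 2 ^ κ₀) (sym length-all³) codegree-union)))
        (+-mono-≤ (union-bound families L.event X₂ 16 L.rare (subst (λ z → z * 16 ≤ 2 ^ X₂) (sym length-families) light-union))
                  (union-bound families M.event X₃ 16 M.rare (subst (λ z → z * 16 ≤ 2 ^ X₃) (sym length-families) mixed-union))) ⟩
    (Q + Q) + (Q + Q) ≡⟨ e₂ Q ⟩
    Q * 4             ∎)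
    where
    open ≤-Reasoning
    Q = q ^ Triples
    e : ∀ a b c d → ((a + b) + (c + d)) * 4 * 4 ≡ (a * 16 + b * 16) + (c * 16 + d * 16)
    e = solve-∀
    e₂ : ∀ a → (a + a) + (a + a) ≡ a * 4
    e₂ = solve-∀

  blocked-pairs : State → V → (Fin K → V) → ℕ
  blocked-pairs F v g = ∑[ i ← idx ] ∑[ j ← idx ] 𝟙 (blocked? F v (g i) (g j))

  -- One eighth of the pairs may be lost in each colour, so three quarters stay open.
  Good : State → Set
  Good F = ∀ v (g : Fin K → V) → Family.Fibres≤ g s → 8 * blocked-pairs F v g ≤ K * K

  good : ∀ F → bad F ≡ 0 → Good F
  good F none v g fib = subst (λ z → 8 * z ≤ K * K)
    (∑-cong idx (λ i → ∑-cong idx (λ j → cong₂ (λ x y → 𝟙 (blocked? F v x y)) (lookup∘tabulate g i) (lookup∘tabulate g j))))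
    (begin
    8 * blocked-pairs F v (lookup γ)
      ≤⟨ *-monoʳ 8 (Blocking.blocked-count d s h κ F v caps codegs (lookup γ) fib′ t 2K≤th heavy-overlaps) ⟩
    8 * (3 * (K * s) + (squares h F v + s * (8 * d) * (2 * K)) + 2 * mixed F v)
      ≤⟨ *-monoʳ 8 (+-mono-≤ (+-monoʳ-≤ (3 * (K * s)) (+-monoˡ-≤ _ few-squares)) (*-monoʳ 2 few-mixed)) ⟩
    8 * (3 * (K * s) + (4 * h₂ * (X₂ + Y₂) + s * (8 * d) * (2 * K)) + 2 * (4 * h₃ * (X₃ + Y₃)))
      ≤⟨ blocked-total ⟩
    K * K ∎)
    where
    open ≤-Reasoning
    -- The union bound runs over a finite list of vectors, so the function `g` is replaced by its
    -- table.
    γ = tabulate g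
    open Family (lookup γ) using (Fibres≤; squares; mixed)
    κ = 4 * suc κ₀
    fib′ : Fibres≤ s
    fib′ x = ≤-trans (≤-reflexive (∑-cong idx (λ i → cong (λ y → 𝟙 (y Fin.≟ x)) (lookup∘tabulate g i)))) (fib x)
    DC≡0 = m+n≡0⇒m≡0 (D-bad F + C-bad F) none
    LM≡0 = m+n≡0⇒n≡0 (D-bad F + C-bad F) none
    caps : ∀ {v} x → deg F v x ≤ 8 * d
    caps {v} x = <⇒≤ (≰⇒> (𝟙≡0⇒ (8 * d ≤? deg F v x) (∑≡0⇒ (λ i → D.event i F) (m+n≡0⇒m≡0 (D-bad F) DC≡0)
      (∈-cartesianProduct⁺ (∈-allFin v) (∈-allFin x)))))
    codegs : ∀ w w′ → w ≢ w′ → codeg F v w w′ ≤ κ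
    codegs w w′ w≢w′ = <⇒≤ (≰⇒> λ large → 𝟙≡0⇒ (C.condition? (v , w , w′) F) (∑≡0⇒ (λ i → C.event i F)
      (m+n≡0⇒n≡0 (D-bad F) DC≡0) (∈-cartesianProduct⁺ (∈-allFin v) (∈-cartesianProduct⁺ (∈-allFin w) (∈-allFin w′))))
      (w≢w′ , caps w , caps w′ , large))
    vγ∈ : (v , γ) ∈ families
    vγ∈ = ∈-cartesianProduct⁺ (∈-allFin v) (∈-vectors ∈-allFin γ)
    few-squares : squares h F v ≤ 4 * h₂ * (X₂ + Y₂)
    few-squares = <⇒≤ (≰⇒> λ large → 𝟙≡0⇒ (L.condition? (v , γ) F) (∑≡0⇒ (λ i → L.event i F)
      (m+n≡0⇒m≡0 (L-bad F) LM≡0) vγ∈) (fib′ , caps , large))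
    few-mixed : mixed F v ≤ 4 * h₃ * (X₃ + Y₃)
    few-mixed = <⇒≤ (≰⇒> λ large → 𝟙≡0⇒ (M.condition? (v , γ) F) (∑≡0⇒ (λ i → M.event i F)
      (m+n≡0⇒n≡0 (L-bad F) LM≡0) vγ∈) (fib′ , caps , large))

  -- π and F belong to the colour of the triple, ρ and G to the other colour.
  module Colour (π ρ : Fin N → V) (F G : State) where

    place : Fin N → Fin N → Fin N → Fin Triples
    place x y z = code (π x) (π y) (π z)

    Kept : Fin N → Fin N → Fin N → Set
    Kept x y z = Adjacent F (π x) (π y) (π z) × ¬ Closed (F ↾ place x y z) (π x) (π y) (π z) × ¬ Closed G (ρ x) (ρ y) (ρ z)

    kept? : ∀ x y z → Dec (Kept x y z)
    kept? x y z = adjacent? F (π x) (π y) (π z) ×-dec ¬? (closed? (F ↾ place x y z) (π x) (π y) (π z)) ×-dec ¬? (closed? G (ρ x) (ρ y) (ρ z))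

    kept-sym₁₂ : ∀ {x y z} → Kept x y z → Kept y x z
    kept-sym₁₂ {x} {y} {z} (a , p , r) = adjacent-sym₁₂ {F} a
      , (λ c → p (closed-sym₁₂ {F ↾ place x y z} (subst (λ e → Closed (F ↾ e) (π y) (π x) (π z)) (code-sym₁₂ (π y) (π x) (π z)) c)))
      , λ c → r (closed-sym₁₂ {G} c)

    kept-sym₂₃ : ∀ {x y z} → Kept x y z → Kept x z y
    kept-sym₂₃ {x} {y} {z} (a , p , r) = adjacent-sym₂₃ {F} a
      , (λ c → p (closed-sym₂₃ {F ↾ place x y z} (subst (λ e → Closed (F ↾ e) (π x) (π z) (π y)) (code-sym₂₃ (π x) (π z) (π y)) c)))
      , λ c → r (closed-sym₂₃ {G} c)

    last : ∀ {x y z w} → place x y w Fin.< place x y z → place x z w Fin.< place x y z →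
      Kept x y w → Kept x z w → ¬ Kept x y z
    last {x} {y} {z} {w} p<r p′<r ((y≢ , w≢ , v≢ , b) , _) ((y≢′ , w≢′ , v≢′ , b′) , _) (_ , open′ , _) =
      open′ (π w , inj₁ ((y≢ , w≢ , v≢ , trans (↾-below F p<r) b) , (y≢′ , w≢′ , v≢′ , trans (↾-below F p′<r) b′)))

    -- Any two of the three codes differ: their triples share two clusters, and the third edge keeps
    -- the remaining two clusters apart. The edge with the largest code then sees both others in its
    -- history and would not have been kept.
    triangle-free : ∀ {a b c d} → Kept a b c → Kept a b d → ¬ Kept a c d
    triangle-free {a} {b} {c} {d} k₁ k₂ k₃ = order (Fin.<-cmp e₁ e₂) (Fin.<-cmp e₁ e₃) (Fin.<-cmp e₂ e₃)
      where
      e₁ = place a b c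
      e₂ = place a b d
      e₃ = place a c d
      distinct : ∀ {x y z w} → Kept x z w → code (π x) (π y) (π z) ≡ code (π x) (π y) (π w) → ⊥
      distinct {x} {y} ((_ , z≢w , _) , _) e = z≢w (code-cancel {π x} {π y} e)
      on₃ : e₁ Fin.< e₃ → e₂ Fin.< e₃ → ⊥
      on₃ p r = last (subst (Fin._< e₃) (code-sym₂₃ _ _ _) p) (subst (Fin._< e₃) (code-sym₂₃ _ _ _) r) (kept-sym₂₃ k₁) (kept-sym₂₃ k₂) k₃
      on₂ : e₁ Fin.< e₂ → e₃ Fin.< e₂ → ⊥
      on₂ p r = last p (subst (Fin._< e₂) (code-sym₂₃ _ _ _) r) k₁ (kept-sym₂₃ k₃) k₂
      on₁ : e₂ Fin.< e₁ → e₃ Fin.< e₁ → ⊥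
      on₁ p r = last p r k₂ k₃ k₁
      order : Tri (e₁ Fin.< e₂) (e₁ ≡ e₂) (e₂ Fin.< e₁) → Tri (e₁ Fin.< e₃) (e₁ ≡ e₃) (e₃ Fin.< e₁) →
        Tri (e₂ Fin.< e₃) (e₂ ≡ e₃) (e₃ Fin.< e₂) → ⊥
      order (tri≈ _ e _) _ _ = distinct k₃ e
      order _ (tri≈ _ e _) _ = distinct k₂ (trans (code-sym₂₃ _ _ _) e)
      order _ _ (tri≈ _ e _) = distinct k₁ (trans (code-sym₂₃ _ _ _) (trans e (code-sym₂₃ _ _ _)))
      order (tri< p _ _) _ (tri> _ _ r) = on₂ p r
      order (tri< p _ _) (tri< r _ _) (tri< r′ _ _) = on₃ r r′
      order (tri> _ _ p) (tri> _ _ r) _ = on₁ p r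
      order (tri< p _ _) (tri> _ _ r) (tri< r′ _ _) = ⊥-elim (<-asym (<-trans p r′) r)
      order (tri> _ _ p) (tri< r _ _) (tri< r′ _ _) = on₃ r r′
      order (tri> _ _ p) (tri< r _ _) (tri> _ _ r′) = ⊥-elim (<-asym (<-trans r′ p) r)

  module Hypergraph (πr πb : Fin N → V) (R B : State) where

    module Red  = Colour πr πb R B
    module Blue = Colour πb πr B R

    H : 3Graph (Fin N)
    H = record
      { E     = λ x y z → Red.Kept x y z ⊎ Blue.Kept x y z
      ; sym₁₂ = λ where
          (inj₁ k) → inj₁ (Red.kept-sym₁₂ k)
          (inj₂ k) → inj₂ (Blue.kept-sym₁₂ k)
      ; sym₂₃ = λ where
          (inj₁ k) → inj₁ (Red.kept-sym₂₃ k)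
          (inj₂ k) → inj₂ (Blue.kept-sym₂₃ k)
      }

    private
      Edge = E H

      conflict : ∀ {a b c d} → Edge a b c → Edge a b d → Edge a c d → ⊥
      conflict (inj₁ p) (inj₁ r) (inj₁ s) = Red.triangle-free p r s
      conflict (inj₂ p) (inj₂ r) (inj₂ s) = Blue.triangle-free p r s
      conflict (inj₁ (p , _)) (inj₁ (r , _)) (inj₂ (_ , _ , s)) = s (_ , inj₁ (adjacent-sym₂₃ {R} p , adjacent-sym₂₃ {R} r))
      conflict (inj₂ (p , _)) (inj₂ (r , _)) (inj₁ (_ , _ , s)) = s (_ , inj₁ (adjacent-sym₂₃ {B} p , adjacent-sym₂₃ {B} r))
      conflict (inj₁ (p , _)) (inj₂ (_ , _ , r)) (inj₁ (s , _)) = r (_ , inj₁ (p , adjacent-sym₂₃ {R} s))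
      conflict (inj₂ (p , _)) (inj₁ (_ , _ , r)) (inj₂ (s , _)) = r (_ , inj₁ (p , adjacent-sym₂₃ {B} s))
      conflict (inj₂ (_ , _ , p)) (inj₁ (r , _)) (inj₁ (s , _)) = p (_ , inj₁ (r , s))
      conflict (inj₁ (_ , _ , p)) (inj₂ (r , _)) (inj₂ (s , _)) = p (_ , inj₁ (r , s))

    free : K₄⁻-free H
    free (f , inj , edges) = conflict
      (edges v₀ v₁ v₂ ((λ ()) , (λ ()) , (λ ())) (inj₁ refl))
      (edges v₀ v₁ v₃ ((λ ()) , (λ ()) , (λ ())) (inj₁ refl))
      (edges v₀ v₂ v₃ ((λ ()) , (λ ()) , (λ ())) (inj₁ refl))
      where
      v₀ v₁ v₂ v₃ : Fin 4
      v₀ = zero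
      v₁ = suc zero
      v₂ = suc (suc zero)
      v₃ = suc (suc (suc zero))

-- Survival of open triples

module Existence (P : Parameters) where

  open Parameters P
  open Construction P
  open Graph m q′

  private
    V = Fin m
    idx = allFin K

  -- The other colour's state `G` is arbitrary but fixed while `F` is random. Independence of the
  -- colours enters through this uniformity in `G`.
  module Star (π ρ : Fin N → V) (G : State) (v : Fin N) (x : Vec (Fin N) K) where

    g γ : Fin K → V
    g i = π (lookup x i)
    γ i = ρ (lookup x i)

    open Family g using (Fibres≤; fibres?; touch-count)

    Open : State → Fin K → Fin K → Set
    Open F i j = ¬ Blocked G (ρ v) (γ i) (γ j) × ¬ Blocked F (π v) (g i) (g j)

    open? : ∀ F i j → Dec (Open F i j)
    open? F i j = ¬? (blocked? G (ρ v) (γ i) (γ j)) ×-dec ¬? (blocked? F (π v) (g i) (g j))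

    open-pairs : State → ℕ
    open-pairs F = ∑[ i ← idx ] ∑[ j ← idx ] 𝟙 (open? F i j)

    KeptPair : State → Fin K → Fin K → Set
    KeptPair F i j = Colour.Kept π ρ F G v (lookup x i) (lookup x j)

    -- Having many open pairs is part of the event, which makes it rare for every `G` and without
    -- any assumption on `F`. `escape` shows that, for good states, losing all pairs does amount to
    -- such a failure.
    Failure : State → Set
    Failure F = Fibres≤ 1 × 3 * (q * μ) ≤ open-pairs F × (∀ i j → ¬ KeptPair F i j)

    failure? : ∀ F → Dec (Failure F)
    failure? F = fibres? 1 ×-dec (3 * (q * μ) ≤? open-pairs F)
      ×-dec Fin.all? (λ i → Fin.all? (λ j → ¬? (Colour.kept? π ρ F G v (lookup x i) (lookup x j))))

    event : State → ℕ
    event F = 𝟙 (failure? F)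

    private
      place : Fin K → Fin K → Fin Triples
      place i j = code (π v) (g i) (g j)

      Active : Fin Triples → State → Set
      Active c F = ∃[ i ] ∃[ j ] (place i j ≡ c × Open F i j)

      active? : ∀ c F → Dec (Active c F)
      active? c F = Fin.any? (λ i → Fin.any? (λ j → (place i j Fin.≟ c) ×-dec open? F i j))

      act : Fin Triples → State → ℕ
      act c F = 𝟙 (active? c F)

      antitone : ∀ c {ω F} → ω ⊑ F → act c F ≤ act c ω
      antitone c {ω} {F} s = 𝟙-mono (active? c F) (active? c ω) λ where
        (i , j , e , p , r) → i , j , e , p , r ∘ blocked-mono {ω} {F} s

      -- Openness at the history `F ↾ c`, together with `c` being chosen, makes the pair `KeptPair`.
      -- This is why an edge is tested only against earlier triples of its own colour.
      avoids : ∀ F c → 1 ≤ event F → lookup F c ≡ true → act c (F ↾ c) ≡ 0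
      avoids F c failure b = 𝟙-no (active? c (F ↾ c)) λ where
        (i , j , refl , p , r) → proj₂ (proj₂ (1≤𝟙⇒ (failure? F) failure)) i j
          ( ( r ∘ inj₁ ∘ inj₁ , r ∘ inj₁ ∘ inj₂ ∘ inj₂ , r ∘ inj₁ ∘ inj₂ ∘ inj₁ , b)
          , r ∘ inj₂ , p ∘ inj₂ )

      open ≤-Reasoning

      -- At most three leaves lie in clusters of `c`; once `g i` is fixed, the code determines
      -- `g j`, and the leaves are separated.
      multiplicity : Fibres≤ 1 → ∀ F c → ∑[ i ← idx ] ∑[ j ← idx ] 𝟙 (place i j Fin.≟ c) * 𝟙 (open? F i j) ≤ 3 * act c F
      multiplicity fib F c = by (active? c F)
        where
        row : ∀ i (d : Dec (Touches c (g i))) → ∑[ j ← idx ] 𝟙 (place i j Fin.≟ c) ≤ 𝟙 d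
        row i (yes _) = ≤-trans (fibre-sum g fib (λ y → 𝟙 (code (π v) (g i) y Fin.≟ c)))
          (≤-trans (≤-reflexive (*-identityˡ _)) (code-unique (π v) (g i) c))
        row i (no ¬t) = ≤-trans (∑-mono idx (λ j → 𝟙-≤ (place i j Fin.≟ c) {0}
          (λ e → ⊥-elim (¬t (π v , g j , trans (code-sym₁₂ (g i) (π v) (g j)) e))))) (≤-reflexive (∑-zero idx))
        by : (d : Dec (Active c F)) → ∑[ i ← idx ] ∑[ j ← idx ] 𝟙 (place i j Fin.≟ c) * 𝟙 (open? F i j) ≤ 3 * 𝟙 d
        by (no ¬a) = ≤-trans (∑-mono idx (λ i → ∑-mono idx (λ j → 𝟙-*-≤ (place i j Fin.≟ c) (open? F i j) {0} (λ e o → ⊥-elim (¬a (i , j , e , o))))))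
          (≤-reflexive (trans (∑-cong idx (λ _ → ∑-zero idx)) (∑-zero idx)))
        by (yes _) = begin
          ∑[ i ← idx ] ∑[ j ← idx ] 𝟙 (place i j Fin.≟ c) * 𝟙 (open? F i j)
            ≤⟨ ∑-mono idx (λ i → ∑-mono idx (λ j → ≤-trans (*-monoʳ (𝟙 (place i j Fin.≟ c)) (𝟙≤1 (open? F i j))) (≤-reflexive (*-identityʳ _)))) ⟩
          ∑[ i ← idx ] ∑[ j ← idx ] 𝟙 (place i j Fin.≟ c)   ≤⟨ ∑-mono idx (λ i → row i (touches? c (g i))) ⟩
          ∑[ i ← idx ] 𝟙 (touches? c (g i))                 ≤⟨ touch-count fib c ⟩
          3 * 1                                             ∎

      many-active : ∀ F → 1 ≤ event F → q * μ ≤ ∑ (allFin Triples) (λ c → act c F)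
      many-active F failure = *-cancelˡ-≤ 3 (begin
        3 * (q * μ)   ≤⟨ proj₁ (proj₂ fails) ⟩
        open-pairs F  ≤⟨ ∑-mono idx (λ i → ∑-mono idx (λ j → locate i j)) ⟩
        ∑[ i ← idx ] ∑[ j ← idx ] ∑[ c ← cs ] 𝟙 (place i j Fin.≟ c) * 𝟙 (open? F i j)
          ≡⟨ trans (∑-cong idx (λ i → ∑-swap idx cs _)) (∑-swap idx cs _) ⟩
        ∑[ c ← cs ] ∑[ i ← idx ] ∑[ j ← idx ] 𝟙 (place i j Fin.≟ c) * 𝟙 (open? F i j)
          ≤⟨ ∑-mono cs (multiplicity (proj₁ fails) F) ⟩
        ∑[ c ← cs ] 3 * act c F ≡⟨ ∑-*ˡ cs 3 _ ⟩
        3 * (∑[ c ← cs ] act c F) ∎)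
        where
        cs = allFin Triples
        fails = 1≤𝟙⇒ (failure? F) failure
        locate : ∀ i j → 𝟙 (open? F i j) ≤ ∑[ c ← cs ] 𝟙 (place i j Fin.≟ c) * 𝟙 (open? F i j)
        locate i j = ≤-trans
          (≤-reflexive (sym (trans (cong (_* 𝟙 (open? F i j)) (𝟙-yes (place i j Fin.≟ place i j) refl)) (*-identityˡ _))))
          (∑-∈ (λ c → 𝟙 (place i j Fin.≟ c) * 𝟙 (open? F i j)) (∈-allFin (place i j)))

    rare : Probability≤2^- event μ
    rare = Survival.survival-bound act event (λ c {ω} {F} s → antitone c {ω} {F} s) (λ c F → 𝟙≤1 (active? c F))
      (λ F → 𝟙≤1 (failure? F)) avoids μ many-active

    -- Of `K * K` pairs each colour blocks at most an eighth. The open ones number at least (3/4)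
    -- K², which is at least 3 q μ.
    escape : ∀ {F} → Good F → Good G → Fibres≤ 1 → Family.Fibres≤ γ s → event F ≡ 0 → (∀ i j → ¬ KeptPair F i j) → ⊥
    escape {F} gF gG fib₁ fib₂ none lost = 𝟙≡0⇒ (failure? F) none (fib₁ , *-cancelˡ-≤ 8 (+-cancelʳ-≤ (2 * (K * K)) _ _ (begin
      8 * (3 * (q * μ)) + 2 * (K * K) ≡⟨ cong (_+ 2 * (K * K)) (e (q * μ)) ⟩
      6 * (4 * (q * μ)) + 2 * (K * K) ≤⟨ +-monoˡ-≤ (2 * (K * K)) (*-monoʳ 6 4qμ≤KK) ⟩
      6 * (K * K) + 2 * (K * K)       ≡⟨ e₁ (K * K) ⟩
      8 * (K * K)                     ≡⟨ cong (8 *_) square ⟨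
      8 * (∑[ i ← idx ] ∑[ j ← idx ] 1) ≤⟨ *-monoʳ 8 (∑-mono idx (λ i → ∑-mono idx (λ j → cover i j))) ⟩
      8 * (∑[ i ← idx ] ∑[ j ← idx ] (𝟙 (open? F i j) + (𝟙 (blocked? G (ρ v) (γ i) (γ j)) + 𝟙 (blocked? F (π v) (g i) (g j)))))
        ≡⟨ cong (8 *_) (trans (∑²-+ idx idx _ _) (cong (open-pairs F +_) (∑²-+ idx idx _ _))) ⟩
      8 * (open-pairs F + (bG + bF)) ≡⟨ e₂ (open-pairs F) bG bF ⟩
      8 * open-pairs F + (8 * bG + 8 * bF)
        ≤⟨ +-monoʳ-≤ (8 * open-pairs F) (+-mono-≤ (gG (ρ v) γ fib₂) (gF (π v) g (λ y → ≤-trans (fib₁ y) 1≤s))) ⟩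
      8 * open-pairs F + (K * K + K * K) ≡⟨ cong (λ z → 8 * open-pairs F + (K * K + z)) (+-identityʳ (K * K)) ⟨
      8 * open-pairs F + 2 * (K * K)     ∎)) , lost)
      where
      bG = blocked-pairs G (ρ v) γ
      bF = blocked-pairs F (π v) g
      square : ∑[ i ← idx ] ∑[ j ← idx ] 1 ≡ K * K
      square = trans (∑-const idx _) (cong₂ _*_ (length-allFin K) (trans (∑-const idx 1) (trans (*-identityʳ _) (length-allFin K))))
      cover : ∀ i j → 1 ≤ 𝟙 (open? F i j) + (𝟙 (blocked? G (ρ v) (γ i) (γ j)) + 𝟙 (blocked? F (π v) (g i) (g j)))
      cover i j = 𝟙-cover (blocked? G (ρ v) (γ i) (γ j)) (blocked? F (π v) (g i) (g j))
      e : ∀ x → 8 * (3 * x) ≡ 6 * (4 * x)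
      e = solve-∀
      e₁ : ∀ x → 6 * x + 2 * x ≡ 8 * x
      e₁ = solve-∀
      e₂ : ∀ x y z → 8 * (x + (y + z)) ≡ 8 * x + (8 * y + 8 * z)
      e₂ = solve-∀

  module _ (πr πb : Fin N → V) where

    private
      stars : List (Fin N × Vec (Fin N) K)
      stars = cartesianProduct (allFin N) (vectors K (allFin N))

      length-stars : length stars ≡ N * N ^ K
      length-stars = trans (length-product _,_ (allFin N) (vectors K (allFin N)))
        (cong₂ _*_ (length-allFin N) (trans (length-vectors K (allFin N)) (cong (_^ K) (length-allFin N))))

      fails : (Fin N → V) → (Fin N → V) → State → State → ℕ
      fails π ρ G F = ∑[ vx ← stars ] Star.event π ρ G (proj₁ vx) (proj₂ vx) F

      no-failure : ∀ π ρ G F v x → fails π ρ G F ≡ 0 → Star.event π ρ G v x F ≡ 0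
      no-failure π ρ G F v x none = ∑≡0⇒ {xs = stars} (λ vx → Star.event π ρ G (proj₁ vx) (proj₂ vx) F) none {v , x}
        (∈-cartesianProduct⁺ (∈-allFin v) (∈-vectors ∈-allFin x))

      fails-rare : ∀ π ρ G → ∑ Ω (fails π ρ G) * 8 ≤ length Ω
      fails-rare π ρ G = subst (∑ Ω (fails π ρ G) * 8 ≤_) (sym length-Ω)
        (union-bound stars (λ vx → Star.event π ρ G (proj₁ vx) (proj₂ vx)) μ 8 (λ vx → Star.rare π ρ G (proj₁ vx) (proj₂ vx))
          (subst (λ z → z * 8 ≤ 2 ^ μ) (sym length-stars) survival-union))

      cost : State → State → ℕ
      cost R B = (bad R + bad B) + (fails πr πb B R + fails πb πr R B)

      Q : ℕ
      Q = length Ω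

      instance
        Q≢0 : NonZero Q
        Q≢0 = subst NonZero (sym length-Ω) (m^n≢0 q Triples)

      bad-rare′ : ∑ Ω bad * 4 ≤ Q
      bad-rare′ = subst (∑ Ω bad * 4 ≤_) (sym length-Ω) bad-rare

      open ≤-Reasoning

      -- The expected cost is at most 2 · 1/4 + 2 · 1/8 = 3/4. Each kind of failure is averaged with
      -- the other colour's state outermost, where `fails-rare` holds uniformly.
      cheap : ∑[ R ← Ω ] ∑[ B ← Ω ] cost R B < ∑[ R ← Ω ] Q
      cheap = *-cancelʳ-< 8 _ _ (begin-strict
        (∑[ R ← Ω ] ∑[ B ← Ω ] cost R B) * 8
          ≡⟨ cong (_* 8) (trans (∑²-+ Ω Ω _ _) (cong₂ _+_ (∑²-+ Ω Ω _ _) (∑²-+ Ω Ω _ _))) ⟩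
        ((A + A′) + (C + C′)) * 8
          ≡⟨ e A A′ C C′ ⟩
        2 * (A * 4) + 2 * (A′ * 4) + (C * 8 + C′ * 8)
          ≤⟨ +-mono-≤ (+-mono-≤ (*-monoʳ 2 boundA) (*-monoʳ 2 boundA′)) (+-mono-≤ boundC boundC′) ⟩
        2 * (Q * Q) + 2 * (Q * Q) + (Q * Q + Q * Q)
          ≡⟨ e₁ (Q * Q) ⟩
        Q * Q * 6
          <⟨ *-monoʳ-< (Q * Q) {{m*n≢0 Q Q}} (s≤s (s≤s (s≤s (s≤s (s≤s (s≤s (s≤s z≤n))))))) ⟩
        Q * Q * 8
          ≡⟨ cong (_* 8) (∑-const Ω Q) ⟨
        (∑[ R ← Ω ] Q) * 8 ∎)
        where
        A = ∑[ R ← Ω ] ∑[ B ← Ω ] bad R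
        A′ = ∑[ R ← Ω ] ∑[ B ← Ω ] bad B
        C = ∑[ R ← Ω ] ∑[ B ← Ω ] fails πr πb B R
        C′ = ∑[ R ← Ω ] ∑[ B ← Ω ] fails πb πr R B
        average : ∀ c (f : State → State → ℕ) → (∀ R → ∑ Ω (f R) * c ≤ Q) → (∑[ R ← Ω ] ∑ Ω (f R)) * c ≤ Q * Q
        average c f le = ≤-trans (≤-reflexive (sym (∑-*ʳ Ω c (λ R → ∑ Ω (f R))))) (∑-bound Ω le)
        boundA′ : A′ * 4 ≤ Q * Q
        boundA′ = average 4 (λ _ B → bad B) (λ _ → bad-rare′)
        boundA : A * 4 ≤ Q * Q
        boundA = subst (λ z → z * 4 ≤ Q * Q) (∑-swap Ω Ω (λ _ R → bad R)) boundA′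
        boundC′ : C′ * 8 ≤ Q * Q
        boundC′ = average 8 (λ R B → fails πb πr R B) (λ R → fails-rare πb πr R)
        boundC : C * 8 ≤ Q * Q
        boundC = subst (λ z → z * 8 ≤ Q * Q) (∑-swap Ω Ω (λ B R → fails πr πb B R)) (average 8 (λ B R → fails πr πb B R) (λ B → fails-rare πr πb B))
        e : ∀ a b c d → ((a + b) + (c + d)) * 8 ≡ 2 * (a * 4) + 2 * (b * 4) + (c * 8 + d * 8)
        e = solve-∀
        e₁ : ∀ a → 2 * a + 2 * a + (a + a) ≡ a * 6
        e₁ = solve-∀

      cheap-pair : ∃[ R ] ∃[ B ] cost R B ≡ 0
      cheap-pair =
        let (R , _ , lt) = ∑-<⇒ Ω {λ R → ∑ Ω (cost R)} {λ _ → Q} cheap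
            (B , _ , lt′) = ∑-<⇒ Ω {cost R} {λ _ → 1} (<-≤-trans lt (≤-reflexive (sym (trans (∑-const Ω 1) (*-identityʳ Q)))))
        in R , B , n≤0⇒n≡0 (s≤s⁻¹ lt′)

    Spread : (Fin N → V) → Vec (Fin N) K → Set
    Spread π x = Family.Fibres≤ (λ i → π (lookup x i)) 1

    Small : (Fin N → V) → Vec (Fin N) K → Set
    Small π x = Family.Fibres≤ (λ i → π (lookup x i)) s

    StarsMeet : 3Graph (Fin N) → Set
    StarsMeet H = ∀ v x → Small πr x → Small πb x → Spread πr x ⊎ Spread πb x →
      ¬ (∀ i j → lookup x i ≢ lookup x j → ¬ E H v (lookup x i) (lookup x j))

    private
      module Cheap (R B : State) (zero-cost : cost R B ≡ 0) where

        open Hypergraph πr πb R B public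

        bads≡0 : bad R + bad B ≡ 0
        bads≡0 = m+n≡0⇒m≡0 (bad R + bad B) zero-cost

        fails≡0 : fails πr πb B R + fails πb πr R B ≡ 0
        fails≡0 = m+n≡0⇒n≡0 (bad R + bad B) zero-cost

        gR : Good R
        gR = good R (m+n≡0⇒m≡0 (bad R) bads≡0)

        gB : Good B
        gB = good B (m+n≡0⇒n≡0 (bad R) bads≡0)

        stars-meet : StarsMeet H
        stars-meet v x small-r small-b (inj₁ spread) lost =
          Star.escape πr πb B v x {R} gR gB spread small-b (no-failure πr πb B R v x (m+n≡0⇒m≡0 (fails πr πb B R) fails≡0)) (λ i j k → lost i j (proj₁ (proj₂ (proj₁ k)) ∘ cong πr) (inj₁ k))
        stars-meet v x small-r small-b (inj₂ spread) lost =
          Star.escape πb πr R v x {B} gB gR spread small-r (no-failure πb πr R B v x (m+n≡0⇒n≡0 (fails πr πb B R) fails≡0)) (λ i j k → lost i j (proj₁ (proj₂ (proj₁ k)) ∘ cong πb) (inj₂ k))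

    hypergraph : Σ[ H ∈ 3Graph (Fin N) ] K₄⁻-free H × StarsMeet H
    hypergraph = let (R , B , zero-cost) = cheap-pair in Cheap.H R B zero-cost , Cheap.free R B zero-cost , Cheap.stars-meet R B zero-cost

-- Random partitions

∑-map : ∀ {A B : Set} (f : A → B) xs (h : B → ℕ) → ∑ (map f xs) h ≡ ∑[ x ← xs ] h (f x)
∑-map f []       h = refl
∑-map f (x ∷ xs) h = cong (h (f x) +_) (∑-map f xs h)

∑-product : ∀ {A B C : Set} (f : A → B → C) xs ys (h : C → ℕ) →
  ∑ (cartesianProductWith f xs ys) h ≡ ∑[ x ← xs ] ∑[ y ← ys ] h (f x y)
∑-product f []       ys h = refl
∑-product f (x ∷ xs) ys h = trans (∑-++ (map (f x) ys) _ h) (cong₂ _+_ (∑-map (f x) ys h) (∑-product f xs ys h))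

∑-allFin-suc : ∀ n (f : Fin (suc n) → ℕ) → ∑ (allFin (suc n)) f ≡ f zero + (∑[ i ← allFin n ] f (suc i))
∑-allFin-suc n f = cong (f zero +_) (trans (cong (λ l → ∑ l f) (sym (map-tabulate id suc))) (∑-map suc (allFin n) f))

∏ : ∀ n → (Fin n → ℕ) → ℕ
∏ zero    f = 1
∏ (suc n) f = f zero * ∏ n (f ∘ suc)

∏-mono : ∀ n {f g : Fin n → ℕ} → (∀ i → f i ≤ g i) → ∏ n f ≤ ∏ n g
∏-mono zero    p = ≤-refl
∏-mono (suc n) p = *-mono-≤ (p zero) (∏-mono n (p ∘ suc))

∏-cong : ∀ n {f g : Fin n → ℕ} → (∀ i → f i ≡ g i) → ∏ n f ≡ ∏ n g
∏-cong zero    p = refl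
∏-cong (suc n) p = cong₂ _*_ (p zero) (∏-cong n (p ∘ suc))

∏-* : ∀ n (f g : Fin n → ℕ) → ∏ n (λ i → f i * g i) ≡ ∏ n f * ∏ n g
∏-* zero    f g = refl
∏-* (suc n) f g = trans (cong (f zero * g zero *_) (∏-* n (f ∘ suc) (g ∘ suc))) (e (f zero) (g zero) _ _)
  where
  e : ∀ a b c d → a * b * (c * d) ≡ a * c * (b * d)
  e = solve-∀

∏-const : ∀ n c → ∏ n (λ _ → c) ≡ c ^ n
∏-const zero    c = refl
∏-const (suc n) c = cong (c *_) (∏-const n c)

^-∑ : ∀ n c (f : Fin n → ℕ) → c ^ ∑ (allFin n) f ≡ ∏ n (λ i → c ^ f i)
^-∑ zero    c f = refl
^-∑ (suc n) c f = trans (cong (c ^_) (∑-allFin-suc n f))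
  (trans (^-distribˡ-+-* c (f zero) _) (cong (c ^ f zero *_) (^-∑ n c (f ∘ suc))))

∑-∏ : ∀ {A : Set} n (xs : List A) (w : Fin n → A → ℕ) →
  ∑[ v ← vectors n xs ] ∏ n (λ i → w i (lookup v i)) ≡ ∏ n (λ i → ∑ xs (w i))
∑-∏ zero    xs w = refl
∑-∏ (suc n) xs w = begin
  ∑[ v ← vectors (suc n) xs ] ∏ (suc n) (λ i → w i (lookup v i))
    ≡⟨ ∑-product _∷_ xs (vectors n xs) _ ⟩
  ∑[ x ← xs ] ∑[ v ← vectors n xs ] w zero x * ∏ n (λ i → w (suc i) (lookup v i))
    ≡⟨ ∑-cong xs (λ x → ∑-*ˡ (vectors n xs) (w zero x) _) ⟩
  ∑[ x ← xs ] w zero x * (∑[ v ← vectors n xs ] ∏ n (λ i → w (suc i) (lookup v i)))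
    ≡⟨ ∑-*ʳ xs _ (w zero) ⟩
  ∑ xs (w zero) * (∑[ v ← vectors n xs ] ∏ n (λ i → w (suc i) (lookup v i)))
    ≡⟨ cong (∑ xs (w zero) *_) (∑-∏ n xs (w ∘ suc)) ⟩
  ∑ xs (w zero) * ∏ n (λ i → ∑ xs (w (suc i))) ∎
  where open ≡-Reasoning

^-pad : ∀ {a b M N} → N ≤ M → a ≤ b → b ^ N * a ^ (M ∸ N) ≤ b ^ M
^-pad {a} {b} {M} {N} N≤M a≤b = begin
  b ^ N * a ^ (M ∸ N)  ≤⟨ *-monoʳ (b ^ N) (^-monoˡ-≤ (M ∸ N) a≤b) ⟩
  b ^ N * b ^ (M ∸ N)  ≡⟨ ^-distribˡ-+-* b N (M ∸ N) ⟨
  b ^ (N + (M ∸ N))    ≡⟨ cong (b ^_) (m+[n∸m]≡n N≤M) ⟩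
  b ^ M                ∎
  where open ≤-Reasoning

-- From (1 + 1/(2r))^(2r) ≤ 4 by padding the exponent to `2 * r * z`. The even denominators explain
-- why clusters and cluster sizes are later written as doubles.
exponential≤4 : ∀ r .{{_ : NonZero r}} z n → n ≤ 2 * r * z → (2 * r + 1) ^ n ≤ 4 ^ z * (2 * r) ^ n
exponential≤4 r z n n≤ = *-cancelʳ-≤ _ _ ((2 * r) ^ (M ∸ n)) {{m^n≢0 (2 * r) (M ∸ n) {{m*n≢0 2 r}}}} (begin
  (2 * r + 1) ^ n * (2 * r) ^ (M ∸ n) ≤⟨ ^-pad n≤ (m≤m+n (2 * r) 1) ⟩
  (2 * r + 1) ^ M                    ≡⟨ cong ((2 * r + 1) ^_) (e r z) ⟩
  (2 * r + 1) ^ (r * (2 * z))        ≤⟨ ^-scale′ 2 r (2 * z) (half-exponential r) ⟩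
  2 ^ (2 * z) * (2 * r) ^ (r * (2 * z)) ≡⟨ cong₂ _*_ (sym (^-*-assoc 2 2 z)) (cong ((2 * r) ^_) (trans (sym (e r z)) (sym (m+[n∸m]≡n n≤)))) ⟩
  4 ^ z * (2 * r) ^ (n + (M ∸ n))    ≡⟨ cong (4 ^ z *_) (^-distribˡ-+-* (2 * r) n (M ∸ n)) ⟩
  4 ^ z * ((2 * r) ^ n * (2 * r) ^ (M ∸ n)) ≡⟨ *-assoc (4 ^ z) _ _ ⟨
  4 ^ z * (2 * r) ^ n * (2 * r) ^ (M ∸ n) ∎)
  where
  open ≤-Reasoning
  M = 2 * r * z
  e : ∀ r z → 2 * r * z ≡ r * (2 * z)
  e = solve-∀

module Moments (N m : ℕ) where

  private
    all = allFin m

  maps : List (Vec (Fin m) N)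
  maps = vectors N all

  count : (Fin N → Fin m → ℕ) → Vec (Fin m) N → ℕ
  count χ π = ∑[ x ← allFin N ] χ x (lookup π x)

  module _ (χ : Fin N → Fin m → ℕ) (χ≤1 : ∀ x a → χ x a ≤ 1) (b : ℕ) where

    open ≤-Reasoning

    -- Vertices are placed independently, so the exponential moment is a product. The last
    -- hypothesis bounds the factor at `x` by (1 + 1/(2r))^(e x), and these exponents add up.
    moment : ∀ r .{{_ : NonZero r}} z (e : Fin N → ℕ) → ∑ (allFin N) e ≤ 2 * r * z →
      (∀ x → (m + b * ∑ all (χ x)) * (2 * r) ^ e x ≤ (2 * r + 1) ^ e x * m) →
      ∑[ π ← maps ] suc b ^ count χ π ≤ 4 ^ z * m ^ N
    moment r z e ∑e≤ local = *-cancelʳ-≤ _ _ ((2 * r) ^ ε) {{m^n≢0 (2 * r) ε {{m*n≢0 2 r}}}} (begin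
      (∑[ π ← maps ] suc b ^ count χ π) * (2 * r) ^ ε
        ≡⟨ cong₂ _*_ (trans (∑-cong maps (λ π → ^-∑ N (suc b) _)) (∑-∏ N all (λ x a → suc b ^ χ x a))) (^-∑ N (2 * r) e) ⟩
      ∏ N (λ x → ∑[ a ← all ] suc b ^ χ x a) * ∏ N (λ x → (2 * r) ^ e x)
        ≡⟨ ∏-* N _ _ ⟨
      ∏ N (λ x → (∑[ a ← all ] suc b ^ χ x a) * (2 * r) ^ e x)
        ≤⟨ ∏-mono N (λ x → ≤-trans (*-monoˡ ((2 * r) ^ e x) (factor x)) (local x)) ⟩
      ∏ N (λ x → (2 * r + 1) ^ e x * m)
        ≡⟨ trans (∏-* N _ _) (cong₂ _*_ (sym (^-∑ N (2 * r + 1) e)) (∏-const N m)) ⟩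
      (2 * r + 1) ^ ε * m ^ N
        ≤⟨ *-monoˡ (m ^ N) (exponential≤4 r z ε ∑e≤) ⟩
      4 ^ z * (2 * r) ^ ε * m ^ N
        ≡⟨ rearrange (4 ^ z) ((2 * r) ^ ε) (m ^ N) ⟩
      4 ^ z * m ^ N * (2 * r) ^ ε ∎)
      where
      ε = ∑ (allFin N) e
      rearrange : ∀ a b c → a * b * c ≡ a * c * b
      rearrange = solve-∀
      linear : ∀ t → t ≤ 1 → suc b ^ t ≤ 1 + b * t
      linear zero          _ = m≤m+n 1 _
      linear (suc zero)    _ = ≤-reflexive (trans (*-identityʳ (suc b)) (cong suc (sym (*-identityʳ b))))
      linear (suc (suc _)) (s≤s ())
      factor : ∀ x → ∑[ a ← all ] suc b ^ χ x a ≤ m + b * ∑ all (χ x)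
      factor x = begin
        ∑[ a ← all ] suc b ^ χ x a      ≤⟨ ∑-mono all (λ a → linear (χ x a) (χ≤1 x a)) ⟩
        ∑[ a ← all ] (1 + b * χ x a)    ≡⟨ ∑-+ all _ _ ⟩
        (∑[ a ← all ] 1) + (∑[ a ← all ] b * χ x a)
          ≡⟨ cong₂ _+_ (trans (∑-const all 1) (trans (*-identityʳ _) (length-allFin m))) (∑-*ˡ all b (χ x)) ⟩
        m + b * ∑ all (χ x)             ∎

    markov : ∀ k → (∑[ π ← maps ] 𝟙 (k ≤? count χ π)) * suc b ^ k ≤ ∑[ π ← maps ] suc b ^ count χ π
    markov k = ≤-trans (≤-reflexive (sym (∑-*ʳ maps (suc b ^ k) (λ π → 𝟙 (k ≤? count χ π))))) (∑-mono maps one)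
      where
      one : ∀ π → 𝟙 (k ≤? count χ π) * suc b ^ k ≤ suc b ^ count χ π
      one π with k ≤? count χ π
      ... | yes p = ≤-trans (≤-reflexive (*-identityˡ _)) (^-monoʳ-≤ (suc b) p)
      ... | no  _ = z≤n

_∈ᵛ_ : ∀ {m K} → Fin m → Vec (Fin m) K → Set
a ∈ᵛ A = ∃[ i ] lookup A i ≡ a

_∈ᵛ?_ : ∀ {m K} (a : Fin m) (A : Vec (Fin m) K) → Dec (a ∈ᵛ A)
a ∈ᵛ? A = Fin.any? (λ i → lookup A i Fin.≟ a)

∑-∈ᵛ : ∀ {m K} (A : Vec (Fin m) K) → ∑[ a ← allFin m ] 𝟙 (a ∈ᵛ? A) ≤ K
∑-∈ᵛ {m} {K} A = begin
  ∑[ a ← allFin m ] 𝟙 (a ∈ᵛ? A)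
    ≤⟨ ∑-mono (allFin m) (λ a → 𝟙-≤ (a ∈ᵛ? A) λ where
         (i , e) → ≤-trans (≤-reflexive (sym (𝟙-yes (lookup A i Fin.≟ a) e))) (∑-∈ (λ i → 𝟙 (lookup A i Fin.≟ a)) (∈-allFin i))) ⟩
  ∑[ a ← allFin m ] ∑[ i ← allFin K ] 𝟙 (lookup A i Fin.≟ a) ≡⟨ ∑-swap (allFin m) (allFin K) _ ⟩
  ∑[ i ← allFin K ] ∑[ a ← allFin m ] 𝟙 (lookup A i Fin.≟ a)
    ≤⟨ ∑-bound (allFin K) (λ i → ∑-𝟙-≤1 (lookup A i Fin.≟_) (allFin⁺ m) (λ p r → trans (sym p) r)) ⟩
  length (allFin K) * 1 ≡⟨ trans (*-identityʳ _) (length-allFin K) ⟩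
  K ∎
  where open ≤-Reasoning

module Partitions (N m′ σ b K k : ℕ) {{_ : NonZero m′}} {{_ : NonZero σ}}
  (N≤ : N ≤ 2 * m′ * (2 * σ))
  (bKσ≤m : b * K * (2 * σ) ≤ 2 * m′)
  (fibre-union : 2 * m′ * 4 ^ (2 * σ) * 4 ≤ 2 ^ (3 * (2 * σ)))
  (spread-union : (2 * m′) ^ K * (2 * m′) ^ K * 4 ^ K * 4 ≤ suc b ^ k) where

  m s₀ : ℕ
  m = 2 * m′
  s₀ = 2 * σ

  private
    V = Fin m
    all = allFin m
    pairs = cartesianProduct (vectors K all) (vectors K all)

  open Moments N m

  πr : Fin N → V
  πr x = quotient s₀ (inject≤ x N≤)

  πr-fibres : ∀ a → ∑[ x ← allFin N ] 𝟙 (πr x Fin.≟ a) ≤ s₀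
  πr-fibres a = begin
    ∑[ x ← allFin N ] 𝟙 (πr x Fin.≟ a)
      ≤⟨ ∑-mono (allFin N) (λ x → 𝟙-≤ (πr x Fin.≟ a) λ e →
           ≤-trans (≤-reflexive (sym (𝟙-yes (both? x (rem x)) (e , refl)))) (∑-∈ (λ r → 𝟙 (both? x r)) (∈-allFin (rem x)))) ⟩
    ∑[ x ← allFin N ] ∑[ r ← allFin s₀ ] 𝟙 (both? x r) ≡⟨ ∑-swap (allFin N) (allFin s₀) _ ⟩
    ∑[ r ← allFin s₀ ] ∑[ x ← allFin N ] 𝟙 (both? x r)
      ≤⟨ ∑-bound (allFin s₀) (λ r → ∑-𝟙-≤1 (λ x → both? x r) (allFin⁺ N) (λ {x} {y} → injective {x} {y})) ⟩
    length (allFin s₀) * 1 ≡⟨ trans (*-identityʳ _) (length-allFin s₀) ⟩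
    s₀ ∎
    where
    open ≤-Reasoning
    rem : Fin N → Fin s₀
    rem x = remainder {m} s₀ (inject≤ x N≤)
    both? : ∀ x r → Dec (πr x ≡ a × rem x ≡ r)
    both? x r = (πr x Fin.≟ a) ×-dec (rem x Fin.≟ r)
    injective : ∀ {x y r} → πr x ≡ a × rem x ≡ r → πr y ≡ a × rem y ≡ r → x ≡ y
    injective {x} {y} (p , p′) (r , r′) = Fin.inject≤-injective N≤ N≤ x y
      (trans (sym (Fin.combine-remQuot {m} s₀ (inject≤ x N≤)))
      (trans (cong₂ Fin.combine (trans p (sym r)) (trans p′ (sym r′))) (Fin.combine-remQuot {m} s₀ (inject≤ y N≤))))

  private
    inFibre : V → Fin N → V → ℕ
    inFibre a _ c = 𝟙 (c Fin.≟ a)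

    inBoth : Vec V K × Vec V K → Fin N → V → ℕ
    inBoth (A , B) x c = 𝟙 (πr x ∈ᵛ? A) * 𝟙 (c ∈ᵛ? B)

    big-fibre trapped : Vec V N → ℕ
    big-fibre π = ∑[ a ← all ] 𝟙 (3 * s₀ ≤? count (inFibre a) π)
    trapped π = ∑[ AB ← pairs ] 𝟙 (k ≤? count (inBoth AB) π)

    open ≤-Reasoning

    -- At most `m * s₀` vertices fall into the fibre with probability 1/m each, so the mean of
    -- 2^count is at most 4^s₀. The threshold `3 * s₀` leaves 2^(-s₀) for the union bound.
    fibre-rare : ∀ a → (∑[ π ← maps ] 𝟙 (3 * s₀ ≤? count (inFibre a) π)) * 2 ^ (3 * s₀) ≤ 4 ^ s₀ * m ^ N
    fibre-rare a = ≤-trans (markov (inFibre a) χ≤1 1 (3 * s₀)) (moment (inFibre a) χ≤1 1 m′ s₀ (λ _ → 1)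
      (≤-trans (≤-reflexive (trans (∑-const (allFin N) 1) (trans (*-identityʳ _) (length-allFin N)))) N≤)
      λ x → begin
        (m + 1 * ∑ all (inFibre a x)) * (m * 1)  ≤⟨ *-monoˡ (m * 1) (+-monoʳ-≤ m (≤-trans (≤-reflexive (*-identityˡ _))
                                                    (∑-𝟙-≤1 (Fin._≟ a) (allFin⁺ m) (λ p r → trans p (sym r))))) ⟩
        (m + 1) * (m * 1)                        ≡⟨ e (m + 1) m ⟩
        (m + 1) ^ 1 * m                          ∎)
      where
      χ≤1 : ∀ x c → inFibre a x c ≤ 1
      χ≤1 x c = 𝟙≤1 (c Fin.≟ a)
      e : ∀ x m → x * (m * 1) ≡ x * 1 * m
      e = solve-∀

    -- Only the vertices in the red clusters of `A` matter, at most `K * s₀` of them. Each lands in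
    -- `B` with probability at most K/m, and `bKσ≤m` makes b K/m at most 1/s₀.
    trapped-rare : ∀ AB → (∑[ π ← maps ] 𝟙 (k ≤? count (inBoth AB) π)) * suc b ^ k ≤ 4 ^ K * m ^ N
    trapped-rare AB@(A , B) = ≤-trans (markov (inBoth AB) χ≤1 b k) (moment (inBoth AB) χ≤1 b σ K (λ x → 𝟙 (πr x ∈ᵛ? A))
      (≤-trans (fibre-sum πr πr-fibres (λ a → 𝟙 (a ∈ᵛ? A))) (*-monoʳ s₀ (∑-∈ᵛ A)))
      local)
      where
      χ≤1 : ∀ x c → inBoth AB x c ≤ 1
      χ≤1 x c = *-mono-≤ (𝟙≤1 (πr x ∈ᵛ? A)) (𝟙≤1 (c ∈ᵛ? B))
      local : ∀ x → (m + b * (∑[ c ← all ] inBoth AB x c)) * s₀ ^ 𝟙 (πr x ∈ᵛ? A) ≤ (s₀ + 1) ^ 𝟙 (πr x ∈ᵛ? A) * m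
      local x = subst (λ z → (m + b * z) * s₀ ^ 𝟙 (πr x ∈ᵛ? A) ≤ (s₀ + 1) ^ 𝟙 (πr x ∈ᵛ? A) * m)
        (sym (∑-*ˡ all (𝟙 (πr x ∈ᵛ? A)) (λ c → 𝟙 (c ∈ᵛ? B)))) (by (πr x ∈ᵛ? A))
        where
        e₀ : ∀ m b → (m + b * 0) * 1 ≡ 1 * m
        e₀ = solve-∀
        e₁ : ∀ m b K s → (m + b * (1 * K)) * (s * 1) ≡ m * s + b * K * s
        e₁ = solve-∀
        e₂ : ∀ m s → m * s + m ≡ (s + 1) * 1 * m
        e₂ = solve-∀
        by : (d : Dec (πr x ∈ᵛ A)) → (m + b * (𝟙 d * (∑[ c ← all ] 𝟙 (c ∈ᵛ? B)))) * s₀ ^ 𝟙 d ≤ (s₀ + 1) ^ 𝟙 d * m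
        by (no  _) = ≤-reflexive (e₀ m b)
        by (yes _) = begin
          (m + b * (1 * (∑[ c ← all ] 𝟙 (c ∈ᵛ? B)))) * (s₀ * 1)
            ≤⟨ *-monoˡ (s₀ * 1) (+-monoʳ-≤ m (*-monoʳ b (*-monoʳ 1 (∑-∈ᵛ B)))) ⟩
          (m + b * (1 * K)) * (s₀ * 1)  ≡⟨ e₁ m b K s₀ ⟩
          m * s₀ + b * K * s₀           ≤⟨ +-monoʳ-≤ (m * s₀) bKσ≤m ⟩
          m * s₀ + m                    ≡⟨ e₂ m s₀ ⟩
          (s₀ + 1) * 1 * m              ∎

    union : ∀ {I : Set} (is : List I) (event : I → Vec V N → ℕ) c L →
      (∀ i → (∑[ π ← maps ] event i π) * c ≤ L * m ^ N) → length is * L * 4 ≤ c → NonZero c →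
      (∑[ π ← maps ] ∑[ i ← is ] event i π) * 4 ≤ m ^ N
    union is event c L rare few c≢0 = *-cancelʳ-≤ _ _ c {{c≢0}} (begin
      (∑[ π ← maps ] ∑[ i ← is ] event i π) * 4 * c ≡⟨ cong (λ z → z * 4 * c) (∑-swap maps is _) ⟩
      (∑[ i ← is ] ∑[ π ← maps ] event i π) * 4 * c ≡⟨ e₁ (∑[ i ← is ] ∑[ π ← maps ] event i π) c ⟩
      (∑[ i ← is ] ∑[ π ← maps ] event i π) * c * 4 ≡⟨ cong (_* 4) (∑-*ʳ is c _) ⟨
      (∑[ i ← is ] (∑[ π ← maps ] event i π) * c) * 4 ≤⟨ *-monoˡ 4 (∑-bound is rare) ⟩
      length is * (L * m ^ N) * 4                   ≡⟨ e₂ (length is) L (m ^ N) ⟩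
      m ^ N * (length is * L * 4)                   ≤⟨ *-monoʳ (m ^ N) few ⟩
      m ^ N * c                                     ∎)
      where
      e₁ : ∀ a c → a * 4 * c ≡ a * c * 4
      e₁ = solve-∀
      e₂ : ∀ a b c → a * (b * c) * 4 ≡ c * (a * b * 4)
      e₂ = solve-∀

    length-maps : length maps ≡ m ^ N
    length-maps = trans (length-vectors N all) (cong (_^ N) (length-allFin m))

    length-pairs : length pairs ≡ m ^ K * m ^ K
    length-pairs = trans (length-product _,_ (vectors K all) (vectors K all))
      (cong (λ z → z * z) (trans (length-vectors K all) (cong (_^ K) (length-allFin m))))

    few-bad : ∑[ π ← maps ] (big-fibre π + trapped π) < ∑[ π ← maps ] 1
    few-bad = *-cancelʳ-< 4 _ _ (begin-strict
      (∑[ π ← maps ] (big-fibre π + trapped π)) * 4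
        ≡⟨ trans (cong (_* 4) (∑-+ maps _ _)) (*-distribʳ-+ 4 (∑ maps big-fibre) (∑ maps trapped)) ⟩
      ∑ maps big-fibre * 4 + ∑ maps trapped * 4
        ≤⟨ +-mono-≤
          (union all (λ a π → 𝟙 (3 * s₀ ≤? count (inFibre a) π)) (2 ^ (3 * s₀)) (4 ^ s₀) fibre-rare
            (subst (λ z → z * 4 ^ s₀ * 4 ≤ 2 ^ (3 * s₀)) (sym (length-allFin m)) fibre-union) (m^n≢0 2 (3 * s₀)))
          (union pairs (λ AB π → 𝟙 (k ≤? count (inBoth AB) π)) (suc b ^ k) (4 ^ K) trapped-rare
            (subst (λ z → z * 4 ^ K * 4 ≤ suc b ^ k) (sym length-pairs) spread-union) (m^n≢0 (suc b) k)) ⟩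
      m ^ N + m ^ N     ≡⟨ e (m ^ N) ⟩
      m ^ N * 2         <⟨ *-monoʳ-< (m ^ N) {{m^n≢0 m N {{m*n≢0 2 m′}}}} (s≤s (s≤s (s≤s z≤n))) ⟩
      m ^ N * 4         ≡⟨ cong (_* 4) (trans (trans (∑-const maps 1) (*-identityʳ _)) length-maps) ⟨
      (∑[ π ← maps ] 1) * 4 ∎)
      where
      e : ∀ x → x + x ≡ x * 2
      e = solve-∀

    chosen : ∃[ π ] π ∈ maps × big-fibre π + trapped π < 1
    chosen = ∑-<⇒ maps {λ π → big-fibre π + trapped π} {λ _ → 1} few-bad

    bad≡0 : big-fibre (proj₁ chosen) + trapped (proj₁ chosen) ≡ 0
    bad≡0 = n≤0⇒n≡0 (s≤s⁻¹ (proj₂ (proj₂ chosen)))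

  πb : Fin N → V
  πb = lookup (proj₁ chosen)

  πb-fibres : ∀ a → ∑[ x ← allFin N ] 𝟙 (πb x Fin.≟ a) ≤ 3 * s₀
  πb-fibres a = <⇒≤ (≰⇒> (𝟙≡0⇒ (3 * s₀ ≤? count (inFibre a) (proj₁ chosen))
    (∑≡0⇒ {xs = all} (λ a → 𝟙 (3 * s₀ ≤? count (inFibre a) (proj₁ chosen))) (m+n≡0⇒m≡0 (big-fibre (proj₁ chosen)) bad≡0) {a} (∈-allFin a))))

  untrapped : ∀ (A B : Vec V K) → ∑[ x ← allFin N ] 𝟙 (πr x ∈ᵛ? A) * 𝟙 (πb x ∈ᵛ? B) < k
  untrapped A B = ≰⇒> (𝟙≡0⇒ (k ≤? count (inBoth (A , B)) (proj₁ chosen))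
    (∑≡0⇒ {xs = pairs} (λ AB → 𝟙 (k ≤? count (inBoth AB) (proj₁ chosen))) (m+n≡0⇒n≡0 (big-fibre (proj₁ chosen)) bad≡0) {A , B}
      (∈-cartesianProduct⁺ (∈-vectors ∈-allFin A) (∈-vectors ∈-allFin B))))

-- Large stars

Separated : ∀ {k m K} → (Fin k → Fin m) → Vec (Fin k) K → Set
Separated g ι = ∀ i j → g (lookup ι i) ≡ g (lookup ι j) → i ≡ j

-- Greedy choice: as long as some value is new it is added; otherwise the values found so far cover
-- everything. Padding with `v₀` gives the cover the exact length that the union bound enumerates.
select : ∀ {k m} (g : Fin k → Fin m) → Fin m → ∀ K →
  (∃ λ (ι : Vec (Fin k) K) → Separated g ι) ⊎ (∃ λ (A : Vec (Fin m) K) → ∀ i → g i ∈ᵛ A)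
select g v₀ zero    = inj₁ ([] , λ ())
select g v₀ (suc K) with select g v₀ K
... | inj₂ (A , covers) = inj₂ (v₀ ∷ A , λ i → suc (proj₁ (covers i)) , proj₂ (covers i))
... | inj₁ (ι , sep) with Fin.any? (λ i → ¬? (g i ∈ᵛ? Vec.map g ι))
...   | yes (i , fresh) = inj₁ (i ∷ ι , separated)
  where
  separated : Separated g (i ∷ ι)
  separated zero    zero    e = refl
  separated zero    (suc j) e = ⊥-elim (fresh (j , trans (lookup-map j g ι) (sym e)))
  separated (suc j) zero    e = ⊥-elim (fresh (j , trans (lookup-map j g ι) e))
  separated (suc j) (suc l) e = cong suc (sep j l e)
...   | no none = inj₂ (v₀ ∷ Vec.map g ι , λ i → extend (covered i))
  where
  covered : ∀ i → g i ∈ᵛ Vec.map g ι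
  covered i with g i ∈ᵛ? Vec.map g ι
  ... | yes p = p
  ... | no ¬p = ⊥-elim (none (i , ¬p))
  extend : ∀ {a} → a ∈ᵛ Vec.map g ι → a ∈ᵛ (v₀ ∷ Vec.map g ι)
  extend (j , e) = suc j , e

injective-fibres : ∀ {n m} (g : Fin n → Fin m) → (∀ i j → g i ≡ g j → i ≡ j) →
  ∀ a → ∑[ i ← allFin n ] 𝟙 (g i Fin.≟ a) ≤ 1
injective-fibres {n} g inj a = ∑-𝟙-≤1 (λ i → g i Fin.≟ a) (allFin⁺ n) (λ {i} {j} p r → inj i j (trans p (sym r)))

module Assembly (P : Parameters) where

  open Parameters P
  open Existence P

  module _ (πr πb : Fin N → Fin m) (k : ℕ)
    (small-r : ∀ a → ∑[ x ← allFin N ] 𝟙 (πr x Fin.≟ a) ≤ s)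
    (small-b : ∀ a → ∑[ x ← allFin N ] 𝟙 (πb x Fin.≟ a) ≤ s)
    (untrapped : ∀ (A B : Vec (Fin m) K) → ∑[ x ← allFin N ] 𝟙 (πr x ∈ᵛ? A) * 𝟙 (πb x ∈ᵛ? B) < k) where

    open ≤-Reasoning

    -- If both colours fail, all `k` leaves lie in `K` red and `K` blue clusters at once, against
    -- `untrapped`.
    spread : (y : Fin k → Fin N) → (∀ i j → y i ≡ y j → i ≡ j) → Fin N →
      ∃ λ (ι : Vec (Fin k) K) → Separated (πr ∘ y) ι ⊎ Separated (πb ∘ y) ι
    spread y inj v with select (πr ∘ y) (πr v) K | select (πb ∘ y) (πb v) K
    ... | inj₁ (ι , sep) | _ = ι , inj₁ sep
    ... | inj₂ _ | inj₁ (ι , sep) = ι , inj₂ sep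
    ... | inj₂ (A , cA) | inj₂ (B , cB) = ⊥-elim (<-irrefl refl (begin-strict
      k                                  ≡⟨ trans (trans (∑-const (allFin k) 1) (*-identityʳ _)) (length-allFin k) ⟨
      ∑[ i ← allFin k ] 1                ≤⟨ ∑-mono (allFin k) (λ i → ≤-reflexive (sym (cong₂ _*_ (𝟙-yes (_ ∈ᵛ? A) (cA i)) (𝟙-yes (_ ∈ᵛ? B) (cB i))))) ⟩
      ∑[ i ← allFin k ] χ (y i)          ≤⟨ fibre-sum y (injective-fibres y inj) χ ⟩
      1 * ∑ (allFin N) χ                 ≡⟨ *-identityˡ _ ⟩
      ∑ (allFin N) χ                     <⟨ untrapped A B ⟩
      k                                  ∎))
      where
      χ : Fin N → ℕ
      χ x = 𝟙 (πr x ∈ᵛ? A) * 𝟙 (πb x ∈ᵛ? B)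

    NoStars : 3Graph (Fin N) → Set
    NoStars H = ∀ n → k < n → ¬ (Star n ⊆ complement H)

    no-stars : ∀ H → StarsMeet πr πb H → NoStars H
    no-stars H meet (suc n) (s≤s k≤n) (f , f-inj , missing) = contradictory (spread y y-inj v)
      where
      v = f zero
      leaf : Fin k → Fin (suc n)
      leaf i = suc (inject≤ i k≤n)
      y : Fin k → Fin N
      y = f ∘ leaf
      leaf-inj : ∀ i j → leaf i ≡ leaf j → i ≡ j
      leaf-inj i j e = Fin.inject≤-injective k≤n k≤n i j (Fin.suc-injective e)
      y-inj : ∀ i j → y i ≡ y j → i ≡ j
      y-inj i j e = leaf-inj i j (f-inj e)
      contradictory : (∃ λ (ι : Vec (Fin k) K) → Separated (πr ∘ y) ι ⊎ Separated (πb ∘ y) ι) → ⊥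
      contradictory (ι , sep) = meet v x (small πr small-r) (small πb small-b) (spreads sep) lost
        where
        x = Vec.map y ι
        eq : ∀ i → lookup x i ≡ y (lookup ι i)
        eq i = lookup-map i y ι
        transport : ∀ (π : Fin N → Fin m) → Separated (π ∘ y) ι → ∀ i j → π (lookup x i) ≡ π (lookup x j) → i ≡ j
        transport π sep i j e = sep i j (trans (cong π (sym (eq i))) (trans e (cong π (eq j))))
        x-inj : ∀ i j → lookup x i ≡ lookup x j → i ≡ j
        x-inj i j e = by sep
          where
          by : Separated (πr ∘ y) ι ⊎ Separated (πb ∘ y) ι → i ≡ j
          by (inj₁ sep-r) = transport πr sep-r i j (cong πr e)
          by (inj₂ sep-b) = transport πb sep-b i j (cong πb e)
        small : ∀ π → (∀ a → ∑[ x ← allFin N ] 𝟙 (π x Fin.≟ a) ≤ s) → Small πr πb π x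
        small π bound a = ≤-trans (fibre-sum (lookup x) (injective-fibres (lookup x) x-inj) (λ y → 𝟙 (π y Fin.≟ a)))
          (≤-trans (≤-reflexive (*-identityˡ _)) (bound a))
        spreads : Separated (πr ∘ y) ι ⊎ Separated (πb ∘ y) ι → Spread πr πb πr x ⊎ Spread πr πb πb x
        spreads (inj₁ sep-r) = inj₁ (injective-fibres (πr ∘ lookup x) (transport πr sep-r))
        spreads (inj₂ sep-b) = inj₂ (injective-fibres (πb ∘ lookup x) (transport πb sep-b))
        lost : ∀ i j → lookup x i ≢ lookup x j → ¬ E H v (lookup x i) (lookup x j)
        lost i j x≢ edge = missing zero (leaf (lookup ι i)) (leaf (lookup ι j))
          ((λ ()) , (λ e → x≢ (trans (eq i) (trans (cong f e) (sym (eq j))))) , (λ ())) (inj₁ refl)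
          (subst₂ (E H v) (eq i) (eq j) edge)

    star-free : Σ[ H ∈ 3Graph (Fin N) ] K₄⁻-free H × NoStars H
    star-free = let (H , free , meet) = hypergraph πr πb in H , free , no-stars H meet

-- Choice of parameters

n≤2^n : ∀ n → n ≤ 2 ^ n
n≤2^n zero    = z≤n
n≤2^n (suc n) = +-mono-≤ (m^n>0 2 n) (≤-trans (n≤2^n n) (m≤m+n (2 ^ n) 0))

-- The constants and exponents are kept abstract so that unary arithmetic never unfolds them.
module Numbers (a i L M κ₀ ν : ℕ) (a≡64 : a ≡ 64) (L≡ : L ≡ 2 ^ 40) (M≡ : suc M ≡ 12 + 64 * i)
  (κ₀≡ : κ₀ ≡ 40 + 192 * i) (ν≡ : ν ≡ 21 + 65 * i) (7≤i : 7 ≤ i) where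

  open ≤-Reasoning

  at-64 : (P : ℕ → Set) → P 64 → P a
  at-64 P p = subst P (sym a≡64) p

  1≤i : 1 ≤ i
  1≤i = ≤-trans (s≤s z≤n) 7≤i

  -- `v` is the fourth root of `d` and dominates all logarithmic factors. By `m≡`, q is a√m, so two
  -- clusters have about m/q² = 1/a² expected common neighbours in a link: enlarging `a` makes
  -- closed pairs rare. `σ` is of order log m, and the factor 3 in `s` allows for the random fibres.
  v h d σ s K m′ m q : ℕ
  v = 2 ^ (8 * i)
  h = v * v * v
  d = h * v
  σ = 4 * a * i
  s = 3 * (2 * σ)
  K = 16 * a * s * d
  m′ = 2 ^ M
  m = 2 * m′
  q = a * a * d

  pow-* : ∀ x y → 2 ^ x * 2 ^ y ≡ 2 ^ (x + y)
  pow-* x y = sym (^-distribˡ-+-* 2 x y)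

  d-power : d ≡ 2 ^ (32 * i)
  d-power = trans (cong (_* v) (trans (cong (_* v) (pow-* (8 * i) (8 * i))) (pow-* (8 * i + 8 * i) (8 * i))))
    (trans (pow-* (8 * i + 8 * i + 8 * i) (8 * i)) (cong (2 ^_) (e i)))
    where
    e : ∀ i → 8 * i + 8 * i + 8 * i + 8 * i ≡ 32 * i
    e = solve-∀

  m≡ : m ≡ a * a * (d * d)
  m≡ = sym (trans (cong₂ _*_ a-power (trans (cong₂ _*_ d-power d-power) (pow-* (32 * i) (32 * i))))
    (trans (pow-* 12 (32 * i + 32 * i)) (cong (2 ^_) (trans (e i) (sym M≡)))))
    where
    e : ∀ i → 12 + (32 * i + 32 * i) ≡ 12 + 64 * i
    e = solve-∀
    a-power : a * a ≡ 2 ^ 12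
    a-power = trans (cong (λ a → a * a) a≡64) refl

  L≤ : L ≤ 2 ^ (6 * i)
  L≤ = ≤-trans (≤-reflexive L≡) (^-monoʳ-≤ 2 (≤-trans (≤ᵇ⇒≤ 40 42 tt) (*-monoʳ 6 7≤i)))

  -- Logarithmic factors are reduced to a constant times `i * i`, so one comparison with `v` serves
  -- many estimates. The condition `7≤i` comes from 40 ≤ 6 · 7.
  quadratic : L * (i * i) ≤ v
  quadratic = begin
    L * (i * i)                  ≤⟨ *-mono-≤ L≤ (*-mono-≤ (n≤2^n i) (n≤2^n i)) ⟩
    2 ^ (6 * i) * (2 ^ i * 2 ^ i) ≡⟨ cong (2 ^ (6 * i) *_) (pow-* i i) ⟩
    2 ^ (6 * i) * 2 ^ (i + i)     ≡⟨ pow-* (6 * i) (i + i) ⟩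
    2 ^ (6 * i + (i + i))         ≡⟨ cong (2 ^_) (e i) ⟩
    v                             ∎
    where
    e : ∀ i → 6 * i + (i + i) ≡ 8 * i
    e = solve-∀

  ≤L : ∀ {c} → c ≤ 2 ^ 40 → c ≤ L
  ≤L le = ≤-trans le (≤-reflexive (sym L≡))

  below : ∀ c → c ≤ L → c * (i * i) ≤ v
  below c c≤ = ≤-trans (*-monoˡ (i * i) c≤) quadratic

  affine : ∀ c c′ → c + c′ * i ≤ (c + c′) * i
  affine c c′ = begin
    c + c′ * i     ≡⟨ cong (_+ c′ * i) (*-identityʳ c) ⟨
    c * 1 + c′ * i ≤⟨ +-monoˡ-≤ (c′ * i) (*-monoʳ c 1≤i) ⟩
    c * i + c′ * i ≡⟨ *-distribʳ-+ i c c′ ⟨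
    (c + c′) * i   ∎

  i≤ii : i ≤ i * i
  i≤ii = ≤-trans (≤-reflexive (sym (*-identityʳ i))) (*-monoʳ i 1≤i)

  s≡ : s ≡ 24 * a * i
  s≡ = e a i
    where
    e : ∀ a i → 3 * (2 * (4 * a * i)) ≡ 24 * a * i
    e = solve-∀

  1≤v : 1 ≤ v
  1≤v = m^n>0 2 (8 * i)

  1≤h : 1 ≤ h
  1≤h = *-mono-≤ (*-mono-≤ 1≤v 1≤v) 1≤v

  1≤d : 1 ≤ d
  1≤d = *-mono-≤ 1≤h 1≤v

  1≤a : 1 ≤ a
  1≤a = at-64 (1 ≤_) (≤ᵇ⇒≤ 1 64 tt)

  v≤d : v ≤ d
  v≤d = ≤-trans (≤-reflexive (sym (*-identityˡ v))) (*-monoˡ v 1≤h)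

  v≤h : v ≤ h
  v≤h = ≤-trans (≤-reflexive (sym (*-identityˡ v))) (*-monoˡ v (*-mono-≤ 1≤v 1≤v))

  s≤v : s ≤ v
  s≤v = begin
    s                ≡⟨ s≡ ⟩
    24 * a * i       ≤⟨ *-monoʳ (24 * a) i≤ii ⟩
    24 * a * (i * i) ≤⟨ below (24 * a) (≤L (at-64 (λ a → 24 * a ≤ 2 ^ 40) (≤ᵇ⇒≤ (24 * 64) (2 ^ 40) tt))) ⟩
    v                ∎

  28+128i≤v : 28 + 128 * i ≤ v
  28+128i≤v = begin
    28 + 128 * i   ≤⟨ affine 28 128 ⟩
    156 * i        ≤⟨ *-monoʳ 156 i≤ii ⟩
    156 * (i * i)  ≤⟨ below 156 (≤L (≤ᵇ⇒≤ 156 (2 ^ 40) tt)) ⟩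
    v              ∎

  1≤s : 1 ≤ s
  1≤s = *-mono-≤ {1} {3} (s≤s z≤n) (*-mono-≤ {1} {2} (s≤s z≤n) (*-mono-≤ (*-mono-≤ {1} {4} (s≤s z≤n) 1≤a) 1≤i))

  1≤K : 1 ≤ K
  1≤K = *-mono-≤ (*-mono-≤ (*-mono-≤ {1} {16} (s≤s z≤n) 1≤a) 1≤s) 1≤d

  d≤K : d ≤ K
  d≤K = ≤-trans (≤-reflexive (sym (*-identityˡ d))) (*-monoˡ d (*-mono-≤ (*-mono-≤ {1} {16} (s≤s z≤n) 1≤a) 1≤s))

  2≤q : 2 ≤ q
  2≤q = *-mono-≤ (*-mono-≤ {2} {a} {1} {a} (at-64 (2 ≤_) (≤ᵇ⇒≤ 2 64 tt)) 1≤a) 1≤d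

  m≤qd : m ≤ q * d
  m≤qd = ≤-reflexive (trans m≡ (sym (*-assoc (a * a) d d)))

  16d≤q : 16 * d ≤ q
  16d≤q = *-monoˡ d (at-64 (λ a → 16 ≤ a * a) (≤ᵇ⇒≤ 16 (64 * 64) tt))

  light-increment : 3 * s * (2 * h + 3 * s) ≤ 2 * (8 * s * h)
  light-increment = begin
    3 * s * (2 * h + 3 * s) ≤⟨ *-monoʳ (3 * s) (+-monoʳ-≤ (2 * h) (*-monoʳ 3 (≤-trans s≤v v≤h))) ⟩
    3 * s * (2 * h + 3 * h) ≤⟨ m≤m+n _ (s * h) ⟩
    3 * s * (2 * h + 3 * h) + s * h ≡⟨ e s h ⟩
    2 * (8 * s * h)         ∎
    where
    e : ∀ s h → 3 * s * (2 * h + 3 * h) + s * h ≡ 2 * (8 * s * h)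
    e = solve-∀

  -- Large enough to absorb the drifts, and above the order K log m of the union bounds over
  -- families. They are also used as `X₂` and `X₃`: deviations as large as the drift are affordable.
  Y₂ Y₃ : ℕ
  Y₂ = 16 * a * s * (d * v)
  Y₃ = 4 * a * (d * d)

  light-drift : K * (2 * (K * (8 * d)) + 3 * s * m) ≤ 8 * s * h * q * Y₂
  light-drift = begin
    K * (2 * (K * (8 * d)) + 3 * s * m)                ≡⟨ cong (λ z → K * (2 * (K * (8 * d)) + 3 * s * z)) m≡ ⟩
    K * (2 * (K * (8 * d)) + 3 * s * (a * a * (d * d))) ≡⟨ e₁ a s d ⟩
    a * a * s * s * d * d * d * (4096 + 48 * a)
      ≤⟨ *-monoʳ (a * a * s * s * d * d * d) (at-64 (λ a → 4096 + 48 * a ≤ 128 * a) (≤ᵇ⇒≤ (4096 + 48 * 64) (128 * 64) tt)) ⟩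
    a * a * s * s * d * d * d * (128 * a)              ≡⟨ e₂ a s d h v ⟩
    8 * s * h * q * Y₂                                 ∎
    where
    e₁ : ∀ a s d → 16 * a * s * d * (2 * (16 * a * s * d * (8 * d)) + 3 * s * (a * a * (d * d)))
      ≡ a * a * s * s * d * d * d * (4096 + 48 * a)
    e₁ = solve-∀
    e₂ : ∀ a s d h v → a * a * s * s * d * d * (h * v) * (128 * a) ≡ 8 * s * h * (a * a * d) * (16 * a * s * (d * v))
    e₂ = solve-∀

  mixed-increment : 3 * s * (3 * s) ≤ 2 * (8 * s * s)
  mixed-increment = ≤-trans (m≤m+n _ (7 * (s * s))) (≤-reflexive (e s))
    where
    e : ∀ s → 3 * s * (3 * s) + 7 * (s * s) ≡ 2 * (8 * s * s)
    e = solve-∀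

  mixed-drift : K * (K * (8 * d)) ≤ 8 * s * s * q * Y₃
  mixed-drift = begin
    K * (K * (8 * d))                            ≡⟨ e₁ a s d ⟩
    a * a * s * s * d * d * d * 2048
      -- The tightest demand on `a`: 2048 is exactly 32 · 64.
      ≤⟨ *-monoʳ (a * a * s * s * d * d * d) (at-64 (λ a → 2048 ≤ 32 * a) (≤ᵇ⇒≤ 2048 (32 * 64) tt)) ⟩
    a * a * s * s * d * d * d * (32 * a)         ≡⟨ e₂ a s d ⟩
    8 * s * s * q * Y₃                           ∎
    where
    e₁ : ∀ a s d → 16 * a * s * d * (16 * a * s * d * (8 * d)) ≡ a * a * s * s * d * d * d * 2048
    e₁ = solve-∀
    e₂ : ∀ a s d → a * a * s * s * d * d * d * (32 * a) ≡ 8 * s * s * (a * a * d) * (4 * a * (d * d))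
    e₂ = solve-∀

  t : ℕ
  t = 32 * a * s * v

  2K≤th : 2 * K ≤ t * h
  2K≤th = ≤-reflexive (e a s h v)
    where
    e : ∀ a s h v → 2 * (16 * a * s * (h * v)) ≡ 32 * a * s * v * h
    e = solve-∀

  heavy-overlaps : t * t * (s * (4 * suc κ₀)) ≤ K
  heavy-overlaps = begin
    t * t * (s * (4 * suc κ₀))                             ≡⟨ e₁ a s v (suc κ₀) ⟩
    16 * a * s * (v * v) * (256 * a * s * suc κ₀ * s)      ≤⟨ *-monoʳ (16 * a * s * (v * v)) (*-mono-≤ le s≤v) ⟩
    16 * a * s * (v * v) * (v * v)                         ≡⟨ e₂ a s v ⟩
    K                                                      ∎
    where
    le : 256 * a * s * suc κ₀ ≤ v
    le = begin
      256 * a * s * suc κ₀                  ≤⟨ *-mono-≤ (≤-reflexive (cong (256 * a *_) s≡)) (≤-trans (≤-reflexive (cong suc κ₀≡)) (affine 41 192)) ⟩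
      256 * a * (24 * a * i) * (233 * i)    ≡⟨ e a i ⟩
      256 * a * 24 * a * 233 * (i * i)
        ≤⟨ below (256 * a * 24 * a * 233) (≤L (at-64 (λ a → 256 * a * 24 * a * 233 ≤ 2 ^ 40) (≤ᵇ⇒≤ (256 * 64 * 24 * 64 * 233) (2 ^ 40) tt))) ⟩
      v                                     ∎
      where
      e : ∀ a i → 256 * a * (24 * a * i) * (233 * i) ≡ 256 * a * 24 * a * 233 * (i * i)
      e = solve-∀
    e₁ : ∀ a s v k → 32 * a * s * v * (32 * a * s * v) * (s * (4 * k)) ≡ 16 * a * s * (v * v) * (256 * a * s * k * s)
    e₁ = solve-∀
    e₂ : ∀ a s v → 16 * a * s * (v * v) * (v * v) ≡ 16 * a * s * (v * v * v * v)
    e₂ = solve-∀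

  blocked-total : 8 * (3 * (K * s) + (4 * (8 * s * h) * (Y₂ + Y₂) + s * (8 * d) * (2 * K)) + 2 * (4 * (8 * s * s) * (Y₃ + Y₃))) ≤ K * K
  blocked-total = begin
    8 * (3 * (K * s) + (4 * (8 * s * h) * (Y₂ + Y₂) + s * (8 * d) * (2 * K)) + 2 * (4 * (8 * s * s) * (Y₃ + Y₃)))
      ≡⟨ e₁ a s h v ⟩
    a * s * s * d * (384 * 1 + 14336 * d)    ≤⟨ *-monoʳ (a * s * s * d) (+-monoˡ-≤ (14336 * d) (*-monoʳ 384 1≤d)) ⟩
    a * s * s * d * (384 * d + 14336 * d)    ≡⟨ e₂ a s d ⟩
    a * s * s * d * d * 14720
      ≤⟨ *-monoʳ (a * s * s * d * d) (at-64 (λ a → 14720 ≤ 256 * a) (≤ᵇ⇒≤ 14720 (256 * 64) tt)) ⟩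
    a * s * s * d * d * (256 * a)            ≡⟨ e₃ a s d ⟩
    K * K                                    ∎
    where
    e₁ : ∀ a s h v → 8 * (3 * (16 * a * s * (h * v) * s) + (4 * (8 * s * h) * (16 * a * s * (h * v * v) + 16 * a * s * (h * v * v))
      + s * (8 * (h * v)) * (2 * (16 * a * s * (h * v)))) + 2 * (4 * (8 * s * s) * (4 * a * (h * v * (h * v)) + 4 * a * (h * v * (h * v)))))
      ≡ a * s * s * (h * v) * (384 * 1 + 14336 * (h * v))
    e₁ = solve-∀
    e₂ : ∀ a s d → a * s * s * d * (384 * d + 14336 * d) ≡ a * s * s * d * d * 14720
    e₂ = solve-∀
    e₃ : ∀ a s d → a * s * s * d * d * (256 * a) ≡ 16 * a * s * d * (16 * a * s * d)
    e₃ = solve-∀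

  W : ℕ
  W = suc M

  m^K : m ^ K ≡ 2 ^ (W * K)
  m^K = ^-*-assoc 2 W K

  2W+4≤ : ∀ {X} → K * (28 + 128 * i) ≤ X → m * m ^ K * 16 ≤ 2 ^ X
  2W+4≤ {X} le = begin
    m * m ^ K * 16              ≡⟨ cong (λ z → m * z * 16) m^K ⟩
    2 ^ W * 2 ^ (W * K) * 2 ^ 4 ≡⟨ trans (cong (_* 16) (pow-* W (W * K))) (pow-* (W + W * K) 4) ⟩
    2 ^ (W + W * K + 4)         ≤⟨ ^-monoʳ-≤ 2 (begin
      W + W * K + 4               ≡⟨ e₀ W (W * K) ⟩
      (W + 4) * 1 + W * K         ≤⟨ +-monoˡ-≤ (W * K) (*-monoʳ (W + 4) 1≤K) ⟩
      (W + 4) * K + W * K         ≡⟨ cong (λ w → (w + 4) * K + w * K) M≡ ⟩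
      (12 + 64 * i + 4) * K + (12 + 64 * i) * K ≡⟨ e K i ⟩
      K * (28 + 128 * i)          ≤⟨ le ⟩
      X                           ∎) ⟩
    2 ^ X                       ∎
    where
    e₀ : ∀ M x → M + x + 4 ≡ (M + 4) * 1 + x
    e₀ = solve-∀
    e : ∀ K i → (12 + 64 * i + 4) * K + (12 + 64 * i) * K ≡ K * (28 + 128 * i)
    e = solve-∀

  degree-union : m * m * 16 ≤ 2 ^ d
  degree-union = begin
    m * m * 16        ≡⟨ trans (cong (_* 16) (pow-* W W)) (pow-* (W + W) 4) ⟩
    2 ^ (W + W + 4)   ≤⟨ ^-monoʳ-≤ 2 (≤-trans (≤-reflexive (trans (cong (λ w → w + w + 4) M≡) (e i))) (≤-trans 28+128i≤v v≤d)) ⟩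
    2 ^ d             ∎
    where
    e : ∀ i → 12 + 64 * i + (12 + 64 * i) + 4 ≡ 28 + 128 * i
    e = solve-∀

  codegree-union : m * (m * m) * 16 ≤ 2 ^ κ₀
  codegree-union = ≤-reflexive (trans (cong (λ z → m * z * 16) (pow-* W W)) (trans (cong (_* 16) (pow-* W (W + W)))
    (trans (pow-* (W + (W + W)) 4) (cong (2 ^_) (trans (cong (λ w → w + (w + w) + 4) M≡) (trans (e i) (sym κ₀≡)))))))
    where
    e : ∀ i → 12 + 64 * i + (12 + 64 * i + (12 + 64 * i)) + 4 ≡ 40 + 192 * i
    e = solve-∀

  light-union : m * m ^ K * 16 ≤ 2 ^ Y₂
  light-union = 2W+4≤ (begin
    K * (28 + 128 * i)     ≤⟨ *-monoʳ K 28+128i≤v ⟩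
    K * v                  ≡⟨ *-assoc (16 * a * s) d v ⟩
    Y₂                     ∎)

  mixed-union : m * m ^ K * 16 ≤ 2 ^ Y₃
  mixed-union = 2W+4≤ (begin
    K * (28 + 128 * i)                 ≡⟨ e a s d (28 + 128 * i) ⟩
    4 * a * d * (4 * s * (28 + 128 * i)) ≤⟨ *-monoʳ (4 * a * d) le ⟩
    4 * a * d * d                      ≡⟨ *-assoc (4 * a) d d ⟩
    Y₃                                 ∎)
    where
    e : ∀ a s d x → 16 * a * s * d * x ≡ 4 * a * d * (4 * s * x)
    e = solve-∀
    le : 4 * s * (28 + 128 * i) ≤ d
    le = begin
      4 * s * (28 + 128 * i)          ≤⟨ *-mono-≤ (≤-reflexive (cong (4 *_) s≡)) (affine 28 128) ⟩
      4 * (24 * a * i) * (156 * i)    ≡⟨ e′ a i ⟩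
      4 * 24 * a * 156 * (i * i)      ≤⟨ below (4 * 24 * a * 156) (≤L (at-64 (λ a → 4 * 24 * a * 156 ≤ 2 ^ 40) (≤ᵇ⇒≤ (4 * 24 * 64 * 156) (2 ^ 40) tt))) ⟩
      v                               ≤⟨ v≤d ⟩
      d                               ∎
      where
      e′ : ∀ a i → 4 * (24 * a * i) * (156 * i) ≡ 4 * 24 * a * 156 * (i * i)
      e′ = solve-∀

  -- A leaf costs log N ≤ 21 + 65i bits in the union bound, which 96i exceeds with room for the
  -- centre. The factor 96 also makes 4 q μ equal to K².
  μ : ℕ
  μ = 96 * i * K

  4qμ≤KK : 4 * (q * μ) ≤ K * K
  4qμ≤KK = ≤-reflexive (trans (e a d i K) (cong (λ z → 16 * a * z * d * K) (sym s≡)))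
    where
    e : ∀ a d i K → 4 * (a * a * d * (96 * i * K)) ≡ 16 * a * (24 * a * i) * d * K
    e = solve-∀

  survival-union : ∀ {N} → N ≤ m * (2 * σ) → N * N ^ K * 8 ≤ 2 ^ μ
  survival-union {N} N≤ = begin
    N * N ^ K * 8                 ≤⟨ *-monoˡ 8 (*-mono-≤ N≤2^ν (^-monoˡ-≤ K N≤2^ν)) ⟩
    2 ^ ν * (2 ^ ν) ^ K * 2 ^ 3   ≡⟨ cong (λ z → 2 ^ ν * z * 8) (^-*-assoc 2 ν K) ⟩
    2 ^ ν * 2 ^ (ν * K) * 2 ^ 3   ≡⟨ trans (cong (_* 8) (pow-* ν (ν * K))) (pow-* (ν + ν * K) 3) ⟩
    2 ^ (ν + ν * K + 3)           ≤⟨ ^-monoʳ-≤ 2 (begin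
      ν + ν * K + 3                 ≡⟨ e₁ ν (ν * K) ⟩
      ν + 3 + ν * K                 ≤⟨ +-monoˡ-≤ (ν * K) (≤-trans (≤-trans (≤-reflexive (cong (_+ 3) ν≡)) 24+65i≤v) (≤-trans v≤d d≤K)) ⟩
      suc ν * K                     ≤⟨ *-monoˡ K (≤-trans (≤-reflexive (cong suc ν≡)) (≤-trans (affine 22 65) (*-monoˡ i (≤ᵇ⇒≤ 87 96 tt)))) ⟩
      96 * i * K                    ∎) ⟩
    2 ^ μ                         ∎
    where
    24+65i≤v : 21 + 65 * i + 3 ≤ v
    24+65i≤v = ≤-trans (≤-reflexive (+-comm (21 + 65 * i) 3)) (≤-trans (affine 24 65) (≤-trans (*-monoʳ 89 i≤ii) (below 89 (≤L (≤ᵇ⇒≤ 89 (2 ^ 40) tt)))))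
    e₁ : ∀ n x → n + x + 3 ≡ n + 3 + x
    e₁ = solve-∀
    σ≤ : 2 * σ ≤ 2 ^ (9 + i)
    σ≤ = begin
      2 * σ             ≡⟨ *-assoc 2 (4 * a) i ⟨
      2 * (4 * a) * i   ≤⟨ *-mono-≤ (at-64 (λ a → 2 * (4 * a) ≤ 2 ^ 9) (≤ᵇ⇒≤ (2 * (4 * 64)) (2 ^ 9) tt)) (n≤2^n i) ⟩
      2 ^ 9 * 2 ^ i     ≡⟨ pow-* 9 i ⟩
      2 ^ (9 + i)       ∎
    N≤2^ν : N ≤ 2 ^ ν
    N≤2^ν = begin
      N                    ≤⟨ N≤ ⟩
      m * (2 * σ)          ≤⟨ *-monoʳ m σ≤ ⟩
      2 ^ W * 2 ^ (9 + i)  ≡⟨ pow-* W (9 + i) ⟩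
      2 ^ (W + (9 + i))    ≡⟨ cong (2 ^_) (trans (cong (_+ (9 + i)) M≡) (trans (e i) (sym ν≡))) ⟩
      2 ^ ν                ∎
      where
      e : ∀ i → 12 + 64 * i + (9 + i) ≡ 21 + 65 * i
      e = solve-∀

  bKσ≤m : v * K * (2 * σ) ≤ m
  bKσ≤m = begin
    v * K * (2 * σ)                       ≡⟨ e₁ v a s d i ⟩
    a * a * d * v * (128 * s * i)         ≤⟨ *-monoʳ (a * a * d * v) le ⟩
    a * a * d * v * h                     ≡⟨ e₂ a d v h ⟩
    a * a * (d * d)                       ≡⟨ m≡ ⟨
    m                                     ∎
    where
    e₁ : ∀ v a s d i → v * (16 * a * s * d) * (2 * (4 * a * i)) ≡ a * a * d * v * (128 * s * i)
    e₁ = solve-∀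
    e₂ : ∀ a d v h → a * a * d * v * h ≡ a * a * (d * (h * v))
    e₂ = solve-∀
    le : 128 * s * i ≤ h
    le = begin
      128 * s * i              ≡⟨ cong (λ z → 128 * z * i) s≡ ⟩
      128 * (24 * a * i) * i   ≡⟨ e′ a i ⟩
      128 * 24 * a * (i * i)   ≤⟨ below (128 * 24 * a) (≤L (at-64 (λ a → 128 * 24 * a ≤ 2 ^ 40) (≤ᵇ⇒≤ (128 * 24 * 64) (2 ^ 40) tt))) ⟩
      v                        ≤⟨ v≤h ⟩
      h                        ∎
      where
      e′ : ∀ a i → 128 * (24 * a * i) * i ≡ 128 * 24 * a * (i * i)
      e′ = solve-∀

  fibre-union : m * 4 ^ (2 * σ) * 4 ≤ 2 ^ (3 * (2 * σ))
  fibre-union = begin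
    m * 4 ^ (2 * σ) * 4             ≡⟨ cong (λ z → m * z * 4) (^-*-assoc 2 2 (2 * σ)) ⟩
    2 ^ W * 2 ^ (2 * (2 * σ)) * 2 ^ 2 ≡⟨ trans (cong (_* 4) (pow-* W (2 * (2 * σ)))) (pow-* (W + 2 * (2 * σ)) 2) ⟩
    2 ^ (W + 2 * (2 * σ) + 2)       ≤⟨ ^-monoʳ-≤ 2 (begin
      W + 2 * (2 * σ) + 2             ≡⟨ e W (2 * (2 * σ)) ⟩
      W + 2 + 2 * (2 * σ)             ≤⟨ +-monoˡ-≤ (2 * (2 * σ)) le ⟩
      2 * σ + 2 * (2 * σ)             ≡⟨⟩
      3 * (2 * σ)                     ∎) ⟩
    2 ^ (3 * (2 * σ))               ∎
    where
    e : ∀ w x → w + x + 2 ≡ w + 2 + x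
    e = solve-∀
    le : W + 2 ≤ 2 * σ
    le = begin
      W + 2            ≡⟨ trans (cong (_+ 2) M≡) (+-comm (12 + 64 * i) 2) ⟩
      14 + 64 * i      ≤⟨ affine 14 64 ⟩
      78 * i           ≤⟨ *-monoˡ i (at-64 (λ a → 78 ≤ 2 * (4 * a)) (≤ᵇ⇒≤ 78 (2 * (4 * 64)) tt)) ⟩
      2 * (4 * a) * i  ≡⟨ *-assoc 2 (4 * a) i ⟩
      2 * σ            ∎

  -- Origin of the factor 20: a red and a blue family together cost at most 160i bits per cluster,
  -- while each trapped vertex gains the factor v = 2^(8i).
  spread-union : m ^ K * m ^ K * 4 ^ K * 4 ≤ suc v ^ (20 * K)
  spread-union = begin
    m ^ K * m ^ K * 4 ^ K * 4
      ≡⟨ cong₂ (λ x y → x * x * y * 4) m^K (^-*-assoc 2 2 K) ⟩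
    2 ^ (W * K) * 2 ^ (W * K) * 2 ^ (2 * K) * 2 ^ 2
      ≡⟨ trans (cong (λ z → z * 2 ^ (2 * K) * 4) (pow-* (W * K) (W * K))) (trans (cong (_* 4) (pow-* (W * K + W * K) (2 * K))) (pow-* (W * K + W * K + 2 * K) 2)) ⟩
    2 ^ (W * K + W * K + 2 * K + 2)
      ≤⟨ ^-monoʳ-≤ 2 (begin
        W * K + W * K + 2 * K + 2 * 1 ≤⟨ +-monoʳ-≤ (W * K + W * K + 2 * K) (*-monoʳ 2 1≤K) ⟩
        W * K + W * K + 2 * K + 2 * K ≡⟨ trans (cong (λ w → w * K + w * K + 2 * K + 2 * K) M≡) (e₁ i K) ⟩
        (28 + 128 * i) * K            ≤⟨ *-monoˡ K (≤-trans (affine 28 128) (*-monoˡ i (≤ᵇ⇒≤ 156 160 tt))) ⟩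
        160 * i * K                   ≡⟨ e₂ i K ⟩
        8 * i * (20 * K)              ∎) ⟩
    2 ^ (8 * i * (20 * K))  ≡⟨ ^-*-assoc 2 (8 * i) (20 * K) ⟨
    v ^ (20 * K)            ≤⟨ ^-monoˡ-≤ (20 * K) (n≤1+n v) ⟩
    suc v ^ (20 * K)        ∎
    where
    e₁ : ∀ i K → (12 + 64 * i) * K + (12 + 64 * i) * K + 2 * K + 2 * K ≡ (28 + 128 * i) * K
    e₁ = solve-∀
    e₂ : ∀ i K → 160 * i * K ≡ 8 * i * (20 * K)
    e₂ = solve-∀

-- From the scales indexed by `i` to all large `N`

clusters : ℕ → ℕ → ℕ
clusters a i = 16 * a * (24 * a * i) * 2 ^ (32 * i)

capacity : ℕ → ℕ → ℕ
capacity a i = 2 ^ (12 + 64 * i) * (2 * (4 * a * i))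

StarFree : ℕ → ℕ → Set₁
StarFree N k = Σ[ H ∈ 3Graph (Fin N) ] K₄⁻-free H × (∀ n → k < n → ¬ (Star n ⊆ complement H))

construction : ∀ a i L M κ₀ ν → a ≡ 64 → L ≡ 2 ^ 40 → suc M ≡ 12 + 64 * i → κ₀ ≡ 40 + 192 * i → ν ≡ 21 + 65 * i →
  7 ≤ i → ∀ N → N ≤ capacity a i → StarFree N (20 * clusters a i)
construction a i L M κ₀ ν a≡64 L≡ M≡ κ₀≡ ν≡ 7≤i N N≤ = subst (λ K → StarFree N (20 * K)) K≡clusters
  (Assembly.star-free parameters Part.πr Part.πb (20 * K)
    (λ x → ≤-trans (Part.πr-fibres x) (m≤m+n (2 * σ) _)) Part.πb-fibres Part.untrapped)
  where
  open Numbers a i L M κ₀ ν a≡64 L≡ M≡ κ₀≡ ν≡ 7≤i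

  N≤mσ : N ≤ m * (2 * σ)
  N≤mσ = subst (λ w → N ≤ 2 ^ w * (2 * σ)) (sym M≡) N≤

  instance
    a≢0 : NonZero a
    a≢0 = subst NonZero (sym a≡64) _

    σ≢0 : NonZero σ
    σ≢0 = m*n≢0 (4 * a) i {{m*n≢0 4 a}} {{>-nonZero 1≤i}}

    v≢0 : NonZero v
    v≢0 = m^n≢0 2 (8 * i)

    m′≢0 : NonZero m′
    m′≢0 = m^n≢0 2 M

    s≢0 : NonZero s
    s≢0 = >-nonZero 1≤s

    h≢0 : NonZero h
    h≢0 = m*n≢0 (v * v) v {{m*n≢0 v v}}

    q≢0 : NonZero q
    q≢0 = >-nonZero (≤-trans (s≤s z≤n) 2≤q)

  q≡ : q ≡ suc (pred q)
  q≡ = sym (suc-pred q)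

  parameters : Parameters
  parameters = record
    { m = m ; q′ = pred q ; d = d ; s = s ; h = h ; K = K ; t = t ; κ₀ = κ₀
    ; h₂ = 8 * s * h ; X₂ = Y₂ ; Y₂ = Y₂ ; h₃ = 8 * s * s ; X₃ = Y₃ ; Y₃ = Y₃ ; N = N ; μ = μ
    ; q′≢0 = >-nonZero (s≤s⁻¹ (≤-trans 2≤q (≤-reflexive q≡)))
    ; t≢0 = m*n≢0 (32 * a * s) v {{m*n≢0 (32 * a) s {{m*n≢0 32 a}}}}
    ; h₂≢0 = m*n≢0 (8 * s) h {{m*n≢0 8 s}}
    ; h₃≢0 = m*n≢0 (8 * s) s {{m*n≢0 8 s}}
    ; 1≤s = 1≤s
    ; m≤qd = subst (λ q → m ≤ q * d) q≡ m≤qd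
    ; 16d≤q = subst (16 * d ≤_) q≡ 16d≤q
    ; light-increment = light-increment
    ; light-drift = subst (λ q → K * (2 * (K * (8 * d)) + 3 * s * m) ≤ 8 * s * h * q * Y₂) q≡ light-drift
    ; mixed-increment = mixed-increment
    ; mixed-drift = subst (λ q → K * (K * (8 * d)) ≤ 8 * s * s * q * Y₃) q≡ mixed-drift
    ; 2K≤th = 2K≤th
    ; heavy-overlaps = heavy-overlaps
    ; blocked-total = blocked-total
    ; degree-union = degree-union
    ; codegree-union = codegree-union
    ; light-union = light-union
    ; mixed-union = mixed-union
    ; survival-union = survival-union N≤mσ
    ; 4qμ≤KK = subst (λ q → 4 * (q * μ) ≤ K * K) q≡ 4qμ≤KK
    }

  module Part = Partitions N m′ σ v K (20 * K) N≤mσ bKσ≤m fibre-union spread-union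

  K≡clusters : K ≡ clusters a i
  K≡clusters = cong₂ (λ x y → 16 * a * x * y) s≡ d-power

bracket : ∀ (F : ℕ → ℕ) N c b → F c < N → N ≤ F (c + b) → ∃[ i ] (c ≤ i × F i < N × N ≤ F (suc i))
bracket F N c zero    lt le = ⊥-elim (<⇒≱ lt (subst (λ z → N ≤ F z) (+-identityʳ c) le))
bracket F N c (suc b) lt le with N ≤? F (c + b)
... | yes p = bracket F N c b lt p
... | no ¬p = c + b , m≤m+n c b , ≰⇒> ¬p , subst (λ z → N ≤ F z) (+-suc c b) le

module Bounds (a R : ℕ) (a≡64 : a ≡ 64) (R≡ : R ≡ 2 ^ 32) where

  open ≤-Reasoning

  -- From `i` to `suc i` the number of leaves grows by at most the factor 2 · 2^32, the price of
  -- serving every `N` between two capacities by the larger scale. Having 21 instead of 20 absorbs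
  -- the successor in `suc n`.
  p : ℕ
  p = 21 * (16 * a * (24 * a * 2) * R)

  1≤a : 1 ≤ a
  1≤a = subst (1 ≤_) (sym a≡64) (s≤s z≤n)

  0<p : 0 < p
  0<p = *-mono-≤ {1} {21} (s≤s z≤n) (*-mono-≤ (*-mono-≤ (*-mono-≤ {1} {16} (s≤s z≤n) 1≤a)
    (*-mono-≤ (*-mono-≤ {1} {24} (s≤s z≤n) 1≤a) (s≤s z≤n))) (subst (1 ≤_) (sym R≡) (m^n>0 2 32)))

  clusters≤ : ∀ i → 1 ≤ i → 21 * clusters a (suc i) ≤ p * (i * 2 ^ (32 * i))
  clusters≤ i 1≤i = begin
    21 * (16 * a * (24 * a * suc i) * 2 ^ (32 * suc i))
      ≡⟨ cong (λ z → 21 * (16 * a * (24 * a * suc i) * z)) (trans (cong (2 ^_) (*-suc 32 i)) (trans (^-distribˡ-+-* 2 32 (32 * i)) (cong (_* 2 ^ (32 * i)) (sym R≡)))) ⟩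
    21 * (16 * a * (24 * a * suc i) * (R * x))
      ≤⟨ *-monoʳ 21 (*-monoˡ (R * x) (*-monoʳ (16 * a) (*-monoʳ (24 * a) (+-monoˡ-≤ i 1≤i)))) ⟩
    21 * (16 * a * (24 * a * (i + i)) * (R * x))
      ≡⟨ e a i R x ⟩
    p * (i * x) ∎
    where
    x = 2 ^ (32 * i)
    e : ∀ a i R x → 21 * (16 * a * (24 * a * (i + i)) * (R * x)) ≡ 21 * (16 * a * (24 * a * 2) * R) * (i * x)
    e = solve-∀

  i≤capacity : ∀ i → i ≤ capacity a i
  i≤capacity i = begin
    i                                    ≡⟨ *-identityˡ i ⟨
    1 * i                                ≤⟨ *-monoˡ i (*-mono-≤ {1} {2} (s≤s z≤n) (*-mono-≤ {1} {4} (s≤s z≤n) 1≤a)) ⟩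
    2 * (4 * a) * i                      ≡⟨ *-assoc 2 (4 * a) i ⟩
    2 * (4 * a * i)                      ≡⟨ *-identityˡ (2 * (4 * a * i)) ⟨
    1 * (2 * (4 * a * i))                ≤⟨ *-monoˡ (2 * (4 * a * i)) (m^n>0 2 (12 + 64 * i)) ⟩
    capacity a i                         ∎

  power≤capacity : ∀ i → i * 2 ^ (64 * i) ≤ capacity a i
  power≤capacity i = begin
    i * 2 ^ (64 * i)                     ≡⟨ *-comm i _ ⟩
    2 ^ (64 * i) * i                     ≤⟨ *-mono-≤ (^-monoʳ-≤ 2 (m≤n+m (64 * i) 12)) (begin
      i                                    ≡⟨ *-identityˡ i ⟨
      1 * i                                ≤⟨ *-monoˡ i (*-mono-≤ {1} {2} (s≤s z≤n) (*-mono-≤ {1} {4} (s≤s z≤n) 1≤a)) ⟩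
      2 * (4 * a) * i                      ≡⟨ *-assoc 2 (4 * a) i ⟩
      2 * (4 * a * i)                      ∎) ⟩
    capacity a i                         ∎

  -- By contraposition: N ≥ i 2^(64i) and log N ≥ i give N log N ≥ (i 2^(32i))², and a star with too
  -- few vertices has suc n ≤ p i 2^(32i).
  large : ∀ {N i} → 1 ≤ i → capacity a i < N → ∀ n →
    p * p * N * ⌊log₂ N ⌋ < 1 * 1 * (suc n * suc n) → 20 * clusters a (suc i) < n
  large {N} {i} 1≤i lt n cond = ≰⇒> λ n≤ → <⇒≱ cond (begin
    1 * 1 * (suc n * suc n)        ≡⟨ *-identityˡ (suc n * suc n) ⟩
    suc n * suc n                  ≤⟨ *-mono-≤ (n≤py n≤) (n≤py n≤) ⟩
    p * y * (p * y)                ≡⟨ e₁ p i x ⟩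
    p * p * (i * (x * x)) * i      ≤⟨ *-mono-≤ (*-monoʳ (p * p) i2^≤N) i≤log ⟩
    p * p * N * ⌊log₂ N ⌋          ∎)
    where
    x = 2 ^ (32 * i)
    y = i * x
    xx : x * x ≡ 2 ^ (64 * i)
    xx = trans (sym (^-distribˡ-+-* 2 (32 * i) (32 * i))) (cong (2 ^_) (sym (*-distribʳ-+ i 32 32)))
    i2^≤N : i * (x * x) ≤ N
    i2^≤N = ≤-trans (≤-reflexive (cong (i *_) xx)) (≤-trans (power≤capacity i) (<⇒≤ lt))
    i≤log : i ≤ ⌊log₂ N ⌋
    i≤log = begin
      i                        ≤⟨ m≤m+n i (63 * i) ⟩
      64 * i                   ≡⟨ ⌊log₂[2^n]⌋≡n (64 * i) ⟨
      ⌊log₂ 2 ^ (64 * i) ⌋     ≤⟨ ⌊log₂⌋-mono-≤ (≤-trans (≤-trans (≤-reflexive (sym (*-identityˡ _))) (*-monoˡ (2 ^ (64 * i)) 1≤i))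
                                    (≤-trans (power≤capacity i) (<⇒≤ lt))) ⟩
      ⌊log₂ N ⌋                ∎
    1≤clusters : 1 ≤ clusters a (suc i)
    1≤clusters = *-mono-≤ (*-mono-≤ (*-mono-≤ {1} {16} (s≤s z≤n) 1≤a) (*-mono-≤ (*-mono-≤ {1} {24} (s≤s z≤n) 1≤a) (s≤s z≤n))) (m^n>0 2 (32 * suc i))
    n≤py : n ≤ 20 * clusters a (suc i) → suc n ≤ p * y
    n≤py n≤ = ≤-trans (+-mono-≤ 1≤clusters n≤) (clusters≤ i 1≤i)
    e₁ : ∀ p i x → p * (i * x) * (p * (i * x)) ≡ p * p * (i * (x * x)) * i
    e₁ = solve-∀

main : ∀ a L R → a ≡ 64 → L ≡ 2 ^ 40 → R ≡ 2 ^ 32 →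
  ∃[ p ] ∃[ q ] (0 < p × 0 < q × ∃[ N₀ ] (∀ N → N₀ ≤ N →
    Σ (3Graph (Fin N)) λ H → K₄⁻-free H ×
    (∀ n → p * p * N * ⌊log₂ N ⌋ < q * q * (suc n * suc n) →
    ¬ (Star n ⊆ complement H))))
-- The constant is the integer `p`, so the denominator is 1; starting beyond the capacity of scale 7
-- provides `7≤i`.
main a L R a≡64 L≡ R≡ = p , 1 , 0<p , s≤s z≤n , suc (capacity a 7) , witness
  where
  open Bounds a R a≡64 R≡
  witness : ∀ N → suc (capacity a 7) ≤ N → Σ (3Graph (Fin N)) λ H → K₄⁻-free H ×
    (∀ n → p * p * N * ⌊log₂ N ⌋ < 1 * 1 * (suc n * suc n) → ¬ (Star n ⊆ complement H))
  witness N N₀≤N =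
    let (i , 7≤i , lt , le) = bracket (capacity a) N 7 N N₀≤N (≤-trans (m≤n+m N 7) (i≤capacity (7 + N)))
        (H , free , no-star) = construction a (suc i) L (11 + 64 * suc i) (40 + 192 * suc i) (21 + 65 * suc i) a≡64 L≡ refl refl refl
          (≤-trans 7≤i (n≤1+n i)) N le
    in H , free , λ n cond → no-star n (large (≤-trans (s≤s z≤n) 7≤i) lt n cond)

theorem1p1 : ∃[ p ] ∃[ q ] (0 < p × 0 < q × ∃[ N₀ ] (∀ N → N₀ ≤ N →
    Σ (3Graph (Fin N)) λ H → K₄⁻-free H ×
    (∀ n → p * p * N * ⌊log₂ N ⌋ < q * q * (suc n * suc n) →
    ¬ (Star n ⊆ complement H))))
theorem1p1 = main 64 (2 ^ 40) (2 ^ 32) refl refl refl
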